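{- Let $p$ be a prime greater than $5$. Then $$\sum_{k=0}^{[p/3]}\frac{(3k)!}{54^k\,k!^3}\equiv\begin{cases}0\pmod p&\text{if }6\mid p-5,\\ 2A\pmod p&\text{if }6\mid p-1\text{ and }p=A^2+3B^2\text{ with }A,B\in\mathbb Z,\ 3\mid A-1,\end{cases}$$ and $$\sum_{k=0}^{[p/3]}\frac{k\,(3k)!}{54^k\,k!^3}\equiv\begin{cases}0\pmod p&\text{if }6\mid p-1,\\ \frac13(-1)^{\frac{p+1}6}2^{ -\frac{p+1}3}\binom{(p+1)/3}{(p+1)/6}\pmod p&\text{if }6\mid p-5.\end{cases}$$
   Context: $[y]$ is the greatest integer not exceeding $y$. Congruences are between rational numbers whose denominators are prime to $p$. -}

module Defs where

open import Data.Fin.Base using (toℕ)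
open import Data.Integer.Base using (+_)
open import Data.Integer.Divisibility using (_∣_)
open import Data.Nat.Base using (ℕ; suc; _*_; _^_; _!; NonZero)
open import Data.Nat.Coprimality using (Coprime)
open import Data.Nat.Properties using (m*n≢0; m^n≢0; _!≢0)
open import Data.Rational.Base as ℚ using (ℚ; ↥_; ↧ₙ_)
open import Algebra.Definitions.RawMonoid ℚ.+-0-rawMonoid using (sum)
open import Algebra.Definitions.RawSemiring ℚ.+-*-rawSemiring public using () renaming (_^_ to _^ℚ_)

infix 4 _≡_[mod_]

-- Elements of ℚ are in lowest terms, so ↧ₙ and ↥ are the reduced
-- denominator and numerator.  The congruence asserts that both of its
-- sides have denominators prime to the modulus.
record _≡_[mod_] (x y : ℚ) (m : ℕ) : Set where
  field
    coprimeˡ  : Coprime (↧ₙ x) m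
    coprimeʳ  : Coprime (↧ₙ y) m
    m∣x-y     : + m ∣ ↥ (x ℚ.- y)

∑≤ : ℕ → (ℕ → ℚ) → ℚ
∑≤ n f = sum {suc n} (λ i → f (toℕ i))

infix 5 ∑≤
syntax ∑≤ n (λ k → e) = ∑[ k ≤ n ] e

54^k*k!³≢0 : ∀ k → NonZero (54 ^ k * (k !) ^ 3)
54^k*k!³≢0 k = m*n≢0 (54 ^ k) ((k !) ^ 3) {{m^n≢0 54 k}} {{m^n≢0 (k !) 3 {{k !≢0}}}}

{-# OPTIONS --safe #-}
module Submission where

-- Write H for the inverse of 2 modulo p and n = [p/3].  Modulo p the k-th summand is
-- C(n,k) C(n+k,k) (−H)ᵏ, so the first sum is the Legendre value Pₙ(0) and the second one is −Pₙ′(0).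
-- Since C(n+k,n) = [yⁿ](1+y)ⁿ⁺ᵏ, these are Hⁿ [yⁿ](1−y²)ⁿ and −n Hⁿ [yⁿ](1+y)²(1−y²)ⁿ⁻¹; coefficients
-- are read off modulo p from the power sums Σ yʲ over the residues.
-- For p = 6m+1 it remains to see 2A ≡ C(3m,m).  With the quadratic character χ put
-- ψ(D) = Σ χ(x³+D), so that ψ(1) ≡ −C(3m,2m).  For D ≠ 0 the product χ(D)ψ(D) depends only on the coset of D
-- modulo cubes; orthogonality of χ shows that its three values have sum 0 and sum of squares 6p.  Hence
-- a = ψ(1) satisfies a² + ab + b² = 3p, and a is even, which makes a/2 the first entry of a
-- representation p = x² + 3y².  Such a representation is unique up to signs, and
-- a ≡ 1 (mod 3) gives a = −2A.

-- Since (3k)!/(27ᵏ k!³) = (1/3)ₖ(2/3)ₖ/k!², what matters is that n is -1/3 or -2/3 modulo p: in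
-- both cases -n and n + 1 are 1/3 and 2/3 in some order, that is 9n(n + 1) ≡ -2. The remaining
-- factor 2ᵏ of 54ᵏ moves the argument of Pₙ(1 - 2x) to x = 1/2, the centre of symmetry. So the two
-- vanishing cases are parity statements: n is even for p ≡ 1 and odd for p ≡ 5 (mod 6). The
-- obstacle is the value 2A. It refers to an equation between integers, while power sums give only
-- residues; the character sums must therefore be known exactly. For the sums of χ(x) and of χ(x)χ(x
-- + c) the residue together with a bound on the absolute value suffices, and all later values
-- follow from these two by exchanging summations. No primitive root is used: one noncube g and the
-- count of solutions of c t³ ≡ D replace the cyclic structure of the multiplicative group. Evenness
-- and the class modulo 3 of ψ(1) both come from the three cube roots of unity modulo p.

module Lemmas where

  open import Data.Fin.Base as Fin using (toℕ)
  open import Data.Fin.Properties using (toℕ<n)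
  open import Data.Integer.Base as ℤ using (+_; -[1+_]; +≤+; -1ℤ; -_; 0ℤ; 1ℤ; _*_; _+_; _-_; _<_; _^_; _≤_; ℤ)
  open import Data.Integer.DivMod using (_%ℕ_; _/ℕ_; a≡a%ℕn+[a/ℕn]*n; n%ℕd<d)
  import Data.Integer.Divisibility as Unsigned
  open import Data.Integer.Divisibility.Signed as Signed using (divides)
  open import Data.Integer.GCD using (gcd)
  import Data.Integer.Properties as ℤₚ
  open import Data.Integer.Tactic.RingSolver using (solve-∀)
  open import Data.Nat.Base as ℕ using (_!; suc; s≤s; zero; z≤n; ℕ)
  open import Data.Nat.Combinatorics using (_C_; nC1≡n; nCk+nC[k+1]≡[n+1]C[k+1]; nCk≡nC[n∸k]; nCn≡1)
  open import Data.Nat.Coprimality using (1-coprimeTo; Coprime)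
  open import Data.Nat.DivMod using (+-distrib-/-∣ʳ; m*n/n≡m)
  import Data.Nat.Divisibility as ℕ∣
  open import Data.Nat.Induction using (<-rec)
  open import Data.Nat.Primality using (Prime; euclidsLemma; prime?; prime⇒irreducible; prime⇒nonTrivial)
  import Data.Nat.Properties as ℕₚ
  import Data.Nat.Tactic.RingSolver as ℕ-solver
  open import Data.Product.Base using (_,_; _×_; proj₁; proj₂; ∃)
  open import Data.Rational.Base as ℚ using (0ℚ; 1ℚ; ½; ℚ; ↥_; ↧_; ↧ₙ_)
  import Data.Rational.Properties as ℚₚ
  open import Data.Sum.Base as ⊎ using ([_,_]′; _⊎_; inj₁; inj₂)
  open import Function.Base using (_∘_; id)
  open import Level using (0ℓ)
  open import Relation.Binary.Bundles using (Setoid)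
  open import Relation.Binary.PropositionalEquality
  import Relation.Binary.Reasoning.Setoid as SetoidReasoning
  open import Relation.Nullary.Decidable using (Dec; _×-dec_; decidable-stable; from-yes; map′; no; yes; ¬?)
  open import Relation.Nullary.Negation using (contradiction; ¬_)

  open import Defs

  import Algebra.Properties.CommutativeSemiring.Binomial ℤₚ.+-*-commutativeSemiring as Binomial
  import Algebra.Properties.CommutativeSemiring.Exp ℤₚ.+-*-commutativeSemiring as Exp
  import Algebra.Properties.Semiring.Mult ℤₚ.+-*-semiring as Mult
  import Algebra.Properties.Semiring.Sum ℤₚ.+-*-semiring as Sum

  -- Finite integer sums and binomial coefficients

  -- Opaque, so that sums over suc n indices do not unfold during unification.
  opaque
    ∑ : ℕ → (ℕ → ℤ) → ℤ
    ∑ n f = Sum.sum {n} (λ i → f (toℕ i))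

    ∑-empty : ∀ f → ∑ 0 f ≡ 0ℤ
    ∑-empty f = refl

    ∑-first : ∀ n f → ∑ (suc n) f ≡ f 0 + ∑ n (f ∘ suc)
    ∑-first n f = refl

    ∑-cong : ∀ n {f g : ℕ → ℤ} → (∀ {k} → k ℕ.< n → f k ≡ g k) → ∑ n f ≡ ∑ n g
    ∑-cong n f≡g = Sum.sum-cong-≗ λ i → f≡g (toℕ<n i)

    ∑-distrib-+ : ∀ n (f g : ℕ → ℤ) → ∑ n (λ k → f k + g k) ≡ ∑ n f + ∑ n g
    ∑-distrib-+ n f g = Sum.∑-distrib-+ {n} (f ∘ toℕ) (g ∘ toℕ)

    *-distribˡ-∑ : ∀ n c (f : ℕ → ℤ) → c * ∑ n f ≡ ∑ n (λ k → c * f k)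
    *-distribˡ-∑ n c f = Sum.*-distribˡ-sum {n} c (f ∘ toℕ)

    *-distribʳ-∑ : ∀ n c (f : ℕ → ℤ) → ∑ n f * c ≡ ∑ n (λ k → f k * c)
    *-distribʳ-∑ n c f = Sum.*-distribʳ-sum {n} c (f ∘ toℕ)

    ∑-comm : ∀ m n (f : ℕ → ℕ → ℤ) → ∑ m (λ i → ∑ n (f i)) ≡ ∑ n (λ j → ∑ m (λ i → f i j))
    ∑-comm m n f = Sum.∑-comm {m} {n} (λ i j → f (toℕ i) (toℕ j))

    ∑-zero : ∀ n → ∑ n (λ _ → 0ℤ) ≡ 0ℤ
    ∑-zero zero    = refl
    ∑-zero (suc n) = trans (ℤₚ.+-identityˡ _) (∑-zero n)

    ∑-const : ∀ n c → ∑ n (λ _ → c) ≡ + n * c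
    ∑-const zero    c = refl
    ∑-const (suc n) c = trans (cong (λ s → c + s) (∑-const n c)) (sym (ℤₚ.suc-* (+ n) c))

    ∑-last : ∀ n (f : ℕ → ℤ) → ∑ (suc n) f ≡ ∑ n f + f n
    ∑-last zero    f = ℤₚ.+-comm (f 0) 0ℤ
    ∑-last (suc n) f = trans (cong (λ s → f 0 + s) (∑-last n (f ∘ suc))) (sym (ℤₚ.+-assoc (f 0) _ _))

    ∑-mono : ∀ n {f g : ℕ → ℤ} → (∀ k → f k ≤ g k) → ∑ n f ≤ ∑ n g
    ∑-mono zero    f≤g = ℤₚ.≤-refl
    ∑-mono (suc n) f≤g = ℤₚ.+-mono-≤ (f≤g 0) (∑-mono n (f≤g ∘ suc))

    ∑-single : ∀ {n j} (f : ℕ → ℤ) → j ℕ.< n → (∀ {k} → k ℕ.< n → k ≢ j → f k ≡ 0ℤ) → ∑ n f ≡ f j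
    ∑-single {suc n} {zero}  f _ others =
      trans (cong (λ s → f 0 + s) (trans (∑-cong n λ k<n → others (s≤s k<n) λ ()) (∑-zero n))) (ℤₚ.+-identityʳ (f 0))
    ∑-single {suc n} {suc j} f (s≤s j<n) others =
      trans (cong₂ _+_ (others (s≤s z≤n) λ ()) (∑-single (f ∘ suc) j<n λ k<n k≢j → others (s≤s k<n) (k≢j ∘ ℕₚ.suc-injective)))
            (ℤₚ.+-identityˡ _)

  telescope : ∀ n (f : ℕ → ℤ) → ∑ n (λ k → f (suc k) - f k) ≡ f n - f 0
  telescope zero    f = trans (∑-empty _) (sym (ℤₚ.+-inverseʳ (f 0)))
  telescope (suc n) f =
    trans (∑-last n _) (trans (cong (λ s → s + (f (suc n) - f n)) (telescope n f)) (eq (f 0) (f n) (f (suc n))))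
    where
    eq : ∀ x y z → y - x + (z - y) ≡ z - x
    eq = solve-∀

  ^-distrib-* : ∀ a b n → (a * b) ^ n ≡ a ^ n * b ^ n
  ^-distrib-* a b zero    = refl
  ^-distrib-* a b (suc n) = trans (cong (λ c → a * b * c) (^-distrib-* a b n)) (eq a b (a ^ n) (b ^ n))
    where
    eq : ∀ w x y z → w * x * (y * z) ≡ w * y * (x * z)
    eq = solve-∀

  ^-+ : ∀ a m n → a ^ (m ℕ.+ n) ≡ a ^ m * a ^ n
  ^-+ = ℤₚ.^-distribˡ-+-*

  opaque
    unfolding ∑

    binomial : ∀ n x y → (x + y) ^ n ≡ ∑ (suc n) (λ k → + (n C k) * (x ^ k * y ^ (n ℕ.∸ k)))
    binomial n x y =
      trans (^≡Exp^ (x + y) n)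
            (trans (Binomial.theorem n x y)
                   (∑-cong (suc n) λ {k} _ →
                     trans (×≡* (n C k) _)
                           (cong (λ z → + (n C k) * z) (cong₂ _*_ (sym (^≡Exp^ x k)) (sym (^≡Exp^ y (n ℕ.∸ k)))))))
      where
      ^≡Exp^ : ∀ a m → a ^ m ≡ a Exp.^ m
      ^≡Exp^ a zero    = refl
      ^≡Exp^ a (suc m) = cong (λ z → a * z) (^≡Exp^ a m)

      ×≡* : ∀ m a → m Mult.× a ≡ + m * a
      ×≡* zero    a = refl
      ×≡* (suc m) a = trans (cong (λ z → a + z) (×≡* m a)) (sym (ℤₚ.suc-* (+ m) a))

  pascal : ∀ n k → + (suc n C suc k) ≡ + (n C k) + + (n C suc k)
  pascal n k = cong +_ (sym (nCk+nC[k+1]≡[n+1]C[k+1] n k))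

  absorption : ∀ n k → + suc k * + (suc n C suc k) ≡ + suc n * + (n C k)
  absorption n zero = trans (ℤₚ.*-identityˡ _) (trans (cong +_ (nC1≡n (suc n))) (sym (ℤₚ.*-identityʳ _)))
  absorption zero (suc k) = ℤₚ.*-zeroʳ (+ suc (suc k))
  absorption (suc n) (suc k) = begin
    + suc (suc k) * + (suc (suc n) C suc (suc k))
      ≡⟨ cong (λ z → + suc (suc k) * z) (pascal (suc n) (suc k)) ⟩
    (1ℤ + + suc k) * (x + + (suc n C suc (suc k)))
      ≡⟨ eq₁ (+ suc k) x _ ⟩
    x + + suc k * x + + suc (suc k) * + (suc n C suc (suc k))
      ≡⟨ cong₂ (λ y z → x + y + z) (absorption n k) (absorption n (suc k)) ⟩
    x + + suc n * + (n C k) + + suc n * + (n C suc k)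
      ≡⟨ eq₂ x (+ suc n) (+ (n C k)) (+ (n C suc k)) ⟩
    x + + suc n * (+ (n C k) + + (n C suc k))
      ≡⟨ cong (λ z → x + + suc n * z) (sym (pascal n k)) ⟩
    x + + suc n * x
      ≡⟨ eq₃ (+ suc n) x ⟩
    + suc (suc n) * x ∎
    where
    open ≡-Reasoning
    x : ℤ
    x = + (suc n C suc k)
    eq₁ : ∀ k x y → (1ℤ + k) * (x + y) ≡ x + k * x + (1ℤ + k) * y
    eq₁ = solve-∀
    eq₂ : ∀ x n y z → x + n * y + n * z ≡ x + n * (y + z)
    eq₂ = solve-∀
    eq₃ : ∀ n x → x + n * x ≡ (1ℤ + n) * x
    eq₃ = solve-∀

  -- The integer difference keeps the factor polynomial in n and k, as the ring identities modulo p
  -- require; beyond k = n both sides are 0.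
  [1+k]*nC[1+k]≡[n-k]*nCk : ∀ n k → + suc k * + (n C suc k) ≡ (+ n - + k) * + (n C k)
  [1+k]*nC[1+k]≡[n-k]*nCk n k = begin
    + suc k * + (n C suc k)                                                  ≡⟨ eq₁ (+ k) (+ (n C k)) _ ⟩
    + suc k * (+ (n C k) + + (n C suc k)) - + suc k * + (n C k)              ≡⟨ cong (λ z → + suc k * z - + suc k * + (n C k)) (sym (pascal n k)) ⟩
    + suc k * + (suc n C suc k) - + suc k * + (n C k)                        ≡⟨ cong (λ z → z - + suc k * + (n C k)) (absorption n k) ⟩
    + suc n * + (n C k) - + suc k * + (n C k)                                ≡⟨ eq₂ (+ n) (+ k) (+ (n C k)) ⟩
    (+ n - + k) * + (n C k) ∎
    where
    open ≡-Reasoning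
    eq₁ : ∀ k x y → (1ℤ + k) * y ≡ (1ℤ + k) * (x + y) - (1ℤ + k) * x
    eq₁ = solve-∀
    eq₂ : ∀ n k x → (1ℤ + n) * x - (1ℤ + k) * x ≡ (n - k) * x
    eq₂ = solve-∀

  0^ : ∀ {n} → 0 ℕ.< n → 0ℤ ^ n ≡ 0ℤ
  0^ {suc n} _ = ℤₚ.*-zeroˡ (0ℤ ^ n)

  -- One term strictly below c would make the total strictly smaller. This turns an upper bound on a
  -- counting function into its exact value.
  ∑-tight : ∀ n {f : ℕ → ℤ} {c} → (∀ k → f k ≤ c) → ∑ n f ≡ + n * c → ∀ {k} → k ℕ.< n → f k ≡ c
  ∑-tight (suc n) {f} {c} f≤c ∑≡ {k} k<1+n with f n ℤₚ.≟ c
  ... | no fn≢c = contradiction ∑≡ (ℤₚ.<⇒≢ (begin-strict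
    ∑ (suc n) f              ≡⟨ ∑-last n f ⟩
    ∑ n f + f n              <⟨ ℤₚ.+-mono-≤-< (∑-mono n f≤c) (ℤₚ.≤∧≢⇒< (f≤c n) fn≢c) ⟩
    ∑ n (λ _ → c) + c        ≡⟨ cong (_+ c) (∑-const n c) ⟩
    + n * c + c              ≡⟨ eq (+ n) c ⟩
    + suc n * c              ∎))
    where
    open ℤₚ.≤-Reasoning
    eq : ∀ n c → n * c + c ≡ (1ℤ + n) * c
    eq = solve-∀
  ... | yes fn≡c with ℕₚ.m≤n⇒m<n∨m≡n (ℕₚ.≤-pred k<1+n)
  ...   | inj₂ refl = fn≡c
  ...   | inj₁ k<n  = ∑-tight n f≤c (begin
    ∑ n f                ≡⟨ eq₁ (∑ n f) (f n) ⟩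
    ∑ n f + f n - f n    ≡⟨ cong₂ _-_ (sym (∑-last n f)) fn≡c ⟩
    ∑ (suc n) f - c      ≡⟨ cong (_- c) ∑≡ ⟩
    + suc n * c - c      ≡⟨ eq₂ (+ n) c ⟩
    + n * c              ∎) k<n
    where
    open ≡-Reasoning
    eq₁ : ∀ s x → s ≡ s + x - x
    eq₁ = solve-∀
    eq₂ : ∀ n c → (1ℤ + n) * c - c ≡ n * c
    eq₂ = solve-∀

  -- Arithmetic modulo p, power sums and coefficient extraction

  module Residues (N : ℕ) (p-prime : Prime (suc N)) where

    -- The prime is `suc N`, so that the exponent p - 1 of Fermat's theorem is `N`, without
    -- truncated subtraction.
    p : ℕ
    p = suc N

    infix 4 _≈_ _≉_ _≈?_

    -- With an explicit quotient, matching the equation against `refl` turns each congruence law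
    -- into a ring identity.
    record _≈_ (a b : ℤ) : Set where
      constructor by
      field
        quotient : ℤ
        equality : a ≡ b + quotient * + p

    _≉_ : ℤ → ℤ → Set
    a ≉ b = ¬ a ≈ b

    ≈-reflexive : ∀ {a b} → a ≡ b → a ≈ b
    ≈-reflexive {b = b} refl = by 0ℤ (sym (ℤₚ.+-identityʳ b))

    ≈-refl : ∀ {a} → a ≈ a
    ≈-refl = ≈-reflexive refl

    ≈-sym : ∀ {a b} → a ≈ b → b ≈ a
    ≈-sym {b = b} (by q refl) = by (- q) (eq b q (+ p))
      where
      eq : ∀ b q p → b ≡ b + q * p + - q * p
      eq = solve-∀

    ≈-trans : ∀ {a b c} → a ≈ b → b ≈ c → a ≈ c
    ≈-trans {c = c} (by q refl) (by r refl) = by (q + r) (eq c q r (+ p))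
      where
      eq : ∀ c q r p → c + r * p + q * p ≡ c + (q + r) * p
      eq = solve-∀

    ≈-setoid : Setoid 0ℓ 0ℓ
    ≈-setoid = record
      { Carrier       = ℤ
      ; _≈_           = _≈_
      ; isEquivalence = record { refl = ≈-refl ; sym = ≈-sym ; trans = ≈-trans }
      }

    module ≈-Reasoning = SetoidReasoning ≈-setoid

    +-cong : ∀ {a b c d} → a ≈ b → c ≈ d → a + c ≈ b + d
    +-cong {b = b} {d = d} (by q refl) (by r refl) = by (q + r) (eq b d q r (+ p))
      where
      eq : ∀ b d q r p → b + q * p + (d + r * p) ≡ b + d + (q + r) * p
      eq = solve-∀

    *-cong : ∀ {a b c d} → a ≈ b → c ≈ d → a * c ≈ b * d
    *-cong {b = b} {d = d} (by q refl) (by r refl) = by (b * r + q * d + q * r * + p) (eq b d q r (+ p))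
      where
      eq : ∀ b d q r p → (b + q * p) * (d + r * p) ≡ b * d + (b * r + q * d + q * r * p) * p
      eq = solve-∀

    *-congˡ : ∀ c {a b} → a ≈ b → c * a ≈ c * b
    *-congˡ c = *-cong (≈-refl {c})

    *-congʳ : ∀ c {a b} → a ≈ b → a * c ≈ b * c
    *-congʳ c a≈b = *-cong a≈b (≈-refl {c})

    +-congˡ : ∀ c {a b} → a ≈ b → c + a ≈ c + b
    +-congˡ c = +-cong (≈-refl {c})

    +-congʳ : ∀ c {a b} → a ≈ b → a + c ≈ b + c
    +-congʳ c a≈b = +-cong a≈b (≈-refl {c})

    neg-cong : ∀ {a b} → a ≈ b → - a ≈ - b
    neg-cong {b = b} (by q refl) = by (- q) (eq b q (+ p))
      where
      eq : ∀ b q p → - (b + q * p) ≡ - b + - q * p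
      eq = solve-∀

    ^-cong : ∀ {a b} n → a ≈ b → a ^ n ≈ b ^ n
    ^-cong zero    a≈b = ≈-refl
    ^-cong (suc n) a≈b = *-cong a≈b (^-cong n a≈b)

    ∑-cong-≈ : ∀ n {f g : ℕ → ℤ} → (∀ {k} → k ℕ.< n → f k ≈ g k) → ∑ n f ≈ ∑ n g
    ∑-cong-≈ zero    {f} {g} f≈g = ≈-reflexive (trans (∑-empty f) (sym (∑-empty g)))
    ∑-cong-≈ (suc n) {f} {g} f≈g = ≈-trans (≈-reflexive (∑-first n f))
      (≈-trans (+-cong (f≈g (s≤s z≤n)) (∑-cong-≈ n (f≈g ∘ s≤s))) (≈-reflexive (sym (∑-first n g))))

    ∑-zero-≈ : ∀ n {f : ℕ → ℤ} → (∀ {k} → k ℕ.< n → f k ≈ 0ℤ) → ∑ n f ≈ 0ℤ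
    ∑-zero-≈ n f≈0 = ≈-trans (∑-cong-≈ n f≈0) (≈-reflexive (∑-zero n))

    ∑-single-≈ : ∀ {n j} {f : ℕ → ℤ} → j ℕ.< n → (∀ {k} → k ℕ.< n → k ≢ j → f k ≈ 0ℤ) → ∑ n f ≈ f j
    ∑-single-≈ {suc n} {zero} {f} _ others = ≈-trans (≈-reflexive (∑-first n f))
      (≈-trans (+-congˡ (f 0) (∑-zero-≈ n λ k<n → others (s≤s k<n) λ ())) (≈-reflexive (ℤₚ.+-identityʳ (f 0))))
    ∑-single-≈ {suc n} {suc j} {f} (s≤s j<n) others = ≈-trans (≈-reflexive (∑-first n f))
      (≈-trans (+-cong (others (s≤s z≤n) λ ()) (∑-single-≈ j<n λ k<n k≢j → others (s≤s k<n) (k≢j ∘ ℕₚ.suc-injective)))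
               (≈-reflexive (ℤₚ.+-identityˡ (f (suc j)))))

    p∣⇒≈0 : ∀ {a} → + p Unsigned.∣ a → a ≈ 0ℤ
    p∣⇒≈0 p∣a with divides q eq ← Signed.∣ᵤ⇒∣ {+ p} p∣a = by q (trans eq (sym (ℤₚ.+-identityˡ _)))

    ≈0⇒p∣ : ∀ {a} → a ≈ 0ℤ → + p Unsigned.∣ a
    ≈0⇒p∣ (by q eq) = Signed.∣⇒∣ᵤ (divides q (trans eq (ℤₚ.+-identityˡ _)))

    p≈0 : + p ≈ 0ℤ
    p≈0 = by 1ℤ (sym (trans (ℤₚ.+-identityˡ _) (ℤₚ.*-identityˡ _)))

    ≈⇒-≈0 : ∀ {a b} → a ≈ b → a - b ≈ 0ℤ
    ≈⇒-≈0 {b = b} (by q refl) = by q (eq b (q * + p))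
      where
      eq : ∀ b x → b + x - b ≡ 0ℤ + x
      eq = solve-∀

    -≈0⇒≈ : ∀ {a b} → a - b ≈ 0ℤ → a ≈ b
    -≈0⇒≈ {a} {b} (by q eq) = by q (trans (eq₁ a b) (cong (λ z → b + z) (trans eq (ℤₚ.+-identityˡ _))))
      where
      eq₁ : ∀ a b → a ≡ b + (a - b)
      eq₁ = solve-∀

    opaque
      _≈?_ : ∀ a b → Dec (a ≈ b)
      a ≈? b = map′ (-≈0⇒≈ ∘ p∣⇒≈0) (≈0⇒p∣ ∘ ≈⇒-≈0) (p ℕ∣.∣? ℤ.∣ a - b ∣)

    *≈0 : ∀ a b → a * b ≈ 0ℤ → a ≈ 0ℤ ⊎ b ≈ 0ℤ
    *≈0 a b ab≈0 = ⊎.map p∣⇒≈0 p∣⇒≈0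
      (euclidsLemma ℤ.∣ a ∣ ℤ.∣ b ∣ p-prime (subst (p ℕ∣.∣_) (ℤₚ.abs-* a b) (≈0⇒p∣ ab≈0)))

    *≉0 : ∀ {a b} → a ≉ 0ℤ → b ≉ 0ℤ → a * b ≉ 0ℤ
    *≉0 {a} {b} a≉0 b≉0 ab≈0 with *≈0 a b ab≈0
    ... | inj₁ a≈0 = a≉0 a≈0
    ... | inj₂ b≈0 = b≉0 b≈0

    ^≉0 : ∀ {a} n → a ≉ 0ℤ → a ^ n ≉ 0ℤ

    *-cancelˡ : ∀ {a b c} → a ≉ 0ℤ → a * b ≈ a * c → b ≈ c
    *-cancelˡ {a} {b} {c} a≉0 ab≈ac with *≈0 a (b - c) (≈-trans (≈-reflexive (eq a b c)) (≈⇒-≈0 ab≈ac))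
      where
      eq : ∀ a b c → a * (b - c) ≡ a * b - a * c
      eq = solve-∀
    ... | inj₁ a≈0   = contradiction a≈0 a≉0
    ... | inj₂ b-c≈0 = -≈0⇒≈ b-c≈0

    0<k<p⇒k≉0 : ∀ {k} → 0 ℕ.< k → k ℕ.< p → + k ≉ 0ℤ
    0<k<p⇒k≉0 {suc k} _ k<p k≈0 = ℕₚ.<⇒≱ k<p (ℕ∣.∣⇒≤ (≈0⇒p∣ k≈0))

    1≉0 : 1ℤ ≉ 0ℤ
    1≉0 1≈0 with prime⇒nonTrivial p-prime | ℕ∣.∣1⇒≡1 (≈0⇒p∣ 1≈0)
    ... | () | refl

    ^≉0 zero    a≉0 = 1≉0
    ^≉0 (suc n) a≉0 = *≉0 a≉0 (^≉0 n a≉0)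

    0<N : 0 ℕ.< N
    0<N = ℕₚ.n≢0⇒n>0 λ { refl → 1≉0 p≈0 }

    reduce : ℤ → ℕ
    reduce a = a %ℕ p

    reduce<p : ∀ a → reduce a ℕ.< p
    reduce<p a = n%ℕd<d a p

    ≈reduce : ∀ a → a ≈ + reduce a
    ≈reduce a = by (a /ℕ p) (a≡a%ℕn+[a/ℕn]*n a p)

    -- By absorption k · C(p, k) = p · C(p - 1, k - 1), and k is prime to p.
    pCk≈0 : ∀ {k} → 0 ℕ.< k → k ℕ.< p → + (p C k) ≈ 0ℤ
    pCk≈0 {suc k} 0<k k<p with *≈0 (+ suc k) (+ (p C suc k))
      (≈-trans (≈-reflexive (absorption N k)) (≈-trans (*-congʳ (+ (N C k)) p≈0) (≈-reflexive (ℤₚ.*-zeroˡ (+ (N C k))))))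
    ... | inj₁ k≈0 = contradiction k≈0 (0<k<p⇒k≉0 0<k k<p)
    ... | inj₂ C≈0 = C≈0

    [a+1]^p≈a^p+1 : ∀ a → (a + 1ℤ) ^ p ≈ a ^ p + 1ℤ
    [a+1]^p≈a^p+1 a = begin
      (a + 1ℤ) ^ p                     ≡⟨ binomial p a 1ℤ ⟩
      ∑ (suc p) t                      ≡⟨ trans (∑-last p t) (cong (λ s → s + t p) (∑-first N t)) ⟩
      t 0 + ∑ N (t ∘ suc) + t p        ≈⟨ +-cong (+-cong t0≈1 (∑-zero-≈ N middle)) tp≈a^p ⟩
      1ℤ + 0ℤ + a ^ p                  ≡⟨ eq (a ^ p) ⟩
      a ^ p + 1ℤ                       ∎
      where
      open ≈-Reasoning
      t : ℕ → ℤ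
      t k = + (p C k) * (a ^ k * 1ℤ ^ (p ℕ.∸ k))
      t0≈1 : t 0 ≈ 1ℤ
      t0≈1 = ≈-reflexive (trans (ℤₚ.*-identityˡ _) (trans (ℤₚ.*-identityˡ _) (ℤₚ.^-zeroˡ p)))
      middle : ∀ {k} → k ℕ.< N → t (suc k) ≈ 0ℤ
      middle {k} k<N = ≈-trans (*-congʳ _ (pCk≈0 (s≤s z≤n) (s≤s k<N))) (≈-reflexive (ℤₚ.*-zeroˡ (a ^ suc k * 1ℤ ^ (N ℕ.∸ k))))
      tp≈a^p : t p ≈ a ^ p
      tp≈a^p rewrite nCn≡1 p | ℕₚ.n∸n≡0 p = ≈-reflexive (trans (ℤₚ.*-identityˡ _) (ℤₚ.*-identityʳ _))
      eq : ∀ x → 1ℤ + 0ℤ + x ≡ x + 1ℤ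
      eq = solve-∀

    fermat : ∀ a → a ^ p ≈ a
    fermat a = begin
      a ^ p            ≈⟨ ^-cong p (≈reduce a) ⟩
      (+ reduce a) ^ p ≈⟨ fermatℕ (reduce a) ⟩
      + reduce a       ≈⟨ ≈reduce a ⟨
      a                ∎
      where
      open ≈-Reasoning
      fermatℕ : ∀ k → (+ k) ^ p ≈ + k
      fermatℕ zero    = ≈-reflexive (ℤₚ.*-zeroˡ (0ℤ ^ N))
      fermatℕ (suc k) = begin
        (+ suc k) ^ p     ≡⟨ cong (λ z → (+ z) ^ p) (ℕₚ.+-comm 1 k) ⟩
        (+ k + 1ℤ) ^ p    ≈⟨ [a+1]^p≈a^p+1 (+ k) ⟩
        (+ k) ^ p + 1ℤ    ≈⟨ +-congʳ 1ℤ (fermatℕ k) ⟩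
        + k + 1ℤ          ≡⟨ cong +_ (ℕₚ.+-comm k 1) ⟩
        + suc k           ∎

    a^N≈1 : ∀ {a} → a ≉ 0ℤ → a ^ N ≈ 1ℤ
    a^N≈1 {a} a≉0 = *-cancelˡ a≉0 (≈-trans (fermat a) (≈-reflexive (sym (ℤₚ.*-identityʳ a))))

    ∑ₚ : (ℤ → ℤ) → ℤ
    ∑ₚ F = ∑ p (λ k → F (+ k))

    -- The binomial expansion of Σ ((x+1)^(j+1) − x^(j+1)) = p^(j+1) determines the power sums recursively.
    power-sum-small : ∀ j → j ℕ.< N → ∑ₚ (_^ j) ≈ 0ℤ
    power-sum-small = <-rec _ step
      where
      step : ∀ j → (∀ {i} → i ℕ.< j → i ℕ.< N → ∑ₚ (_^ i) ≈ 0ℤ) → j ℕ.< N → ∑ₚ (_^ j) ≈ 0ℤ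
      -- The factor j + 1 can be cancelled because j + 1 < p. For j = N it would be p itself, which
      -- is why the recursion stops short of that exponent.
      step j ih j<N = *-cancelˡ (0<k<p⇒k≉0 (s≤s z≤n) (s≤s j<N)) (begin
        + suc j * ∑ₚ (_^ j)                                ≡⟨ ℤₚ.+-identityˡ _ ⟨
        0ℤ + + suc j * ∑ₚ (_^ j)
          ≈⟨ +-cong (∑-zero-≈ j λ {i} i<j → ≈-trans (*-congˡ (c i) (ih i<j (ℕₚ.<-trans i<j j<N))) (≈-reflexive (ℤₚ.*-zeroʳ (c i))))
                    (≈-reflexive (cong (_* ∑ₚ (_^ j)) cj≡1+j)) ⟨
        ∑ j (λ i → c i * ∑ₚ (_^ i)) + c j * ∑ₚ (_^ j)      ≡⟨ ∑-last j (λ i → c i * ∑ₚ (_^ i)) ⟨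
        ∑ (suc j) (λ i → c i * ∑ₚ (_^ i))
          ≡⟨ ∑-cong (suc j) (λ {i} _ → *-distribˡ-∑ p (c i) (λ k → (+ k) ^ i)) ⟩
        ∑ (suc j) (λ i → ∑ₚ (λ x → c i * x ^ i))           ≡⟨ ∑-comm p (suc j) (λ k i → c i * (+ k) ^ i) ⟨
        ∑ₚ (λ x → ∑ (suc j) (λ i → c i * x ^ i))           ≡⟨ ∑-cong p (λ {k} _ → difference k) ⟨
        ∑ p (λ k → (+ suc k) ^ suc j - (+ k) ^ suc j)      ≡⟨ telescope p (λ k → (+ k) ^ suc j) ⟩
        (+ p) ^ suc j - 0ℤ ^ suc j                         ≈⟨ +-cong (^-cong (suc j) p≈0) ≈-refl ⟩
        0ℤ ^ suc j - 0ℤ ^ suc j                            ≡⟨ ℤₚ.+-inverseʳ (0ℤ ^ suc j) ⟩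
        0ℤ                                                 ≡⟨ ℤₚ.*-zeroʳ (+ suc j) ⟨
        + suc j * 0ℤ                                       ∎)
        where
        open ≈-Reasoning
        c : ℕ → ℤ
        c i = + (suc j C i)
        cj≡1+j : c j ≡ + suc j
        cj≡1+j = cong +_ (trans (nCk≡nC[n∸k] (ℕₚ.n≤1+n j))
                                (trans (cong (suc j C_) (ℕₚ.m+n∸n≡m 1 j)) (nC1≡n (suc j))))
        t : ℤ → ℕ → ℤ
        t x i = c i * (x ^ i * 1ℤ ^ (suc j ℕ.∸ i))
        t≡ : ∀ x i → t x i ≡ c i * x ^ i
        t≡ x i = cong (λ z → c i * z) (trans (cong (λ z → x ^ i * z) (ℤₚ.^-zeroˡ (suc j ℕ.∸ i))) (ℤₚ.*-identityʳ _))
        difference : ∀ k → (+ suc k) ^ suc j - (+ k) ^ suc j ≡ ∑ (suc j) (λ i → c i * (+ k) ^ i)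
        difference k = trans
          (cong (_- x ^ suc j)
            (trans (cong (λ z → (+ z) ^ suc j) (ℕₚ.+-comm 1 k))
            (trans (binomial (suc j) x 1ℤ)
            (trans (∑-cong (suc (suc j)) {t x} (λ {i} _ → t≡ x i))
            (trans (∑-last (suc j) (λ i → c i * x ^ i))
                   (cong (λ z → ∑ (suc j) (λ i → c i * x ^ i) + + z * x ^ suc j) (nCn≡1 (suc j))))))))
          (eq (∑ (suc j) (λ i → c i * x ^ i)) (x ^ suc j))
          where
          x : ℤ
          x = + k
          eq : ∀ s y → s + 1ℤ * y - y ≡ s
          eq = solve-∀

    -- By Fermat's theorem each of the N = p - 1 nonzero residues contributes 1.
    power-sum-N : ∑ₚ (_^ N) ≈ -1ℤ
    power-sum-N = begin
      ∑ₚ (_^ N)                           ≡⟨ ∑-first N (λ k → (+ k) ^ N) ⟩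
      0ℤ ^ N + ∑ N (λ k → (+ suc k) ^ N)  ≈⟨ +-cong (≈-reflexive (0^ 0<N)) (∑-cong-≈ N λ k<N → a^N≈1 (0<k<p⇒k≉0 (s≤s z≤n) (s≤s k<N))) ⟩
      0ℤ + ∑ N (λ _ → 1ℤ)                 ≡⟨ cong (λ z → 0ℤ + z) (∑-const N 1ℤ) ⟩
      0ℤ + + N * 1ℤ                       ≡⟨ eq (+ N) ⟩
      + p - 1ℤ                            ≈⟨ +-congʳ -1ℤ p≈0 ⟩
      -1ℤ                                 ∎
      where
      open ≈-Reasoning
      eq : ∀ n → 0ℤ + n * 1ℤ ≡ 1ℤ + n - 1ℤ
      eq = solve-∀

    -- Fermat's theorem lowers an exponent above N by N. The lowered exponent stays positive, so the
    -- summand at 0 agrees as well. The next exponent with a nonzero sum is 2N.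
    power-sum : ∀ {j} → j ≢ N → j ℕ.< N ℕ.+ N → ∑ₚ (_^ j) ≈ 0ℤ
    power-sum {j} j≢N j<2N with j ℕₚ.<? N
    ... | yes j<N = power-sum-small j j<N
    ... | no  j≮N = ≈-trans (∑-cong-≈ p λ {k} _ → lower (+ k)) (power-sum-small i i<N)
      where
      N<j : N ℕ.< j
      N<j = ℕₚ.≤∧≢⇒< (ℕₚ.≮⇒≥ j≮N) (j≢N ∘ sym)
      i : ℕ
      i = j ℕ.∸ N
      N+i≡j : N ℕ.+ i ≡ j
      N+i≡j = ℕₚ.m+[n∸m]≡n (ℕₚ.<⇒≤ N<j)
      i<N : i ℕ.< N
      i<N = ℕₚ.+-cancelˡ-< N i N (subst (ℕ._< N ℕ.+ N) (sym N+i≡j) j<2N)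
      lower′ : ∀ a i → 0 ℕ.< i → a ^ (N ℕ.+ i) ≈ a ^ i
      lower′ a (suc i) _ = ≈-trans (≈-reflexive (trans (cong (a ^_) (ℕₚ.+-suc N i)) (^-+ a p i)))
                                   (*-congʳ (a ^ i) (fermat a))
      lower : ∀ a → a ^ j ≈ a ^ i
      lower a = ≈-trans (≈-reflexive (cong (a ^_) (sym N+i≡j))) (lower′ a i (ℕₚ.m<n⇒0<n∸m N<j))

    -- In degree below 2N the only exponent with a nonzero power sum is N. Hence summing a
    -- polynomial over all residues gives minus its coefficient at y^N, and the prefactor y^e shifts
    -- the wanted coefficient to that place.
    module _ (e s : ℕ) (a b : ℤ) (M : ℕ) (small : e ℕ.+ s ℕ.* M ℕ.< N ℕ.+ N) where

      private
        coefficient : ℕ → ℤ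
        coefficient i = + (M C i) * (a ^ i * b ^ (M ℕ.∸ i))

        expand : ∑ₚ (λ y → y ^ e * (a * y ^ s + b) ^ M) ≡ ∑ (suc M) (λ i → coefficient i * ∑ₚ (_^ (e ℕ.+ s ℕ.* i)))
        expand = begin
          ∑ₚ (λ y → y ^ e * (a * y ^ s + b) ^ M)
            ≡⟨ ∑-cong p (λ {k} _ → trans (cong (λ z → (+ k) ^ e * z) (binomial M (a * (+ k) ^ s) b)) (*-distribˡ-∑ (suc M) ((+ k) ^ e) _)) ⟩
          ∑ₚ (λ y → ∑ (suc M) (λ i → y ^ e * (+ (M C i) * ((a * y ^ s) ^ i * b ^ (M ℕ.∸ i)))))
            ≡⟨ ∑-comm p (suc M) (λ k i → (+ k) ^ e * (+ (M C i) * ((a * (+ k) ^ s) ^ i * b ^ (M ℕ.∸ i)))) ⟩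
          ∑ (suc M) (λ i → ∑ₚ (λ y → y ^ e * (+ (M C i) * ((a * y ^ s) ^ i * b ^ (M ℕ.∸ i)))))
            ≡⟨ ∑-cong (suc M) (λ {i} _ → trans (∑-cong p (λ {k} _ → term (+ k) i)) (sym (*-distribˡ-∑ p (coefficient i) (λ k → (+ k) ^ (e ℕ.+ s ℕ.* i))))) ⟩
          ∑ (suc M) (λ i → coefficient i * ∑ₚ (_^ (e ℕ.+ s ℕ.* i))) ∎
          where
          open ≡-Reasoning
          eq : ∀ y c a z b → y * (c * (a * z * b)) ≡ c * (a * b) * (y * z)
          eq = solve-∀
          term : ∀ y i → y ^ e * (+ (M C i) * ((a * y ^ s) ^ i * b ^ (M ℕ.∸ i))) ≡ coefficient i * y ^ (e ℕ.+ s ℕ.* i)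
          term y i = begin
            y ^ e * (+ (M C i) * ((a * y ^ s) ^ i * b ^ (M ℕ.∸ i)))
              ≡⟨ cong (λ z → y ^ e * (+ (M C i) * (z * b ^ (M ℕ.∸ i))))
                      (trans (^-distrib-* a (y ^ s) i) (cong (λ z → a ^ i * z) (ℤₚ.^-*-assoc y s i))) ⟩
            y ^ e * (+ (M C i) * (a ^ i * y ^ (s ℕ.* i) * b ^ (M ℕ.∸ i)))
              ≡⟨ eq (y ^ e) (+ (M C i)) (a ^ i) (y ^ (s ℕ.* i)) (b ^ (M ℕ.∸ i)) ⟩
            coefficient i * (y ^ e * y ^ (s ℕ.* i))
              ≡⟨ cong (λ z → coefficient i * z) (^-+ y e (s ℕ.* i)) ⟨
            coefficient i * y ^ (e ℕ.+ s ℕ.* i) ∎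

        vanish : ∀ {i} → i ℕ.< suc M → e ℕ.+ s ℕ.* i ≢ N → coefficient i * ∑ₚ (_^ (e ℕ.+ s ℕ.* i)) ≈ 0ℤ
        vanish {i} (s≤s i≤M) ≢N = ≈-trans
          (*-congˡ (coefficient i) (power-sum ≢N (ℕₚ.≤-<-trans (ℕₚ.+-monoʳ-≤ e (ℕₚ.*-monoʳ-≤ s i≤M)) small)))
          (≈-reflexive (ℤₚ.*-zeroʳ (coefficient i)))

      no-coefficient : (∀ i → e ℕ.+ s ℕ.* i ≢ N) → ∑ₚ (λ y → y ^ e * (a * y ^ s + b) ^ M) ≈ 0ℤ
      no-coefficient ≢N = ≈-trans (≈-reflexive expand) (∑-zero-≈ (suc M) λ {i} i<1+M → vanish i<1+M (≢N i))

      extract-coefficient : .{{ℕ.NonZero s}} → ∀ {i} → i ℕ.≤ M → e ℕ.+ s ℕ.* i ≡ N →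
                            ∑ₚ (λ y → y ^ e * (a * y ^ s + b) ^ M) ≈ - (+ (M C i) * (a ^ i * b ^ (M ℕ.∸ i)))
      extract-coefficient {i} i≤M ≡N = begin
        ∑ₚ (λ y → y ^ e * (a * y ^ s + b) ^ M)      ≡⟨ expand ⟩
        ∑ (suc M) t                                 ≈⟨ ∑-single-≈ (s≤s i≤M) (λ k≤M k≢i → vanish k≤M (k≢i ∘ unique _)) ⟩
        coefficient i * ∑ₚ (_^ (e ℕ.+ s ℕ.* i))     ≡⟨ cong (λ j → coefficient i * ∑ₚ (_^ j)) ≡N ⟩
        coefficient i * ∑ₚ (_^ N)                   ≈⟨ *-congˡ (coefficient i) power-sum-N ⟩
        coefficient i * -1ℤ                         ≡⟨ eq (coefficient i) ⟩
        - coefficient i                             ∎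
        where
        open ≈-Reasoning
        t : ℕ → ℤ
        t i = coefficient i * ∑ₚ (_^ (e ℕ.+ s ℕ.* i))
        eq : ∀ c → c * -1ℤ ≡ - c
        eq = solve-∀
        unique : ∀ k → e ℕ.+ s ℕ.* k ≡ N → k ≡ i
        unique k ≡N′ = ℕₚ.*-cancelˡ-≡ k i s (ℕₚ.+-cancelˡ-≡ e _ _ (trans ≡N′ (sym ≡N)))

  -- The two truncated sums as coefficients of polynomials in 1 - y²

  binomial₁ : ∀ n x → ∑ (suc n) (λ k → + (n C k) * x ^ k) ≡ (x + 1ℤ) ^ n
  binomial₁ n x = sym (trans (binomial n x 1ℤ) (∑-cong (suc n) λ {k} _ → cong (λ z → + (n C k) * z) (x^k*1 k)))
    where
    x^k*1 : ∀ k → x ^ k * 1ℤ ^ (n ℕ.∸ k) ≡ x ^ k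
    x^k*1 k = trans (cong (λ z → x ^ k * z) (ℤₚ.^-zeroˡ (n ℕ.∸ k))) (ℤₚ.*-identityʳ (x ^ k))

  -- The operator x d/dx applied to the binomial theorem; the weight k is that of the second sum.
  binomial-derivative : ∀ n x → ∑ (suc (suc n)) (λ k → + k * (+ (suc n C k) * x ^ k)) ≡ + suc n * (x * (x + 1ℤ) ^ n)
  binomial-derivative n x = begin
    ∑ (suc (suc n)) (λ k → + k * (+ (suc n C k) * x ^ k))
      ≡⟨ ∑-first (suc n) (λ k → + k * (+ (suc n C k) * x ^ k)) ⟩
    0ℤ * (+ (suc n C 0) * x ^ 0) + ∑ (suc n) (λ k → + suc k * (+ (suc n C suc k) * x ^ suc k))
      ≡⟨ cong₂ _+_ (ℤₚ.*-zeroˡ (+ (suc n C 0) * x ^ 0)) (∑-cong (suc n) λ {k} _ → term k) ⟩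
    0ℤ + ∑ (suc n) (λ k → + suc n * x * (+ (n C k) * x ^ k))
      ≡⟨ ℤₚ.+-identityˡ _ ⟩
    ∑ (suc n) (λ k → + suc n * x * (+ (n C k) * x ^ k))
      ≡⟨ *-distribˡ-∑ (suc n) (+ suc n * x) (λ k → + (n C k) * x ^ k) ⟨
    + suc n * x * ∑ (suc n) (λ k → + (n C k) * x ^ k)
      ≡⟨ cong (λ z → + suc n * x * z) (binomial₁ n x) ⟩
    + suc n * x * (x + 1ℤ) ^ n
      ≡⟨ ℤₚ.*-assoc (+ suc n) x _ ⟩
    + suc n * (x * (x + 1ℤ) ^ n) ∎
    where
    open ≡-Reasoning
    eq₁ : ∀ a b x y → a * (b * (x * y)) ≡ a * b * (x * y)
    eq₁ = solve-∀
    eq₂ : ∀ a b x y → a * b * (x * y) ≡ a * x * (b * y)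
    eq₂ = solve-∀
    term : ∀ k → + suc k * (+ (suc n C suc k) * x ^ suc k) ≡ + suc n * x * (+ (n C k) * x ^ k)
    term k = trans (eq₁ (+ suc k) (+ (suc n C suc k)) x (x ^ k))
             (trans (cong (_* (x * x ^ k)) (absorption n k)) (eq₂ (+ suc n) (+ (n C k)) x (x ^ k)))

  -- `half` is an integer inverse of 2 modulo p, and `e` is the shift that carries the coefficient
  -- at yⁿ to the exponent N.
  module LegendreSums (N : ℕ) (p-prime : Prime (suc N))
    (half : ℤ) (2half≈1 : Residues._≈_ N p-prime (+ 2 * half) 1ℤ)
    (n e : ℕ) (e+n≡N : e ℕ.+ n ≡ N) (n<N : n ℕ.< N) where
    open Residues N p-prime

    -- The coefficient of xᵏ in the Legendre polynomial Pₙ(1 − 2x), times (1/2)ᵏ.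
    term : ℕ → ℤ
    term k = + (n C k) * (+ ((n ℕ.+ k) C k) * (- half) ^ k)

    private
      -- 1 + y, in the shape `a * y ^ s + b` on which `extract-coefficient` works.
      B : ℤ → ℤ
      B y = 1ℤ * y ^ 1 + 1ℤ

      e+n+k : ∀ k → e ℕ.+ 1 ℕ.* (n ℕ.+ k) ≡ N ℕ.+ k
      e+n+k k = trans (cong (e ℕ.+_) (ℕₚ.*-identityˡ (n ℕ.+ k)))
                      (trans (sym (ℕₚ.+-assoc e n k)) (cong (ℕ._+ k) e+n≡N))

    -- C(n+k, n) is the coefficient of yⁿ in (1+y)ⁿ⁺ᵏ, which a power sum over the residues extracts.
    central : ∀ {k} → k ℕ.< suc n → + ((n ℕ.+ k) C k) ≈ - ∑ₚ (λ y → y ^ e * B y ^ (n ℕ.+ k))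
    central {k} (s≤s k≤n) = begin
      + ((n ℕ.+ k) C k)                       ≡⟨ cong +_ C-sym ⟩
      + ((n ℕ.+ k) C n)                       ≡⟨ eq (+ ((n ℕ.+ k) C n)) ⟩
      - - (+ ((n ℕ.+ k) C n) * (1ℤ * 1ℤ))     ≡⟨ cong (λ z → - - (+ ((n ℕ.+ k) C n) * z)) (cong₂ _*_ (ℤₚ.^-zeroˡ n) (ℤₚ.^-zeroˡ (n ℕ.+ k ℕ.∸ n))) ⟨
      - - (+ ((n ℕ.+ k) C n) * (1ℤ ^ n * 1ℤ ^ (n ℕ.+ k ℕ.∸ n)))
        ≈⟨ neg-cong (extract-coefficient e 1 1ℤ 1ℤ (n ℕ.+ k) bound (ℕₚ.m≤m+n n k)
             (trans (cong (e ℕ.+_) (ℕₚ.*-identityˡ n)) e+n≡N)) ⟨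
      - ∑ₚ (λ y → y ^ e * B y ^ (n ℕ.+ k))    ∎
      where
      open ≈-Reasoning
      eq : ∀ x → x ≡ - - (x * (1ℤ * 1ℤ))
      eq = solve-∀
      C-sym : (n ℕ.+ k) C k ≡ (n ℕ.+ k) C n
      C-sym = trans (nCk≡nC[n∸k] (ℕₚ.m≤n+m k n)) (cong ((n ℕ.+ k) C_) (ℕₚ.m+n∸n≡m n k))
      bound : e ℕ.+ 1 ℕ.* (n ℕ.+ k) ℕ.< N ℕ.+ N
      bound = subst (ℕ._< N ℕ.+ N) (sym (e+n+k k)) (ℕₚ.+-monoʳ-< N (ℕₚ.≤-<-trans k≤n n<N))

    exponent-bound : ∀ i j → i ℕ.+ 2 ℕ.* j ≡ 2 ℕ.* n → e ℕ.+ i ℕ.+ 2 ℕ.* j ℕ.< N ℕ.+ N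
    exponent-bound i j i+2j≡2n = subst (ℕ._< N ℕ.+ N) (sym (trans (ℕₚ.+-assoc e i (2 ℕ.* j)) (trans (cong (e ℕ.+_) i+2j≡2n) e+2n≡N+n))) (ℕₚ.+-monoʳ-< N n<N)
      where
      eq : ∀ e n → e ℕ.+ 2 ℕ.* n ≡ e ℕ.+ n ℕ.+ n
      eq = ℕ-solver.solve-∀
      e+2n≡N+n : e ℕ.+ 2 ℕ.* n ≡ N ℕ.+ n
      e+2n≡N+n = trans (eq e n) (cong (ℕ._+ n) e+n≡N)

    private
      -- Inserting `central` and exchanging the summations leaves, for each y, a binomial sum in
      -- `- half * B y`. For w = 1 and for w = k, the two weights needed, it has a closed form.
      weighted : (w : ℕ → ℤ) → ∑ (suc n) (λ k → w k * term k) ≈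
                 - ∑ₚ (λ y → y ^ e * B y ^ n * ∑ (suc n) (λ k → w k * (+ (n C k) * (- half * B y) ^ k)))
      weighted w = begin
        ∑ (suc n) (λ k → w k * term k)
          ≈⟨ ∑-cong-≈ (suc n) (λ {k} k≤n → *-congˡ (w k) (*-congˡ (+ (n C k)) (*-congʳ ((- half) ^ k) (central k≤n)))) ⟩
        ∑ (suc n) (λ k → w k * (+ (n C k) * (- ∑ₚ (λ y → y ^ e * B y ^ (n ℕ.+ k)) * (- half) ^ k)))
          ≡⟨ ∑-cong (suc n) (λ {k} _ → trans (eq₁ (w k) (+ (n C k)) (∑ₚ (λ y → y ^ e * B y ^ (n ℕ.+ k))) ((- half) ^ k))
               (*-distribˡ-∑ p (-1ℤ * (w k * (+ (n C k) * (- half) ^ k))) (λ i → (+ i) ^ e * B (+ i) ^ (n ℕ.+ k)))) ⟩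
        ∑ (suc n) (λ k → ∑ₚ (λ y → -1ℤ * (w k * (+ (n C k) * (- half) ^ k)) * (y ^ e * B y ^ (n ℕ.+ k))))
          ≡⟨ ∑-comm (suc n) p (λ k i → -1ℤ * (w k * (+ (n C k) * (- half) ^ k)) * ((+ i) ^ e * B (+ i) ^ (n ℕ.+ k))) ⟩
        ∑ₚ (λ y → ∑ (suc n) (λ k → -1ℤ * (w k * (+ (n C k) * (- half) ^ k)) * (y ^ e * B y ^ (n ℕ.+ k))))
          ≡⟨ ∑-cong p (λ {i} _ → trans (∑-cong (suc n) (λ {k} _ → pointwise (+ i) k))
               (sym (*-distribˡ-∑ (suc n) (-1ℤ * ((+ i) ^ e * B (+ i) ^ n)) (λ k → w k * (+ (n C k) * (- half * B (+ i)) ^ k))))) ⟩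
        ∑ₚ (λ y → -1ℤ * (y ^ e * B y ^ n) * ∑ (suc n) (λ k → w k * (+ (n C k) * (- half * B y) ^ k)))
          ≡⟨ ∑-cong p (λ {i} _ → ℤₚ.*-assoc -1ℤ ((+ i) ^ e * B (+ i) ^ n) _) ⟩
        ∑ₚ (λ y → -1ℤ * (y ^ e * B y ^ n * ∑ (suc n) (λ k → w k * (+ (n C k) * (- half * B y) ^ k))))
          ≡⟨ *-distribˡ-∑ p -1ℤ (λ i → (+ i) ^ e * B (+ i) ^ n * ∑ (suc n) (λ k → w k * (+ (n C k) * (- half * B (+ i)) ^ k))) ⟨
        -1ℤ * ∑ₚ (λ y → y ^ e * B y ^ n * ∑ (suc n) (λ k → w k * (+ (n C k) * (- half * B y) ^ k)))
          ≡⟨ ℤₚ.-1*i≡-i _ ⟩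
        - ∑ₚ (λ y → y ^ e * B y ^ n * ∑ (suc n) (λ k → w k * (+ (n C k) * (- half * B y) ^ k))) ∎
        where
        open ≈-Reasoning
        eq₁ : ∀ w c s z → w * (c * (- s * z)) ≡ -1ℤ * (w * (c * z)) * s
        eq₁ = solve-∀
        eq₂ : ∀ w c z y b b′ → -1ℤ * (w * (c * z)) * (y * (b * b′)) ≡ -1ℤ * (y * b) * (w * (c * (z * b′)))
        eq₂ = solve-∀
        pointwise : ∀ y k → -1ℤ * (w k * (+ (n C k) * (- half) ^ k)) * (y ^ e * B y ^ (n ℕ.+ k)) ≡
                            -1ℤ * (y ^ e * B y ^ n) * (w k * (+ (n C k) * (- half * B y) ^ k))
        pointwise y k = trans
          (cong (λ z → -1ℤ * (w k * (+ (n C k) * (- half) ^ k)) * (y ^ e * z)) (^-+ (B y) n k))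
          (trans (eq₂ (w k) (+ (n C k)) ((- half) ^ k) (y ^ e) (B y ^ n) (B y ^ k))
                 (cong (λ z → -1ℤ * (y ^ e * B y ^ n) * (w k * (+ (n C k) * z))) (sym (^-distrib-* (- half) (B y) k))))

      -- As `half` stands for 1/2, the second factor is (1 - y)/2. The product is even in y, and
      -- this evenness decides below which coefficients exist.
      difference-of-squares : ∀ y → B y * (- half * B y + 1ℤ) ≈ half * (-1ℤ * y ^ 2 + 1ℤ)
      difference-of-squares y = -≈0⇒≈ (≈-trans (≈-reflexive (eq y half))
        (≈-trans (*-congˡ (- (y + 1ℤ)) (≈⇒-≈0 2half≈1)) (≈-reflexive (ℤₚ.*-zeroʳ (- (y + 1ℤ))))))
        where
        eq : ∀ y h → (1ℤ * (y * 1ℤ) + 1ℤ) * (- h * (1ℤ * (y * 1ℤ) + 1ℤ) + 1ℤ) - h * (-1ℤ * (y * (y * 1ℤ)) + 1ℤ)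
                     ≡ - (y + 1ℤ) * (+ 2 * h - 1ℤ)
        eq = solve-∀

      powers : ∀ y m → B y ^ m * (- half * B y + 1ℤ) ^ m ≈ half ^ m * (-1ℤ * y ^ 2 + 1ℤ) ^ m
      powers y m = begin
        B y ^ m * (- half * B y + 1ℤ) ^ m      ≡⟨ ^-distrib-* (B y) (- half * B y + 1ℤ) m ⟨
        (B y * (- half * B y + 1ℤ)) ^ m        ≈⟨ ^-cong m (difference-of-squares y) ⟩
        (half * (-1ℤ * y ^ 2 + 1ℤ)) ^ m        ≡⟨ ^-distrib-* half (-1ℤ * y ^ 2 + 1ℤ) m ⟩
        half ^ m * (-1ℤ * y ^ 2 + 1ℤ) ^ m      ∎
        where open ≈-Reasoning

    ∑term : ∑ (suc n) term ≈ - (half ^ n * ∑ₚ (λ y → y ^ e * (-1ℤ * y ^ 2 + 1ℤ) ^ n))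
    ∑term = begin
      ∑ (suc n) term
        ≡⟨ ∑-cong (suc n) (λ {k} _ → ℤₚ.*-identityˡ (term k)) ⟨
      ∑ (suc n) (λ k → 1ℤ * term k)
        ≈⟨ weighted (λ _ → 1ℤ) ⟩
      - ∑ₚ (λ y → y ^ e * B y ^ n * ∑ (suc n) (λ k → 1ℤ * (+ (n C k) * (- half * B y) ^ k)))
        ≈⟨ neg-cong (∑-cong-≈ p (λ {i} _ → pointwise (+ i))) ⟩
      - ∑ₚ (λ y → half ^ n * (y ^ e * (-1ℤ * y ^ 2 + 1ℤ) ^ n))
        ≡⟨ cong -_ (*-distribˡ-∑ p (half ^ n) (λ i → (+ i) ^ e * (-1ℤ * (+ i) ^ 2 + 1ℤ) ^ n)) ⟨
      - (half ^ n * ∑ₚ (λ y → y ^ e * (-1ℤ * y ^ 2 + 1ℤ) ^ n)) ∎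
      where
      open ≈-Reasoning
      eq : ∀ y h d → y * (h * d) ≡ h * (y * d)
      eq = solve-∀
      pointwise : ∀ y → y ^ e * B y ^ n * ∑ (suc n) (λ k → 1ℤ * (+ (n C k) * (- half * B y) ^ k)) ≈
                        half ^ n * (y ^ e * (-1ℤ * y ^ 2 + 1ℤ) ^ n)
      pointwise y = begin
        y ^ e * B y ^ n * ∑ (suc n) (λ k → 1ℤ * (+ (n C k) * (- half * B y) ^ k))
          ≡⟨ cong (λ z → y ^ e * B y ^ n * z) (trans (∑-cong (suc n) (λ {k} _ → ℤₚ.*-identityˡ (+ (n C k) * (- half * B y) ^ k))) (binomial₁ n (- half * B y))) ⟩
        y ^ e * B y ^ n * (- half * B y + 1ℤ) ^ n
          ≡⟨ ℤₚ.*-assoc (y ^ e) (B y ^ n) _ ⟩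
        y ^ e * (B y ^ n * (- half * B y + 1ℤ) ^ n)
          ≈⟨ *-congˡ (y ^ e) (powers y n) ⟩
        y ^ e * (half ^ n * (-1ℤ * y ^ 2 + 1ℤ) ^ n)
          ≡⟨ eq (y ^ e) (half ^ n) ((-1ℤ * y ^ 2 + 1ℤ) ^ n) ⟩
        half ^ n * (y ^ e * (-1ℤ * y ^ 2 + 1ℤ) ^ n) ∎

    module _ (n′ : ℕ) (n≡1+n′ : n ≡ suc n′) where

      T : ℕ → ℤ
      T i = ∑ₚ (λ y → y ^ (e ℕ.+ i) * (-1ℤ * y ^ 2 + 1ℤ) ^ n′)

      -- Differentiation lowers the power of (1 - y)/2 to n - 1 and leaves two unpaired factors 1 +
      -- y. The three sums `T` come from (1 + y)² = 1 + 2y + y².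
      ∑k*term : ∑ (suc n) (λ k → + k * term k) ≈ + n * half ^ n * (T 0 + + 2 * T 1 + T 2)
      ∑k*term = begin
        ∑ (suc n) (λ k → + k * term k)
          ≈⟨ weighted (λ k → + k) ⟩
        - ∑ₚ (λ y → y ^ e * B y ^ n * ∑ (suc n) (λ k → + k * (+ (n C k) * (- half * B y) ^ k)))
          ≈⟨ neg-cong (∑-cong-≈ p (λ {i} _ → pointwise (+ i))) ⟩
        - ∑ₚ (λ y → c * (t 0 y + + 2 * t 1 y + t 2 y))
          ≡⟨ cong -_ (*-distribˡ-∑ p c (λ i → t 0 (+ i) + + 2 * t 1 (+ i) + t 2 (+ i))) ⟨
        - (c * ∑ₚ (λ y → t 0 y + + 2 * t 1 y + t 2 y))
          ≡⟨ cong (λ z → - (c * z)) (trans (∑-distrib-+ p (λ i → t 0 (+ i) + + 2 * t 1 (+ i)) (λ i → t 2 (+ i)))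
               (cong (_+ T 2) (trans (∑-distrib-+ p (λ i → t 0 (+ i)) (λ i → + 2 * t 1 (+ i)))
                                     (cong (λ z → T 0 + z) (sym (*-distribˡ-∑ p (+ 2) (λ i → t 1 (+ i)))))))) ⟩
        - (c * (T 0 + + 2 * T 1 + T 2))
          ≡⟨ eq₁ (+ n) (half ^ n) (T 0 + + 2 * T 1 + T 2) ⟩
        + n * half ^ n * (T 0 + + 2 * T 1 + T 2) ∎
        where
        open ≈-Reasoning
        c : ℤ
        c = - (+ n * half ^ n)
        t : ℕ → ℤ → ℤ
        t i y = y ^ (e ℕ.+ i) * (-1ℤ * y ^ 2 + 1ℤ) ^ n′
        eq₁ : ∀ n h s → - (- (n * h) * s) ≡ n * h * s
        eq₁ = solve-∀
        eq₂ : ∀ ye b bm h s d → ye * (b * bm) * (s * (- h * b * d)) ≡ - (ye * (b * b) * (s * h)) * (bm * d)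
        eq₂ = solve-∀
        eq₃ : ∀ ye y s h hm q → - (ye * ((1ℤ * (y * 1ℤ) + 1ℤ) * (1ℤ * (y * 1ℤ) + 1ℤ)) * (s * h)) * (hm * q) ≡
                - (s * (h * hm)) * (ye * 1ℤ * q + + 2 * (ye * (y * 1ℤ) * q) + ye * (y * (y * 1ℤ)) * q)
        eq₃ = solve-∀
        pointwise : ∀ y → y ^ e * B y ^ n * ∑ (suc n) (λ k → + k * (+ (n C k) * (- half * B y) ^ k)) ≈
                          c * (t 0 y + + 2 * t 1 y + t 2 y)
        pointwise y rewrite n≡1+n′ = begin
          y ^ e * B y ^ suc n′ * ∑ (suc (suc n′)) (λ k → + k * (+ (suc n′ C k) * (- half * B y) ^ k))
            ≡⟨ cong (λ z → y ^ e * B y ^ suc n′ * z) (binomial-derivative n′ (- half * B y)) ⟩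
          y ^ e * (B y * B y ^ n′) * (+ suc n′ * (- half * B y * (- half * B y + 1ℤ) ^ n′))
            ≡⟨ eq₂ (y ^ e) (B y) (B y ^ n′) half (+ suc n′) ((- half * B y + 1ℤ) ^ n′) ⟩
          - (y ^ e * (B y * B y) * (+ suc n′ * half)) * (B y ^ n′ * (- half * B y + 1ℤ) ^ n′)
            ≈⟨ *-congˡ (- (y ^ e * (B y * B y) * (+ suc n′ * half))) (powers y n′) ⟩
          - (y ^ e * (B y * B y) * (+ suc n′ * half)) * (half ^ n′ * (-1ℤ * y ^ 2 + 1ℤ) ^ n′)
            ≡⟨ eq₃ (y ^ e) y (+ suc n′) half (half ^ n′) ((-1ℤ * y ^ 2 + 1ℤ) ^ n′) ⟩
          - (+ suc n′ * (half * half ^ n′)) * (u 0 + + 2 * u 1 + u 2)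
            ≡⟨ cong (λ z → - (+ suc n′ * (half * half ^ n′)) * z)
                 (sym (cong₂ _+_ (cong₂ _+_ (t≡u 0) (cong (λ z → + 2 * z) (t≡u 1))) (t≡u 2))) ⟩
          - (+ suc n′ * (half * half ^ n′)) * (t 0 y + + 2 * t 1 y + t 2 y) ∎
          where
          u : ℕ → ℤ
          u i = y ^ e * y ^ i * (-1ℤ * y ^ 2 + 1ℤ) ^ n′
          t≡u : ∀ i → t i y ≡ u i
          t≡u i = cong (_* (-1ℤ * y ^ 2 + 1ℤ) ^ n′) (^-+ y e i)

    -- The hypothesis reads (3n + 1)(3n + 2) ≡ 0. Therefore (3k + 1)(3k + 2) ≡ 9k(k + 1) - 9n(n + 1)
    -- = -9(n - k)(n + k + 1), and the last two factors advance C(n, k) and C(n + k, k) to k + 1.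
    -- The constant that remains is -27 ≡ 54 · (-1/2).
    term-residue : + 9 * (+ n * (+ n + 1ℤ)) ≈ - + 2 → ∀ k → + ((3 ℕ.* k) !) ≈ term k * + (54 ℕ.^ k ℕ.* (k !) ℕ.^ 3)
    term-residue 9n[n+1]≈-2 zero    = ≈-refl
    term-residue 9n[n+1]≈-2 (suc k) = begin
      + ((3 ℕ.* suc k) !)
        ≡⟨ cong (λ j → + (j !)) (3*suc k) ⟩
      + (suc (suc (suc (3 ℕ.* k))) !)
        ≡⟨ factorial ⟩
      (+ 3 * K + + 3) * ((+ 3 * K + + 2) * ((+ 3 * K + 1ℤ) * + ((3 ℕ.* k) !)))
        ≈⟨ *-congˡ (+ 3 * K + + 3) (*-congˡ (+ 3 * K + + 2) (*-congˡ (+ 3 * K + 1ℤ) (term-residue 9n[n+1]≈-2 k))) ⟩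
      (+ 3 * K + + 3) * ((+ 3 * K + + 2) * ((+ 3 * K + 1ℤ) * (term k * + D)))
        ≡⟨ eq₁ K (term k * + D) (+ n) ⟩
      + 3 * ((K + 1ℤ) * (term k * + D)) * (- + 9 * ((+ n - K) * (+ n + K + 1ℤ)) + (+ 9 * (+ n * (+ n + 1ℤ)) - - + 2))
        ≈⟨ *-congˡ (+ 3 * ((K + 1ℤ) * (term k * + D))) (+-congˡ (- + 9 * ((+ n - K) * (+ n + K + 1ℤ))) (≈⇒-≈0 9n[n+1]≈-2)) ⟩
      + 3 * ((K + 1ℤ) * (term k * + D)) * (- + 9 * ((+ n - K) * (+ n + K + 1ℤ)) + 0ℤ)
        ≡⟨ eq₂ K (term k * + D) ((+ n - K) * (+ n + K + 1ℤ)) ⟩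
      1ℤ * (- + 27 * ((K + 1ℤ) * (term k * + D)) * ((+ n - K) * (+ n + K + 1ℤ)))
        ≈⟨ *-congʳ (- + 27 * ((K + 1ℤ) * (term k * + D)) * ((+ n - K) * (+ n + K + 1ℤ))) 2half≈1 ⟨
      + 2 * half * (- + 27 * ((K + 1ℤ) * (term k * + D)) * ((+ n - K) * (+ n + K + 1ℤ)))
        ≡⟨ eq₃ half K (+ (n C k)) (+ ((n ℕ.+ k) C k)) ((- half) ^ k) (+ D) (+ n) ⟩
      (+ n - K) * + (n C k) * ((+ n + K + 1ℤ) * + ((n ℕ.+ k) C k)) * (- half * (- half) ^ k) * (+ 54 * (K + 1ℤ)) * + D
        ≡⟨ cong₂ (λ u v → u * v * (- half * (- half) ^ k) * (+ 54 * (K + 1ℤ)) * + D) (sym ([1+k]*nC[1+k]≡[n-k]*nCk n k)) C-step ⟩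
      + suc k * + (n C suc k) * (+ suc k * + ((n ℕ.+ suc k) C suc k)) * (- half * (- half) ^ k) * (+ 54 * (K + 1ℤ)) * + D
        ≡⟨ cong (λ z → + suc k * + (n C suc k) * (+ suc k * + ((n ℕ.+ suc k) C suc k)) * (- half * (- half) ^ k) * (+ 54 * (K + 1ℤ)) * z) D≡ ⟩
      + suc k * + (n C suc k) * (+ suc k * + ((n ℕ.+ suc k) C suc k)) * (- half * (- half) ^ k) * (+ 54 * (K + 1ℤ)) * (+ (54 ℕ.^ k) * (F * (F * F)))
        ≡⟨ eq₄ K (+ (n C suc k)) (+ ((n ℕ.+ suc k) C suc k)) (- half * (- half) ^ k) (+ (54 ℕ.^ k)) F ⟩
      term (suc k) * (+ 54 * + (54 ℕ.^ k) * ((1ℤ + K) * F * ((1ℤ + K) * F * ((1ℤ + K) * F))))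
        ≡⟨ cong (λ z → term (suc k) * z) (sym D′≡) ⟩
      term (suc k) * + (54 ℕ.^ suc k ℕ.* (suc k !) ℕ.^ 3) ∎
      where
      open ≈-Reasoning
      K F : ℤ
      K = + k
      F = + (k !)
      D : ℕ
      D = 54 ℕ.^ k ℕ.* (k !) ℕ.^ 3
      3*suc : ∀ k → 3 ℕ.* suc k ≡ suc (suc (suc (3 ℕ.* k)))
      3*suc = ℕ-solver.solve-∀
      +[m*n^3] : ∀ m n → + (m ℕ.* n ℕ.^ 3) ≡ + m * (+ n * (+ n * + n))
      +[m*n^3] m n = trans (ℤₚ.pos-* m (n ℕ.^ 3)) (cong (λ z → + m * z)
        (trans (cong (λ z → + (n ℕ.* (n ℕ.* z))) (ℕₚ.*-identityʳ n))
               (trans (ℤₚ.pos-* n (n ℕ.* n)) (cong (λ z → + n * z) (ℤₚ.pos-* n n)))))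
      D≡ : + D ≡ + (54 ℕ.^ k) * (F * (F * F))
      D≡ = +[m*n^3] (54 ℕ.^ k) (k !)
      D′≡ : + (54 ℕ.^ suc k ℕ.* (suc k !) ℕ.^ 3) ≡ + 54 * + (54 ℕ.^ k) * ((1ℤ + K) * F * ((1ℤ + K) * F * ((1ℤ + K) * F)))
      D′≡ = trans (+[m*n^3] (54 ℕ.^ suc k) (suc k !))
                  (cong₂ (λ u v → u * (v * (v * v))) (ℤₚ.pos-* 54 (54 ℕ.^ k)) (ℤₚ.pos-* (suc k) (k !)))
      3k≡ : + (3 ℕ.* k) ≡ + 3 * K
      3k≡ = ℤₚ.pos-* 3 k
      suc-+ : ∀ m → + suc m ≡ + m + 1ℤ
      suc-+ m = cong +_ (ℕₚ.+-comm 1 m)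
      factorial : + (suc (suc (suc (3 ℕ.* k))) !) ≡ (+ 3 * K + + 3) * ((+ 3 * K + + 2) * ((+ 3 * K + 1ℤ) * + ((3 ℕ.* k) !)))
      factorial = trans (ℤₚ.pos-* (3 ℕ.+ 3 ℕ.* k) ((2 ℕ.+ 3 ℕ.* k) !)) (cong₂ _*_ (shift 3)
                 (trans (ℤₚ.pos-* (2 ℕ.+ 3 ℕ.* k) ((1 ℕ.+ 3 ℕ.* k) !)) (cong₂ _*_ (shift 2)
                 (trans (ℤₚ.pos-* (1 ℕ.+ 3 ℕ.* k) ((3 ℕ.* k) !)) (cong (_* + ((3 ℕ.* k) !)) (shift 1))))))
        where
        shift : ∀ j → + (j ℕ.+ 3 ℕ.* k) ≡ + 3 * K + + j
        shift j = trans (cong +_ (ℕₚ.+-comm j (3 ℕ.* k))) (cong (_+ + j) 3k≡)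
      C-step : (+ n + K + 1ℤ) * + ((n ℕ.+ k) C k) ≡ + suc k * + ((n ℕ.+ suc k) C suc k)
      C-step = trans (cong (_* + ((n ℕ.+ k) C k)) (sym (suc-+ (n ℕ.+ k))))
               (trans (sym (absorption (n ℕ.+ k) k)) (cong (λ j → + suc k * + (j C suc k)) (sym (ℕₚ.+-suc n k))))
      eq₁ : ∀ k t n → (+ 3 * k + + 3) * ((+ 3 * k + + 2) * ((+ 3 * k + 1ℤ) * t)) ≡
              + 3 * ((k + 1ℤ) * t) * (- + 9 * ((n - k) * (n + k + 1ℤ)) + (+ 9 * (n * (n + 1ℤ)) - - + 2))
      eq₁ = solve-∀
      eq₂ : ∀ k t u → + 3 * ((k + 1ℤ) * t) * (- + 9 * u + 0ℤ) ≡ 1ℤ * (- + 27 * ((k + 1ℤ) * t) * u)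
      eq₂ = solve-∀
      eq₃ : ∀ h k c c′ z d n → + 2 * h * (- + 27 * ((k + 1ℤ) * (c * (c′ * z) * d)) * ((n - k) * (n + k + 1ℤ))) ≡
              (n - k) * c * ((n + k + 1ℤ) * c′) * (- h * z) * (+ 54 * (k + 1ℤ)) * d
      eq₃ = solve-∀
      eq₄ : ∀ k c c′ z d f → (1ℤ + k) * c * ((1ℤ + k) * c′) * z * (+ 54 * (k + 1ℤ)) * (d * (f * (f * f))) ≡
              c * (c′ * z) * (+ 54 * d * ((1ℤ + k) * f * ((1ℤ + k) * f * ((1ℤ + k) * f))))
      eq₄ = solve-∀

  -- Reduction of rationals modulo p

  module RationalResidues (N : ℕ) (p-prime : Prime (suc N)) where
    open Residues N p-prime

    infix 4 _↦_

    -- The reduction map from the rationals with denominator prime to p, as a relation. The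
    -- denominator is multiplied out, so that no inverse has to be chosen.
    record _↦_ (q : ℚ) (a : ℤ) : Set where
      field
        coprime   : Coprime (↧ₙ q) p
        numerator : ↥ q ≈ a * ↧ q

    open _↦_

    ≉0⇒coprime : ∀ {d} → + d ≉ 0ℤ → Coprime d p
    ≉0⇒coprime d≉0 (i∣d , i∣p) with prime⇒irreducible p-prime i∣p
    ... | inj₁ i≡1  = i≡1
    ... | inj₂ refl = contradiction (p∣⇒≈0 i∣d) d≉0

    coprime⇒≉0 : ∀ {d} → Coprime d p → + d ≉ 0ℤ
    coprime⇒≉0 d⊥p d≈0 = 1≉0 (≈-trans (≈-reflexive (cong +_ (sym (d⊥p (≈0⇒p∣ d≈0 , ℕ∣.∣-refl))))) p≈0)

    -- `n ℚ./ d` is put in lowest terms. The cancelled gcd divides d, hence is a unit modulo p, and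
    -- the congruence for the unreduced fraction passes to the reduced one.
    /-residue : ∀ n d .{{_ : ℕ.NonZero d}} {a} → + d ≉ 0ℤ → n ≈ a * + d → n ℚ./ d ↦ a
    /-residue n d {a} d≉0 n≈ad = record
      { coprime   = ≉0⇒coprime λ ↧≈0 → d≉0 (≈-trans (≈-reflexive (sym (ℚₚ.↧-/ n d)))
                      (≈-trans (*-congʳ g ↧≈0) (≈-reflexive (ℤₚ.*-zeroˡ g))))
      ; numerator = *-cancelˡ g≉0 (begin
          g * ↥ q          ≡⟨ trans (ℤₚ.*-comm g (↥ q)) (ℚₚ.↥-/ n d) ⟩
          n                ≈⟨ n≈ad ⟩
          a * + d          ≡⟨ cong (λ z → a * z) (ℚₚ.↧-/ n d) ⟨
          a * (↧ q * g)    ≡⟨ eq a (↧ q) g ⟩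
          g * (a * ↧ q)    ∎)
      }
      where
      open ≈-Reasoning
      q : ℚ
      q = n ℚ./ d
      g : ℤ
      g = gcd n (+ d)
      g≉0 : g ≉ 0ℤ
      g≉0 g≈0 = d≉0 (≈-trans (≈-reflexive (sym (ℚₚ.↧-/ n d)))
                      (≈-trans (*-congˡ (↧ q) g≈0) (≈-reflexive (ℤₚ.*-zeroʳ (↧ q)))))
      eq : ∀ a d g → a * (d * g) ≡ g * (a * d)
      eq = solve-∀

    0-residue : 0ℚ ↦ 0ℤ
    0-residue = record { coprime = 1-coprimeTo p ; numerator = ≈-refl }

    1-residue : 1ℚ ↦ 1ℤ
    1-residue = record { coprime = 1-coprimeTo p ; numerator = ≈-refl }

    denominators : ∀ {q r a b} → q ↦ a → r ↦ b → + (↧ₙ q ℕ.* ↧ₙ r) ≉ 0ℤ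
    denominators {q} {r} q↦a r↦b = *≉0 (coprime⇒≉0 (coprime q↦a)) (coprime⇒≉0 (coprime r↦b)) ∘
      ≈-trans (≈-reflexive (sym (ℤₚ.pos-* (↧ₙ q) (↧ₙ r))))

    +-residue : ∀ {q r a b} → q ↦ a → r ↦ b → q ℚ.+ r ↦ a + b
    +-residue {q@record{}} {r@record{}} {a} {b} q↦a r↦b = /-residue _ _ (denominators q↦a r↦b) (begin
      ↥ q * ↧ r + ↥ r * ↧ q                ≈⟨ +-cong (*-congʳ (↧ r) (numerator q↦a)) (*-congʳ (↧ q) (numerator r↦b)) ⟩
      a * ↧ q * ↧ r + b * ↧ r * ↧ q        ≡⟨ eq a b (↧ q) (↧ r) ⟩
      (a + b) * (↧ q * ↧ r)                ≡⟨ cong (λ z → (a + b) * z) (ℤₚ.pos-* (↧ₙ q) (↧ₙ r)) ⟨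
      (a + b) * + (↧ₙ q ℕ.* ↧ₙ r)          ∎)
      where
      open ≈-Reasoning
      eq : ∀ a b c d → a * c * d + b * d * c ≡ (a + b) * (c * d)
      eq = solve-∀

    *-residue : ∀ {q r a b} → q ↦ a → r ↦ b → q ℚ.* r ↦ a * b
    *-residue {q@record{}} {r@record{}} {a} {b} q↦a r↦b = /-residue _ _ (denominators q↦a r↦b) (begin
      ↥ q * ↥ r                            ≈⟨ *-cong (numerator q↦a) (numerator r↦b) ⟩
      a * ↧ q * (b * ↧ r)                  ≡⟨ eq a b (↧ q) (↧ r) ⟩
      a * b * (↧ q * ↧ r)                  ≡⟨ cong (λ z → a * b * z) (ℤₚ.pos-* (↧ₙ q) (↧ₙ r)) ⟨
      a * b * + (↧ₙ q ℕ.* ↧ₙ r)            ∎)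
      where
      open ≈-Reasoning
      eq : ∀ a b c d → a * c * (b * d) ≡ a * b * (c * d)
      eq = solve-∀

    neg-residue : ∀ {q a} → q ↦ a → ℚ.- q ↦ - a
    neg-residue {q} {a} q↦a = record
      { coprime   = subst (λ d → Coprime d p) (sym (ℤₚ.+-injective (ℚₚ.↧-neg q))) (coprime q↦a)
      ; numerator = begin
          ↥ (ℚ.- q)        ≡⟨ ℚₚ.↥-neg q ⟩
          - ↥ q            ≈⟨ neg-cong (numerator q↦a) ⟩
          - (a * ↧ q)      ≡⟨ ℤₚ.neg-distribˡ-* a (↧ q) ⟩
          - a * ↧ q        ≡⟨ cong (λ d → - a * d) (ℚₚ.↧-neg q) ⟨
          - a * ↧ (ℚ.- q)  ∎
      }
      where open ≈-Reasoning

    ^-residue : ∀ {q a} n → q ↦ a → q ^ℚ n ↦ a ^ n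
    ^-residue zero    q↦a = 1-residue
    ^-residue (suc n) q↦a = *-residue q↦a (^-residue n q↦a)

    ∑-residue : ∀ n {f : ℕ → ℚ} {c : ℕ → ℤ} → (∀ k → k ℕ.≤ n → f k ↦ c k) → ∑≤ n f ↦ ∑ (suc n) c
    ∑-residue zero {f} {c} f↦c = subst (∑≤ 0 f ↦_)
      (sym (trans (∑-first 0 c) (cong (λ z → c 0 + z) (∑-empty (c ∘ suc))))) (+-residue (f↦c 0 z≤n) 0-residue)
    ∑-residue (suc n) {f} {c} f↦c = subst (∑≤ (suc n) f ↦_) (sym (∑-first (suc n) c))
      (+-residue (f↦c 0 z≤n) (∑-residue n (λ k k≤n → f↦c (suc k) (s≤s k≤n))))

    residue⇒≡ : ∀ {q r a b} → q ↦ a → r ↦ b → a ≈ b → q ≡ r [mod p ]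
    residue⇒≡ {q} {r} {a} {b} q↦a r↦b a≈b = record
      { coprimeˡ = coprime q↦a
      ; coprimeʳ = coprime r↦b
      ; m∣x-y    = ≈0⇒p∣ (begin
          ↥ (q ℚ.- r)             ≈⟨ numerator (+-residue q↦a (neg-residue r↦b)) ⟩
          (a - b) * ↧ (q ℚ.- r)   ≈⟨ *-congʳ (↧ (q ℚ.- r)) (≈⇒-≈0 a≈b) ⟩
          0ℤ * ↧ (q ℚ.- r)        ≡⟨ ℤₚ.*-zeroˡ (↧ (q ℚ.- r)) ⟩
          0ℤ                      ∎)
      }
      where open ≈-Reasoning

  -- Exact sums over a complete residue system

  ∣∑∣≤ : ∀ n {f g : ℕ → ℤ} → (∀ k → + ℤ.∣ f k ∣ ≤ g k) → + ℤ.∣ ∑ n f ∣ ≤ ∑ n g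
  ∣∑∣≤ zero    {f} {g} f≤g = ℤₚ.≤-reflexive (trans (cong (λ s → + ℤ.∣ s ∣) (∑-empty f)) (sym (∑-empty g)))
  ∣∑∣≤ (suc n) {f} {g} f≤g = begin
    + ℤ.∣ ∑ (suc n) f ∣                ≡⟨ cong (λ s → + ℤ.∣ s ∣) (∑-last n f) ⟩
    + ℤ.∣ ∑ n f + f n ∣                ≤⟨ +≤+ (ℤₚ.∣i+j∣≤∣i∣+∣j∣ (∑ n f) (f n)) ⟩
    + ℤ.∣ ∑ n f ∣ + + ℤ.∣ f n ∣        ≤⟨ ℤₚ.+-mono-≤ (∣∑∣≤ n f≤g) (f≤g n) ⟩
    ∑ n g + g n                        ≡⟨ ∑-last n g ⟨
    ∑ (suc n) g                        ∎
    where open ℤₚ.≤-Reasoning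

  module ResidueSums (N : ℕ) (p-prime : Prime (suc N)) where
    open Residues N p-prime

    Periodic : (ℤ → ℤ) → Set
    Periodic F = ∀ {a b} → a ≈ b → F a ≡ F b

    -- A nonzero multiple of p has absolute value at least p. This is the passage from residues to
    -- exact integers.
    ≈⇒≡ : ∀ {a b} → ℤ.∣ a - b ∣ ℕ.< p → a ≈ b → a ≡ b
    ≈⇒≡ {a} {b} small a≈b with ℤ.∣ a - b ∣ in eq | ≈0⇒p∣ (≈⇒-≈0 a≈b)
    ... | zero  | _   = ℤₚ.i-j≡0⇒i≡j a b (ℤₚ.∣i∣≡0⇒i≡0 eq)
    ... | suc _ | p∣d = contradiction (ℕ∣.∣⇒≤ p∣d) (ℕₚ.<⇒≱ small)

    +≈+⇒≡ : ∀ {j k} → j ℕ.< p → k ℕ.< p → + j ≈ + k → j ≡ k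
    +≈+⇒≡ {j} {k} j<p k<p = ℤₚ.+-injective ∘ ≈⇒≡ (ℕₚ.≤-<-trans
      (subst (ℕ._≤ j ℕ.⊔ k) (cong ℤ.∣_∣ (sym (ℤₚ.[+m]-[+n]≡m⊖n j k))) (ℤₚ.∣m⊝n∣≤m⊔n j k)) (ℕₚ.⊔-lub j<p k<p))

    opaque
      -- Integer-valued, so that counting solutions of a congruence becomes a summation.
      δ : ℤ → ℤ → ℤ
      δ a b with a ≈? b
      ... | yes _ = 1ℤ
      ... | no _  = 0ℤ

      δ-≈ : ∀ {a b} → a ≈ b → δ a b ≡ 1ℤ
      δ-≈ {a} {b} a≈b with a ≈? b
      ... | yes _  = refl
      ... | no a≉b = contradiction a≈b a≉b

      δ-≉ : ∀ {a b} → a ≉ b → δ a b ≡ 0ℤ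
      δ-≉ {a} {b} a≉b with a ≈? b
      ... | yes a≈b = contradiction a≈b a≉b
      ... | no _    = refl

    δ-⇔ : ∀ {a b c d} → (a ≈ b → c ≈ d) → (c ≈ d → a ≈ b) → δ a b ≡ δ c d
    δ-⇔ {a} {b} to from with a ≈? b
    ... | yes a≈b = trans (δ-≈ a≈b) (sym (δ-≈ (to a≈b)))
    ... | no  a≉b = trans (δ-≉ a≉b) (sym (δ-≉ (a≉b ∘ from)))

    δ-sym : ∀ a b → δ a b ≡ δ b a
    δ-sym a b = δ-⇔ ≈-sym ≈-sym

    ∑ₚ-cong : ∀ {F G : ℤ → ℤ} → (∀ x → F x ≡ G x) → ∑ₚ F ≡ ∑ₚ G
    ∑ₚ-cong F≡G = ∑-cong p λ {k} _ → F≡G (+ k)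

    ∑ₚ-+ : ∀ (F G : ℤ → ℤ) → ∑ₚ (λ x → F x + G x) ≡ ∑ₚ F + ∑ₚ G
    ∑ₚ-+ F G = ∑-distrib-+ p (F ∘ +_) (G ∘ +_)

    ∑ₚ-*ˡ : ∀ c (F : ℤ → ℤ) → ∑ₚ (λ x → c * F x) ≡ c * ∑ₚ F
    ∑ₚ-*ˡ c F = sym (*-distribˡ-∑ p c (F ∘ +_))

    ∑ₚ-*ʳ : ∀ c (F : ℤ → ℤ) → ∑ₚ (λ x → F x * c) ≡ ∑ₚ F * c
    ∑ₚ-*ʳ c F = sym (*-distribʳ-∑ p c (F ∘ +_))

    ∑ₚ-const : ∀ c → ∑ₚ (λ _ → c) ≡ + p * c
    ∑ₚ-const = ∑-const p

    ∑ₚ-comm : ∀ (F : ℤ → ℤ → ℤ) → ∑ₚ (λ x → ∑ₚ (F x)) ≡ ∑ₚ (λ y → ∑ₚ (λ x → F x y))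
    ∑ₚ-comm F = ∑-comm p p λ i j → F (+ i) (+ j)

    ∑ₚ-δ : ∀ c {F} → Periodic F → ∑ₚ (λ x → δ x c * F x) ≡ F c
    ∑ₚ-δ c {F} F-periodic = begin
      ∑ₚ (λ x → δ x c * F x)                  ≡⟨ ∑-single (λ k → δ (+ k) c * F (+ k)) (reduce<p c) others ⟩
      δ (+ reduce c) c * F (+ reduce c)       ≡⟨ cong₂ _*_ (δ-≈ (≈-sym (≈reduce c))) (F-periodic (≈-sym (≈reduce c))) ⟩
      1ℤ * F c                                ≡⟨ ℤₚ.*-identityˡ (F c) ⟩
      F c                                     ∎
      where
      open ≡-Reasoning
      others : ∀ {k} → k ℕ.< p → k ≢ reduce c → δ (+ k) c * F (+ k) ≡ 0ℤ
      others {k} k<p k≢c = trans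
        (cong (_* F (+ k)) (δ-≉ λ k≈c → k≢c (+≈+⇒≡ k<p (reduce<p c) (≈-trans k≈c (≈reduce c)))))
        (ℤₚ.*-zeroˡ (F (+ k)))

    ∑ₚ-δ-count : ∀ c → ∑ₚ (λ x → δ x c) ≡ 1ℤ
    ∑ₚ-δ-count c = trans (∑ₚ-cong λ x → sym (ℤₚ.*-identityʳ (δ x c))) (∑ₚ-δ c λ _ → refl)

    -- Inserting `δ x (σ y)` and exchanging the sums takes the place of a permutation argument: for
    -- each x exactly one residue y, that of τ x, is counted.
    reindex : ∀ {F} → Periodic F → (σ τ : ℤ → ℤ) → (∀ x y → x ≈ σ y → y ≈ τ x) → (∀ x y → y ≈ τ x → x ≈ σ y) →
              ∑ₚ (F ∘ σ) ≡ ∑ₚ F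
    reindex {F} F-periodic σ τ to from = begin
      ∑ₚ (F ∘ σ)                                ≡⟨ ∑ₚ-cong (λ y → ∑ₚ-δ (σ y) F-periodic) ⟨
      ∑ₚ (λ y → ∑ₚ (λ x → δ x (σ y) * F x))     ≡⟨ ∑ₚ-comm (λ y x → δ x (σ y) * F x) ⟩
      ∑ₚ (λ x → ∑ₚ (λ y → δ x (σ y) * F x))     ≡⟨ ∑ₚ-cong (λ x → ∑ₚ-*ʳ (F x) (λ y → δ x (σ y))) ⟩
      ∑ₚ (λ x → ∑ₚ (λ y → δ x (σ y)) * F x)
        ≡⟨ ∑ₚ-cong (λ x → trans (cong (_* F x) (trans (∑ₚ-cong λ y → δ-⇔ (to x y) (from x y)) (∑ₚ-δ-count (τ x)))) (ℤₚ.*-identityˡ (F x))) ⟩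
      ∑ₚ F                                      ∎
      where open ≡-Reasoning

    shift : ∀ {F} → Periodic F → ∀ a → ∑ₚ (λ x → F (x + a)) ≡ ∑ₚ F
    shift F-periodic a = reindex F-periodic (_+ a) (_- a)
      (λ x y x≈y+a → ≈-trans (≈-reflexive (eq₁ y a)) (+-congʳ (- a) (≈-sym x≈y+a)))
      (λ x y y≈x-a → ≈-trans (≈-reflexive (eq₂ x a)) (+-congʳ a (≈-sym y≈x-a)))
      where
      eq₁ : ∀ y a → y ≡ y + a - a
      eq₁ = solve-∀
      eq₂ : ∀ x a → x ≡ x - a + a
      eq₂ = solve-∀

    -- The power t^(p - 2), an inverse of t ≢ 0 by Fermat's theorem.
    inverse : ℤ → ℤ
    inverse t = t ^ (N ℕ.∸ 1)

    *-inverse : ∀ {t} → t ≉ 0ℤ → t * inverse t ≈ 1ℤ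
    *-inverse {t} t≉0 = ≈-trans (≈-reflexive (cong (t ^_) (ℕₚ.m+[n∸m]≡n 0<N))) (a^N≈1 t≉0)

    scale : ∀ {F} → Periodic F → ∀ {t} → t ≉ 0ℤ → ∑ₚ (λ x → F (t * x)) ≡ ∑ₚ F
    scale F-periodic {t} t≉0 = reindex F-periodic (t *_) (inverse t *_)
      (λ x y x≈ty → *-cancelˡ t≉0 (≈-trans (≈-sym x≈ty) (≈-sym (t[t⁻¹x]≈x x))))
      (λ x y y≈t⁻¹x → ≈-trans (≈-sym (t[t⁻¹x]≈x x)) (*-congˡ t (≈-sym y≈t⁻¹x)))
      where
      t[t⁻¹x]≈x : ∀ x → t * (inverse t * x) ≈ x
      t[t⁻¹x]≈x x = ≈-trans (≈-reflexive (sym (ℤₚ.*-assoc t (inverse t) x)))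
                    (≈-trans (*-congʳ x (*-inverse t≉0)) (≈-reflexive (ℤₚ.*-identityˡ x)))

  -- The quadratic character and its orthogonality

  module QuadraticCharacter (N : ℕ) (p-prime : Prime (suc N)) (h : ℕ) (h+h≡N : h ℕ.+ h ≡ N) where
    open Residues N p-prime
    open ResidueSums N p-prime

    0<h : 0 ℕ.< h
    0<h = ℕₚ.n≢0⇒n>0 λ { refl → ℕₚ.<⇒≢ 0<N h+h≡N }

    2<p : 2 ℕ.< p
    2<p = s≤s (subst (2 ℕ.≤_) h+h≡N (ℕₚ.+-mono-≤ 0<h 0<h))

    -- The values of the quadratic character, by Euler's criterion.
    data Value (a : ℤ) : ℤ → Set where
      zero       : a ≈ 0ℤ → Value a 0ℤ
      residue    : a ≉ 0ℤ → a ^ h ≈ 1ℤ → Value a 1ℤ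
      nonresidue : a ≉ 0ℤ → a ^ h ≈ -1ℤ → Value a -1ℤ

    ^h≈±1 : ∀ {a} → a ≉ 0ℤ → a ^ h ≈ 1ℤ ⊎ a ^ h ≈ -1ℤ
    ^h≈±1 {a} a≉0 = ⊎.map -≈0⇒≈ -≈0⇒≈ (*≈0 (a ^ h - 1ℤ) (a ^ h - -1ℤ) (≈-trans (≈-reflexive difference) (≈⇒-≈0 (a^N≈1 a≉0))))
      where
      eq : ∀ x → (x - 1ℤ) * (x - -1ℤ) ≡ x * x - 1ℤ
      eq = solve-∀
      difference : (a ^ h - 1ℤ) * (a ^ h - -1ℤ) ≡ a ^ N - 1ℤ
      difference = trans (eq (a ^ h)) (cong (_- 1ℤ) (trans (sym (^-+ a h h)) (cong (a ^_) h+h≡N)))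

    opaque
      classify : ∀ a → ∃ (Value a)
      classify a = split (a ≈? 0ℤ)
        where
        split : Dec (a ≈ 0ℤ) → ∃ (Value a)
        split (yes a≈0) = 0ℤ , zero a≈0
        split (no a≉0)  = ⊎.[ (λ e → 1ℤ , residue a≉0 e) , (λ e → -1ℤ , nonresidue a≉0 e) ]′ (^h≈±1 a≉0)

    χ : ℤ → ℤ
    χ a = proj₁ (classify a)

    χ-value : ∀ a → Value a (χ a)
    χ-value a = proj₂ (classify a)

    χ≈^h : ∀ a → χ a ≈ a ^ h
    χ≈^h a with χ a | χ-value a
    ... | _ | zero a≈0       = ≈-sym (≈-trans (^-cong h a≈0) (≈-reflexive (0^ 0<h)))
    ... | _ | residue _ e    = ≈-sym e
    ... | _ | nonresidue _ e = ≈-sym e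

    ∣χ∣≤1 : ∀ a → ℤ.∣ χ a ∣ ℕ.≤ 1
    ∣χ∣≤1 a with χ a | χ-value a
    ... | _ | zero _         = z≤n
    ... | _ | residue _ _    = ℕₚ.≤-refl
    ... | _ | nonresidue _ _ = ℕₚ.≤-refl

    χ-≈0 : ∀ {a} → a ≈ 0ℤ → χ a ≡ 0ℤ
    χ-≈0 {a} a≈0 with χ a | χ-value a
    ... | _ | zero _           = refl
    ... | _ | residue a≉0 _    = contradiction a≈0 a≉0
    ... | _ | nonresidue a≉0 _ = contradiction a≈0 a≉0

    χ² : ∀ {a} → a ≉ 0ℤ → χ a * χ a ≡ 1ℤ
    χ² {a} a≉0 with χ a | χ-value a
    ... | _ | zero a≈0       = contradiction a≈0 a≉0
    ... | _ | residue _ _    = refl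
    ... | _ | nonresidue _ _ = refl

    private
      -- Two such integers differ by at most 2 < p. Periodicity and multiplicativity of χ are
      -- thereby inherited from the power a^h.
      trits : ∀ {x y} → ℤ.∣ x ∣ ℕ.≤ 1 → ℤ.∣ y ∣ ℕ.≤ 1 → x ≈ y → x ≡ y
      trits {x} {y} ∣x∣≤1 ∣y∣≤1 = ≈⇒≡ (ℕₚ.≤-<-trans (ℤₚ.∣i-j∣≤∣i∣+∣j∣ x y) (ℕₚ.≤-<-trans (ℕₚ.+-mono-≤ ∣x∣≤1 ∣y∣≤1) 2<p))

      ∣χχ∣≤1 : ∀ a b → ℤ.∣ χ a * χ b ∣ ℕ.≤ 1
      ∣χχ∣≤1 a b = subst (ℕ._≤ 1) (sym (ℤₚ.abs-* (χ a) (χ b))) (ℕₚ.*-mono-≤ (∣χ∣≤1 a) (∣χ∣≤1 b))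

    χ-periodic : Periodic χ
    χ-periodic {a} {b} a≈b = trits (∣χ∣≤1 a) (∣χ∣≤1 b) (≈-trans (χ≈^h a) (≈-trans (^-cong h a≈b) (≈-sym (χ≈^h b))))

    χ-* : ∀ a b → χ (a * b) ≡ χ a * χ b
    χ-* a b = trits (∣χ∣≤1 (a * b)) (∣χχ∣≤1 a b) (begin
      χ (a * b)      ≈⟨ χ≈^h (a * b) ⟩
      (a * b) ^ h    ≡⟨ ^-distrib-* a b h ⟩
      a ^ h * b ^ h  ≈⟨ *-cong (χ≈^h a) (χ≈^h b) ⟨
      χ a * χ b      ∎)
      where open ≈-Reasoning

    χ1≡1 : χ 1ℤ ≡ 1ℤ
    χ1≡1 = trits (∣χ∣≤1 1ℤ) ℕₚ.≤-refl (≈-trans (χ≈^h 1ℤ) (≈-reflexive (ℤₚ.^-zeroˡ h)))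

    -- Power sums determine the next two sums modulo p, and counting nonzero summands bounds them by less than p.
    ∑χ≡0 : ∑ₚ χ ≡ 0ℤ
    ∑χ≡0 = ≈⇒≡ (ℤₚ.drop‿+<+ bound)
      (≈-trans (∑-cong-≈ p λ {k} _ → χ≈^h (+ k)) (power-sum-small h (subst (h ℕ.<_) h+h≡N (ℕₚ.m<m+n h 0<h))))
      where
      open ℤₚ.≤-Reasoning
      pointwise : ∀ x → + ℤ.∣ χ x ∣ ≤ 1ℤ + -1ℤ * δ x 0ℤ
      pointwise x with x ≈? 0ℤ
      ... | yes x≈0 rewrite χ-≈0 x≈0 | δ-≈ x≈0 = ℤₚ.≤-refl
      ... | no  x≉0 rewrite δ-≉ x≉0 = +≤+ (∣χ∣≤1 x)
      eq : ∀ n → (1ℤ + n) * 1ℤ + -1ℤ * 1ℤ ≡ n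
      eq = solve-∀
      bound : + ℤ.∣ ∑ₚ χ - 0ℤ ∣ < + p
      bound = begin-strict
        + ℤ.∣ ∑ₚ χ - 0ℤ ∣                  ≡⟨ cong (λ z → + ℤ.∣ z ∣) (ℤₚ.+-identityʳ (∑ₚ χ)) ⟩
        + ℤ.∣ ∑ₚ χ ∣                       ≤⟨ ∣∑∣≤ p (λ k → pointwise (+ k)) ⟩
        ∑ₚ (λ x → 1ℤ + -1ℤ * δ x 0ℤ)       ≡⟨ ∑ₚ-+ (λ _ → 1ℤ) (λ x → -1ℤ * δ x 0ℤ) ⟩
        ∑ₚ (λ _ → 1ℤ) + ∑ₚ (λ x → -1ℤ * δ x 0ℤ)
          ≡⟨ cong₂ _+_ (∑ₚ-const 1ℤ) (trans (∑ₚ-*ˡ -1ℤ (λ x → δ x 0ℤ)) (cong (λ z → -1ℤ * z) (∑ₚ-δ-count 0ℤ))) ⟩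
        + p * 1ℤ + -1ℤ * 1ℤ                ≡⟨ eq (+ N) ⟩
        + N                                <⟨ ℤ.+<+ (ℕₚ.n<1+n N) ⟩
        + p                                ∎

    ∑χχ : ∀ c → ∑ₚ (λ x → χ x * χ (x + c)) ≡ + p * δ c 0ℤ - 1ℤ
    ∑χχ c with c ≈? 0ℤ
    ... | yes c≈0 = begin
      ∑ₚ (λ x → χ x * χ (x + c))                ≡⟨ ∑ₚ-cong pointwise ⟩
      ∑ₚ (λ x → 1ℤ + -1ℤ * δ x 0ℤ)              ≡⟨ ∑ₚ-+ (λ _ → 1ℤ) (λ x → -1ℤ * δ x 0ℤ) ⟩
      ∑ₚ (λ _ → 1ℤ) + ∑ₚ (λ x → -1ℤ * δ x 0ℤ)
        ≡⟨ cong₂ _+_ (∑ₚ-const 1ℤ) (trans (∑ₚ-*ˡ -1ℤ (λ x → δ x 0ℤ)) (cong (λ z → -1ℤ * z) (∑ₚ-δ-count 0ℤ))) ⟩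
      + p * 1ℤ + -1ℤ * 1ℤ                       ≡⟨ cong (λ d → + p * d - 1ℤ) (sym (δ-≈ c≈0)) ⟩
      + p * δ c 0ℤ - 1ℤ                         ∎
      where
      open ≡-Reasoning
      pointwise : ∀ x → χ x * χ (x + c) ≡ 1ℤ + -1ℤ * δ x 0ℤ
      pointwise x rewrite χ-periodic (≈-trans (+-congˡ x c≈0) (≈-reflexive (ℤₚ.+-identityʳ x))) with x ≈? 0ℤ
      ... | yes x≈0 rewrite χ-≈0 x≈0 | δ-≈ x≈0 = refl
      ... | no  x≉0 rewrite χ² x≉0 | δ-≉ x≉0 = refl
    ... | no c≉0 = trans (≈⇒≡ (ℤₚ.drop‿+<+ bound) s≈-1) (sym (trans (cong (λ d → + p * d - 1ℤ) (δ-≉ c≉0)) (cong (_- 1ℤ) (ℤₚ.*-zeroʳ (+ p)))))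
      where
      s : ℤ
      s = ∑ₚ (λ x → χ x * χ (x + c))
      s≈-1 : s ≈ -1ℤ
      s≈-1 = begin
        s                                              ≈⟨ ∑-cong-≈ p (λ {k} _ → pointwise (+ k)) ⟩
        -- As h + h = N, only the leading term of the second factor reaches the exponent N, so the
        -- result does not depend on c.
        ∑ₚ (λ x → x ^ h * (1ℤ * x ^ 1 + c) ^ h)        ≈⟨ extract-coefficient h 1 1ℤ c h small ℕₚ.≤-refl h+1*h≡N ⟩
        - (+ (h C h) * (1ℤ ^ h * c ^ (h ℕ.∸ h)))
          ≡⟨ cong -_ (cong₂ _*_ (cong +_ (nCn≡1 h)) (cong₂ _*_ (ℤₚ.^-zeroˡ h) (cong (c ^_) (ℕₚ.n∸n≡0 h)))) ⟩
        -1ℤ                                            ∎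
        where
        open ≈-Reasoning
        eq : ∀ x c → x + c ≡ 1ℤ * (x * 1ℤ) + c
        eq = solve-∀
        pointwise : ∀ x → χ x * χ (x + c) ≈ x ^ h * (1ℤ * x ^ 1 + c) ^ h
        pointwise x = *-cong (χ≈^h x) (≈-trans (χ≈^h (x + c)) (≈-reflexive (cong (_^ h) (eq x c))))
        h+1*h≡N : h ℕ.+ 1 ℕ.* h ≡ N
        h+1*h≡N = trans (cong (h ℕ.+_) (ℕₚ.*-identityˡ h)) h+h≡N
        small : h ℕ.+ 1 ℕ.* h ℕ.< N ℕ.+ N
        small = subst (ℕ._< N ℕ.+ N) (sym h+1*h≡N) (ℕₚ.m<m+n N 0<N)
      open ℤₚ.≤-Reasoning
      pointwise : ∀ x → + ℤ.∣ χ x * χ (x + c) ∣ ≤ 1ℤ + -1ℤ * (δ x 0ℤ + δ x (- c))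
      pointwise x with x ≈? 0ℤ | x ≈? - c
      ... | yes x≈0 | yes x≈-c = contradiction
              (≈-trans (≈-reflexive (sym (ℤₚ.neg-involutive c))) (neg-cong (≈-trans (≈-sym x≈-c) x≈0))) c≉0
      ... | yes x≈0 | no x≉-c rewrite χ-≈0 x≈0 | δ-≈ x≈0 | δ-≉ x≉-c | ℤₚ.*-zeroˡ (χ (x + c)) = ℤₚ.≤-refl
      ... | no x≉0  | yes x≈-c rewrite δ-≉ x≉0 | δ-≈ x≈-c
                                     | χ-≈0 (≈-trans (+-congʳ c x≈-c) (≈-reflexive (ℤₚ.+-inverseˡ c)))
                                     | ℤₚ.*-zeroʳ (χ x) = ℤₚ.≤-refl
      ... | no x≉0  | no x≉-c rewrite δ-≉ x≉0 | δ-≉ x≉-c = +≤+ (∣χχ∣≤1 x (x + c))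
      eq : ∀ n → (1ℤ + n) * 1ℤ + -1ℤ * (1ℤ + 1ℤ) + 1ℤ ≡ n
      eq = solve-∀
      -- The summands at the two distinct residues 0 and -c vanish. Hence |s| ≤ p - 2, and |s + 1|
      -- stays below p.
      bound : + ℤ.∣ s - -1ℤ ∣ < + p
      bound = begin-strict
        + ℤ.∣ s - -1ℤ ∣                                         ≤⟨ +≤+ (ℤₚ.∣i-j∣≤∣i∣+∣j∣ s -1ℤ) ⟩
        + ℤ.∣ s ∣ + 1ℤ                                          ≤⟨ ℤₚ.+-monoˡ-≤ 1ℤ (∣∑∣≤ p (λ k → pointwise (+ k))) ⟩
        ∑ₚ (λ x → 1ℤ + -1ℤ * (δ x 0ℤ + δ x (- c))) + 1ℤ         ≡⟨ cong (_+ 1ℤ) (∑ₚ-+ (λ _ → 1ℤ) (λ x → -1ℤ * (δ x 0ℤ + δ x (- c)))) ⟩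
        ∑ₚ (λ _ → 1ℤ) + ∑ₚ (λ x → -1ℤ * (δ x 0ℤ + δ x (- c))) + 1ℤ
          ≡⟨ cong (_+ 1ℤ) (cong₂ _+_ (∑ₚ-const 1ℤ) (trans (∑ₚ-*ˡ -1ℤ (λ x → δ x 0ℤ + δ x (- c)))
               (cong (λ z → -1ℤ * z) (trans (∑ₚ-+ (λ x → δ x 0ℤ) (λ x → δ x (- c))) (cong₂ _+_ (∑ₚ-δ-count 0ℤ) (∑ₚ-δ-count (- c))))))) ⟩
        + p * 1ℤ + -1ℤ * (1ℤ + 1ℤ) + 1ℤ                         ≡⟨ eq (+ N) ⟩
        + N                                                     <⟨ ℤ.+<+ (ℕₚ.n<1+n N) ⟩
        + p                                                     ∎

    -- Translation by a reduces this to `∑χχ`. Both moments of χ(D)ψ(D) rest on this form, with D as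
    -- summation variable and cubes for a and b.
    ∑χ[+a]χ[+b] : ∀ a b → ∑ₚ (λ x → χ (a + x) * χ (b + x)) ≡ + p * δ b a - 1ℤ
    ∑χ[+a]χ[+b] a b = begin
      ∑ₚ (λ x → χ (a + x) * χ (b + x))               ≡⟨ ∑ₚ-cong (λ x → cong₂ (λ u v → χ u * χ v) (ℤₚ.+-comm a x) (eq a b x)) ⟩
      ∑ₚ (λ x → χ (x + a) * χ (x + a + (b - a)))     ≡⟨ shift periodic a ⟩
      ∑ₚ (λ x → χ x * χ (x + (b - a)))               ≡⟨ ∑χχ (b - a) ⟩
      + p * δ (b - a) 0ℤ - 1ℤ                        ≡⟨ cong (λ d → + p * d - 1ℤ) (δ-⇔ -≈0⇒≈ ≈⇒-≈0) ⟩
      + p * δ b a - 1ℤ                               ∎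
      where
      open ≡-Reasoning
      eq : ∀ a b x → b + x ≡ x + a + (b - a)
      eq = solve-∀
      periodic : Periodic (λ x → χ x * χ (x + (b - a)))
      periodic x≈y = cong₂ _*_ (χ-periodic x≈y) (χ-periodic (+-congʳ (b - a) x≈y))

  -- Cosets of the cubes modulo p = 6m + 1

  module CubicClasses (N : ℕ) (p-prime : Prime (suc N)) (m : ℕ) (N≡6m : N ≡ 6 ℕ.* m) where
    open Residues N p-prime
    open ResidueSums N p-prime

    -- The exponent (p - 1)/3: D ↦ D^q is the cubic residue character with values modulo p.
    q : ℕ
    q = 2 ℕ.* m

    q+q+q≡N : q ℕ.+ (q ℕ.+ q) ≡ N
    q+q+q≡N = trans (eq m) (sym N≡6m)
      where
      eq : ∀ m → 2 ℕ.* m ℕ.+ (2 ℕ.* m ℕ.+ 2 ℕ.* m) ≡ 6 ℕ.* m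
      eq = ℕ-solver.solve-∀

    0<q : 0 ℕ.< q
    0<q = ℕₚ.n≢0⇒n>0 λ q≡0 → ℕₚ.<⇒≢ 0<N (trans (cong (λ q → q ℕ.+ (q ℕ.+ q)) (sym q≡0)) q+q+q≡N)

    q<N : q ℕ.< N
    q<N = subst (q ℕ.<_) q+q+q≡N (ℕₚ.m<m+n q (ℕₚ.<-≤-trans 0<q (ℕₚ.m≤m+n q q)))

    ^3^q : ∀ {t} → t ≉ 0ℤ → (t ^ 3) ^ q ≈ 1ℤ
    ^3^q {t} t≉0 = ≈-trans (≈-reflexive (trans (ℤₚ.^-*-assoc t 3 q) (cong (t ^_) 3*q≡N))) (a^N≈1 t≉0)
      where
      3*q≡N : 3 ℕ.* q ≡ N
      3*q≡N = trans (cong (λ z → q ℕ.+ (q ℕ.+ z)) (ℕₚ.+-identityʳ q)) q+q+q≡N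

    ^3≈0⇒≈0 : ∀ {t} → t ^ 3 ≈ 0ℤ → t ≈ 0ℤ
    ^3≈0⇒≈0 {t} t³≈0 = decidable-stable (t ≈? 0ℤ) λ t≉0 → ^≉0 3 t≉0 t³≈0

    ≈0⇒^3≈0 : ∀ {t} → t ≈ 0ℤ → t ^ 3 ≈ 0ℤ
    ≈0⇒^3≈0 = ^-cong 3

    -- If xᑫ were 1 for all x ≠ 0, then Σ xᑫ and Σ xᴺ would agree.
    opaque
      noncube : ∃ λ g → g ≉ 0ℤ × g ^ q ≉ 1ℤ
      noncube with ℕₚ.anyUpTo? (λ k → ¬? (+ k ≈? 0ℤ) ×-dec ¬? ((+ k) ^ q ≈? 1ℤ)) p
      ... | yes (k , _ , found) = + k , found
      ... | no none = contradiction
        (≈-trans (≈-sym (≈-trans (∑-cong-≈ p λ {k} k<p → agree k<p) power-sum-N)) (power-sum-small q q<N))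
        λ -1≈0 → 1≉0 (neg-cong -1≈0)
        where
        agree : ∀ {k} → k ℕ.< p → (+ k) ^ q ≈ (+ k) ^ N
        agree {k} k<p with + k ≈? 0ℤ
        ... | yes k≈0 = ≈-trans (≈-trans (^-cong q k≈0) (≈-reflexive (0^ 0<q)))
                                (≈-sym (≈-trans (^-cong N k≈0) (≈-reflexive (0^ 0<N))))
        ... | no  k≉0 = ≈-trans (decidable-stable ((+ k) ^ q ≈? 1ℤ) λ k^q≉1 → none (k , k<p , k≉0 , k^q≉1))
                                (≈-sym (a^N≈1 k≉0))

    -- ω is a primitive cube root of unity. The cosets of 1, g and g² are told apart by their q-th
    -- powers 1, ω and ω².
    g ω : ℤ
    g = proj₁ noncube
    ω = g ^ q

    g≉0 : g ≉ 0ℤ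
    g≉0 = proj₁ (proj₂ noncube)

    ω≉1 : ω ≉ 1ℤ
    ω≉1 = proj₂ (proj₂ noncube)

    ω≉0 : ω ≉ 0ℤ
    ω≉0 = ^≉0 q g≉0

    ω³≈1 : ω * (ω * ω) ≈ 1ℤ
    ω³≈1 = ≈-trans (≈-reflexive (trans (cong (λ z → ω * z) (sym (^-+ g q q)))
             (trans (sym (^-+ g q (q ℕ.+ q))) (cong (g ^_) q+q+q≡N)))) (a^N≈1 g≉0)

    ω²≉1 : ω * ω ≉ 1ℤ
    ω²≉1 ω²≈1 = ω≉1 (≈-trans (≈-trans (≈-reflexive (sym (ℤₚ.*-identityʳ ω))) (*-congˡ ω (≈-sym ω²≈1))) ω³≈1)

    ω²≉ω : ω * ω ≉ ω
    ω²≉ω ω²≈ω = ω≉1 (*-cancelˡ ω≉0 (≈-trans ω²≈ω (≈-reflexive (sym (ℤₚ.*-identityʳ ω)))))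

    1+ω+ω²≈0 : 1ℤ + ω + ω * ω ≈ 0ℤ
    1+ω+ω²≈0 = [ (λ ω-1≈0 → contradiction (-≈0⇒≈ ω-1≈0) ω≉1) , id ]′
      (*≈0 (ω - 1ℤ) (1ℤ + ω + ω * ω) (≈-trans (≈-reflexive (eq ω)) (≈⇒-≈0 ω³≈1)))
      where
      eq : ∀ w → (w - 1ℤ) * (1ℤ + w + w * w) ≡ w * (w * w) - 1ℤ
      eq = solve-∀

    -- For t ≢ 0, the indicator of the set of cube roots of t³.
    δ³ : ℤ → ℤ → ℤ
    δ³ x t = δ x t + (δ x (ω * t) + δ x (ω * ω * t))

    δ³-exclusive : ∀ x {t} → t ≉ 0ℤ → δ³ x t ≡ 0ℤ × x ≉ t × x ≉ ω * t × x ≉ ω * ω * t ⊎ δ³ x t ≡ 1ℤ × (x ≈ t ⊎ x ≈ ω * t ⊎ x ≈ ω * ω * t)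
    δ³-exclusive x {t} t≉0 = split (x ≈? t) (x ≈? ω * t) (x ≈? ω * ω * t)
      where
      split : Dec (x ≈ t) → Dec (x ≈ ω * t) → Dec (x ≈ ω * ω * t) →
              δ³ x t ≡ 0ℤ × x ≉ t × x ≉ ω * t × x ≉ ω * ω * t ⊎ δ³ x t ≡ 1ℤ × (x ≈ t ⊎ x ≈ ω * t ⊎ x ≈ ω * ω * t)
      split (no  a) (no  b) (no  c) = inj₁ (cong₂ _+_ (δ-≉ a) (cong₂ _+_ (δ-≉ b) (δ-≉ c)) , a , b , c)
      split (yes a) (no  b) (no  c) = inj₂ (cong₂ _+_ (δ-≈ a) (cong₂ _+_ (δ-≉ b) (δ-≉ c)) , inj₁ a)
      split (no  a) (yes b) (no  c) = inj₂ (cong₂ _+_ (δ-≉ a) (cong₂ _+_ (δ-≈ b) (δ-≉ c)) , inj₂ (inj₁ b))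
      split (no  a) (no  b) (yes c) = inj₂ (cong₂ _+_ (δ-≉ a) (cong₂ _+_ (δ-≉ b) (δ-≈ c)) , inj₂ (inj₂ c))
      split (yes a) (yes b) _ = contradiction (*-cancelˡ t≉0 (≈-trans (≈-reflexive (ℤₚ.*-comm t ω))
        (≈-trans (≈-sym b) (≈-trans a (≈-reflexive (sym (ℤₚ.*-identityʳ t))))))) ω≉1
      split (yes a) (no _) (yes c) = contradiction (*-cancelˡ t≉0 (≈-trans (≈-reflexive (ℤₚ.*-comm t (ω * ω)))
        (≈-trans (≈-sym c) (≈-trans a (≈-reflexive (sym (ℤₚ.*-identityʳ t))))))) ω²≉1
      split (no _) (yes b) (yes c) = contradiction (*-cancelˡ t≉0 (≈-trans (≈-reflexive (ℤₚ.*-comm t (ω * ω)))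
        (≈-trans (≈-sym c) (≈-trans b (≈-reflexive (ℤₚ.*-comm ω t)))))) ω²≉ω

    cube-factors : ∀ y t → (y - t) * ((y - ω * t) * (y - ω * ω * t)) ≈ y ^ 3 - t ^ 3
    cube-factors y t = begin
      (y - t) * ((y - ω * t) * (y - ω * ω * t))
        ≡⟨ eq y t ω ⟩
      (1ℤ + ω + ω * ω) * (ω * (t * t * y) - t * y * y) + (y ^ 3 - ω * (ω * ω) * t ^ 3)
        ≈⟨ +-cong (*-congʳ (ω * (t * t * y) - t * y * y) 1+ω+ω²≈0) (+-congˡ (y ^ 3) (neg-cong (*-congʳ (t ^ 3) ω³≈1))) ⟩
      0ℤ * (ω * (t * t * y) - t * y * y) + (y ^ 3 - 1ℤ * t ^ 3)
        ≡⟨ cong₂ (λ u v → u + (y ^ 3 - v)) (ℤₚ.*-zeroˡ (ω * (t * t * y) - t * y * y)) (ℤₚ.*-identityˡ (t ^ 3)) ⟩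
      0ℤ + (y ^ 3 - t ^ 3)
        ≡⟨ ℤₚ.+-identityˡ (y ^ 3 - t ^ 3) ⟩
      y ^ 3 - t ^ 3 ∎
      where
      open ≈-Reasoning
      eq : ∀ y t w → (y - t) * ((y - w * t) * (y - w * w * t)) ≡
        (1ℤ + w + w * w) * (w * (t * t * y) - t * y * y) + (y * (y * (y * 1ℤ)) - w * (w * w) * (t * (t * (t * 1ℤ))))
      eq = solve-∀

    δ-cube : ∀ {t} → t ≉ 0ℤ → ∀ y → δ (y ^ 3) (t ^ 3) ≡ δ³ y t
    δ-cube {t} t≉0 y = [ no-root , root ]′ (δ³-exclusive y t≉0)
      where
      vanish : y ≈ t ⊎ y ≈ ω * t ⊎ y ≈ ω * ω * t → (y - t) * ((y - ω * t) * (y - ω * ω * t)) ≈ 0ℤ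
      vanish (inj₁ a) = ≈-trans (*-congʳ ((y - ω * t) * (y - ω * ω * t)) (≈⇒-≈0 a))
        (≈-reflexive (ℤₚ.*-zeroˡ ((y - ω * t) * (y - ω * ω * t))))
      vanish (inj₂ (inj₁ b)) = ≈-trans (*-congˡ (y - t) (*-congʳ (y - ω * ω * t) (≈⇒-≈0 b)))
        (≈-reflexive (trans (cong (λ z → (y - t) * z) (ℤₚ.*-zeroˡ (y - ω * ω * t))) (ℤₚ.*-zeroʳ (y - t))))
      vanish (inj₂ (inj₂ c)) = ≈-trans (*-congˡ (y - t) (*-congˡ (y - ω * t) (≈⇒-≈0 c)))
        (≈-reflexive (trans (cong (λ z → (y - t) * z) (ℤₚ.*-zeroʳ (y - ω * t))) (ℤₚ.*-zeroʳ (y - t))))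
      root : δ³ y t ≡ 1ℤ × (y ≈ t ⊎ y ≈ ω * t ⊎ y ≈ ω * ω * t) → δ (y ^ 3) (t ^ 3) ≡ δ³ y t
      root (δ³≡1 , y≈) = trans (δ-≈ (-≈0⇒≈ (≈-trans (≈-sym (cube-factors y t)) (vanish y≈)))) (sym δ³≡1)
      no-root : δ³ y t ≡ 0ℤ × y ≉ t × y ≉ ω * t × y ≉ ω * ω * t → δ (y ^ 3) (t ^ 3) ≡ δ³ y t
      no-root (δ³≡0 , y≉t , y≉ωt , y≉ω²t) = trans (δ-≉ λ y³≈t³ →
        *≉0 (y≉t ∘ -≈0⇒≈) (*≉0 (y≉ωt ∘ -≈0⇒≈) (y≉ω²t ∘ -≈0⇒≈)) (≈-trans (cube-factors y t) (≈⇒-≈0 y³≈t³))) (sym δ³≡0)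

    ∑δ-cube : ∀ {t} → t ≉ 0ℤ → ∑ₚ (λ y → δ (y ^ 3) (t ^ 3)) ≡ + 3
    ∑δ-cube {t} t≉0 = begin
      ∑ₚ (λ y → δ (y ^ 3) (t ^ 3))      ≡⟨ ∑ₚ-cong (δ-cube t≉0) ⟩
      ∑ₚ (λ y → δ³ y t)                 ≡⟨ ∑ₚ-+ (λ y → δ y t) (λ y → δ y (ω * t) + δ y (ω * ω * t)) ⟩
      ∑ₚ (λ y → δ y t) + ∑ₚ (λ y → δ y (ω * t) + δ y (ω * ω * t))
        ≡⟨ cong₂ _+_ (∑ₚ-δ-count t) (trans (∑ₚ-+ (λ y → δ y (ω * t)) (λ y → δ y (ω * ω * t)))
             (cong₂ _+_ (∑ₚ-δ-count (ω * t)) (∑ₚ-δ-count (ω * ω * t)))) ⟩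
      + 3                               ∎
      where open ≡-Reasoning

    ∑δ-cube-0 : ∀ {d} → d ≈ 0ℤ → ∑ₚ (λ y → δ (y ^ 3) d) ≡ 1ℤ
    ∑δ-cube-0 d≈0 = trans (∑ₚ-cong {G = λ y → δ y 0ℤ} λ y → δ-⇔ (λ y³≈d → ^3≈0⇒≈0 (≈-trans y³≈d d≈0))
                                             (λ y≈0 → ≈-trans (≈0⇒^3≈0 y≈0) (≈-sym d≈0)))
                          (∑ₚ-δ-count 0ℤ)

    -- The number of solutions t of c t³ ≡ D. For c and D nonzero it is three times the indicator of
    -- the coset of c modulo cubes, obtained without a description of that coset.
    representations : ℤ → ℤ → ℤ
    representations c D = ∑ₚ (λ t → δ (c * t ^ 3) D)

    -- From one solution k all others arise by cube roots of unity, and nonzero cubes have q-th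
    -- power 1. The congruence `D ^ q ≈ c ^ q` is recorded in order to separate the cosets later.
    representations-≉0 : ∀ {c} → c ≉ 0ℤ → ∀ {D} → D ≉ 0ℤ →
                         representations c D ≡ 0ℤ ⊎ representations c D ≡ + 3 × D ^ q ≈ c ^ q
    representations-≉0 {c} c≉0 {D} D≉0 = split (ℕₚ.anyUpTo? (λ k → c * (+ k) ^ 3 ≈? D) p)
      where
      open ≈-Reasoning
      split : Dec (∃ λ k → k ℕ.< p × c * (+ k) ^ 3 ≈ D) → representations c D ≡ 0ℤ ⊎ representations c D ≡ + 3 × D ^ q ≈ c ^ q
      split (no none) = inj₁ (trans (∑-cong p λ {k} k<p → δ-≉ λ e → none (k , k<p , e)) (∑-zero p))
      split (yes (k , _ , ck³≈D)) = inj₂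
        ( trans (∑ₚ-cong {G = λ t → δ (t ^ 3) ((+ k) ^ 3)} λ t → δ-⇔ (λ ct³≈D → *-cancelˡ c≉0 (≈-trans ct³≈D (≈-sym ck³≈D)))
                                   (λ t³≈k³ → ≈-trans (*-congˡ c t³≈k³) ck³≈D))
                (∑δ-cube k≉0)
        , (begin
            D ^ q                    ≈⟨ ^-cong q ck³≈D ⟨
            (c * (+ k) ^ 3) ^ q      ≡⟨ ^-distrib-* c ((+ k) ^ 3) q ⟩
            c ^ q * ((+ k) ^ 3) ^ q  ≈⟨ *-congˡ (c ^ q) (^3^q k≉0) ⟩
            c ^ q * 1ℤ               ≡⟨ ℤₚ.*-identityʳ (c ^ q) ⟩
            c ^ q                    ∎)
        )
        where
        k≉0 : + k ≉ 0ℤ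
        k≉0 k≈0 = D≉0 (≈-trans (≈-sym ck³≈D) (≈-trans (*-congˡ c (≈0⇒^3≈0 k≈0)) (≈-reflexive (ℤₚ.*-zeroʳ c))))

    representations-0 : ∀ {c} → c ≉ 0ℤ → ∀ {D} → D ≈ 0ℤ → representations c D ≡ 1ℤ
    representations-0 {c} c≉0 {D} D≈0 = trans
      (∑ₚ-cong {G = λ t → δ (t ^ 3) 0ℤ} λ t → δ-⇔ (λ ct³≈D → *-cancelˡ c≉0 (≈-trans ct³≈D (≈-trans D≈0 (≈-reflexive (sym (ℤₚ.*-zeroʳ c))))))
                         (λ t³≈0 → ≈-trans (*-congˡ c t³≈0) (≈-trans (≈-reflexive (ℤₚ.*-zeroʳ c)) (≈-sym D≈0))))
      (∑δ-cube-0 ≈-refl)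

    ∑representations : ∀ c {F} → Periodic F → ∑ₚ (λ D → representations c D * F D) ≡ ∑ₚ (λ t → F (c * t ^ 3))
    ∑representations c {F} F-periodic = begin
      ∑ₚ (λ D → representations c D * F D)
        ≡⟨ ∑ₚ-cong (λ D → ∑ₚ-*ʳ (F D) (λ t → δ (c * t ^ 3) D)) ⟨
      ∑ₚ (λ D → ∑ₚ (λ t → δ (c * t ^ 3) D * F D))
        ≡⟨ ∑ₚ-comm (λ D t → δ (c * t ^ 3) D * F D) ⟩
      ∑ₚ (λ t → ∑ₚ (λ D → δ (c * t ^ 3) D * F D))
        ≡⟨ ∑ₚ-cong (λ t → trans (∑ₚ-cong λ D → cong (_* F D) (δ-sym (c * t ^ 3) D)) (∑ₚ-δ (c * t ^ 3) F-periodic)) ⟩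
      ∑ₚ (λ t → F (c * t ^ 3)) ∎
      where open ≡-Reasoning

    classes : ℤ → ℤ
    classes D = representations 1ℤ D + (representations g D + representations (g * g) D)

    -- For D ≢ 0 a nonzero contribution fixes D^q as 1, ω or ω², and these differ, so at most one of
    -- the three occurs. At D ≡ 0 each contributes the single solution t ≡ 0.
    classes≤3 : ∀ D → classes D ≤ + 3
    classes≤3 D = split (D ≈? 0ℤ)
      where
      [g²]^q : (g * g) ^ q ≈ ω * ω
      [g²]^q = ≈-reflexive (^-distrib-* g g q)
      bound : ∀ {x y z} → x ≡ 0ℤ ⊎ x ≡ + 3 × D ^ q ≈ 1ℤ ^ q → y ≡ 0ℤ ⊎ y ≡ + 3 × D ^ q ≈ ω →
              z ≡ 0ℤ ⊎ z ≡ + 3 × D ^ q ≈ (g * g) ^ q → x + (y + z) ≤ + 3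
      bound (inj₁ refl) (inj₁ refl) (inj₁ refl)       = +≤+ z≤n
      bound (inj₂ (refl , _)) (inj₁ refl) (inj₁ refl) = ℤₚ.≤-refl
      bound (inj₁ refl) (inj₂ (refl , _)) (inj₁ refl) = ℤₚ.≤-refl
      bound (inj₁ refl) (inj₁ refl) (inj₂ (refl , _)) = ℤₚ.≤-refl
      bound (inj₂ (_ , a)) (inj₂ (_ , b)) _ = contradiction
        (≈-trans (≈-sym b) (≈-trans a (≈-reflexive (ℤₚ.^-zeroˡ q)))) ω≉1
      bound (inj₂ (_ , a)) (inj₁ _) (inj₂ (_ , c)) = contradiction
        (≈-trans (≈-sym [g²]^q) (≈-trans (≈-sym c) (≈-trans a (≈-reflexive (ℤₚ.^-zeroˡ q))))) ω²≉1
      bound (inj₁ _) (inj₂ (_ , b)) (inj₂ (_ , c)) = contradiction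
        (≈-trans (≈-sym [g²]^q) (≈-trans (≈-sym c) b)) ω²≉ω
      split : Dec (D ≈ 0ℤ) → classes D ≤ + 3
      split (yes D≈0) = ℤₚ.≤-reflexive (cong₂ _+_ (representations-0 1≉0 D≈0)
                      (cong₂ _+_ (representations-0 g≉0 D≈0) (representations-0 (*≉0 g≉0 g≉0) D≈0)))
      split (no D≉0)  = bound (representations-≉0 1≉0 D≉0) (representations-≉0 g≉0 D≉0) (representations-≉0 (*≉0 g≉0 g≉0) D≉0)

    ∑classes : ∀ {F} → Periodic F → ∑ₚ (λ D → classes D * F D) ≡
               ∑ₚ (λ t → F (1ℤ * t ^ 3)) + (∑ₚ (λ t → F (g * t ^ 3)) + ∑ₚ (λ t → F (g * g * t ^ 3)))
    ∑classes {F} F-periodic = begin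
      ∑ₚ (λ D → classes D * F D)
        ≡⟨ ∑ₚ-cong (λ D → eq (representations 1ℤ D) (representations g D) (representations (g * g) D) (F D)) ⟩
      ∑ₚ (λ D → representations 1ℤ D * F D + (representations g D * F D + representations (g * g) D * F D))
        ≡⟨ trans (∑ₚ-+ (λ D → representations 1ℤ D * F D) (λ D → representations g D * F D + representations (g * g) D * F D))
             (cong (λ z → ∑ₚ (λ D → representations 1ℤ D * F D) + z) (∑ₚ-+ (λ D → representations g D * F D) (λ D → representations (g * g) D * F D))) ⟩
      ∑ₚ (λ D → representations 1ℤ D * F D) + (∑ₚ (λ D → representations g D * F D) + ∑ₚ (λ D → representations (g * g) D * F D))
        ≡⟨ cong₂ _+_ (∑representations 1ℤ F-periodic) (cong₂ _+_ (∑representations g F-periodic) (∑representations (g * g) F-periodic)) ⟩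
      ∑ₚ (λ t → F (1ℤ * t ^ 3)) + (∑ₚ (λ t → F (g * t ^ 3)) + ∑ₚ (λ t → F (g * g * t ^ 3))) ∎
      where
      open ≡-Reasoning
      eq : ∀ a b c x → (a + (b + c)) * x ≡ a * x + (b * x + c * x)
      eq = solve-∀

    -- Each D ≠ 0 lies in at most one of the three cosets of the cubes; since the total count is 3p, in exactly one.
    classes≡3 : ∀ {k} → k ℕ.< p → classes (+ k) ≡ + 3
    classes≡3 = ∑-tight p {λ k → classes (+ k)} (λ k → classes≤3 (+ k)) (begin
      ∑ₚ classes
        ≡⟨ ∑ₚ-cong (λ D → ℤₚ.*-identityʳ (classes D)) ⟨
      ∑ₚ (λ D → classes D * 1ℤ)
        ≡⟨ ∑classes {λ _ → 1ℤ} (λ _ → refl) ⟩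
      ∑ₚ (λ _ → 1ℤ) + (∑ₚ (λ _ → 1ℤ) + ∑ₚ (λ _ → 1ℤ))
        ≡⟨ cong (λ s → s + (s + s)) (∑ₚ-const 1ℤ) ⟩
      + p * 1ℤ + (+ p * 1ℤ + + p * 1ℤ)
        ≡⟨ eq (+ p) ⟩
      + p * + 3 ∎)
      where
      open ≡-Reasoning
      eq : ∀ p → p * 1ℤ + (p * 1ℤ + p * 1ℤ) ≡ p * + 3
      eq = solve-∀

    -- Each coset has (p - 1)/3 elements, and t ↦ c t³ for t ≢ 0 runs through the coset of c three
    -- times; the factor 3 on the left avoids the division.
    ∑-by-classes : ∀ {F} → Periodic F → (∀ {a} → a ≈ 0ℤ → F a ≡ 0ℤ) → (∀ c {t} → t ≉ 0ℤ → F (c * t ^ 3) ≡ F c) →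
                   + 3 * ∑ₚ F ≡ + N * (F 1ℤ + (F g + F (g * g)))
    ∑-by-classes {F} F-periodic F-0 F-invariant = begin
      + 3 * ∑ₚ F
        ≡⟨ ∑ₚ-*ˡ (+ 3) F ⟨
      ∑ₚ (λ D → + 3 * F D)
        ≡⟨ ∑-cong p (λ {k} k<p → cong (_* F (+ k)) (classes≡3 k<p)) ⟨
      ∑ₚ (λ D → classes D * F D)
        ≡⟨ ∑classes F-periodic ⟩
      ∑ₚ (λ t → F (1ℤ * t ^ 3)) + (∑ₚ (λ t → F (g * t ^ 3)) + ∑ₚ (λ t → F (g * g * t ^ 3)))
        ≡⟨ cong₂ _+_ (coset 1ℤ) (cong₂ _+_ (coset g) (coset (g * g))) ⟩
      + N * F 1ℤ + (+ N * F g + + N * F (g * g))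
        ≡⟨ eq₃ (+ N) (F 1ℤ) (F g) (F (g * g)) ⟩
      + N * (F 1ℤ + (F g + F (g * g))) ∎
      where
      open ≡-Reasoning
      eq₁ : ∀ x → x ≡ x + - x * 0ℤ
      eq₁ = solve-∀
      eq₂ : ∀ n x → (1ℤ + n) * x + - x * 1ℤ ≡ n * x
      eq₂ = solve-∀
      eq₃ : ∀ n x y z → n * x + (n * y + n * z) ≡ n * (x + (y + z))
      eq₃ = solve-∀
      pointwise : ∀ c t → F (c * t ^ 3) ≡ F c + - F c * δ t 0ℤ
      pointwise c t with t ≈? 0ℤ
      ... | no  t≉0 = trans (F-invariant c t≉0) (trans (eq₁ (F c)) (cong (λ d → F c + - F c * d) (sym (δ-≉ t≉0))))
      ... | yes t≈0 = trans (F-0 (≈-trans (*-congˡ c (≈0⇒^3≈0 t≈0)) (≈-reflexive (ℤₚ.*-zeroʳ c))))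
                            (trans (sym (ℤₚ.+-inverseʳ (F c)))
                                   (cong (λ z → F c + z) (trans (sym (ℤₚ.*-identityʳ (- F c))) (cong (λ d → - F c * d) (sym (δ-≈ t≈0))))))
      coset : ∀ c → ∑ₚ (λ t → F (c * t ^ 3)) ≡ + N * F c
      coset c = begin
        ∑ₚ (λ t → F (c * t ^ 3))                      ≡⟨ ∑ₚ-cong (pointwise c) ⟩
        ∑ₚ (λ t → F c + - F c * δ t 0ℤ)               ≡⟨ ∑ₚ-+ (λ _ → F c) (λ t → - F c * δ t 0ℤ) ⟩
        ∑ₚ (λ _ → F c) + ∑ₚ (λ t → - F c * δ t 0ℤ)
          ≡⟨ cong₂ _+_ (∑ₚ-const (F c)) (trans (∑ₚ-*ˡ (- F c) (λ t → δ t 0ℤ)) (cong (λ z → - F c * z) (∑ₚ-δ-count 0ℤ))) ⟩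
        + p * F c + - F c * 1ℤ                        ≡⟨ eq₂ (+ N) (F c) ⟩
        + N * F c                                     ∎

  -- The character sums of x³ + D

  module CubicCharacterSums (N : ℕ) (p-prime : Prime (suc N)) (m : ℕ) (N≡6m : N ≡ 6 ℕ.* m) where
    open Residues N p-prime
    open ResidueSums N p-prime
    open CubicClasses N p-prime m N≡6m

    h : ℕ
    h = 3 ℕ.* m

    h+h≡N : h ℕ.+ h ≡ N
    h+h≡N = trans (eq m) (sym N≡6m)
      where
      eq : ∀ m → 3 ℕ.* m ℕ.+ 3 ℕ.* m ≡ 6 ℕ.* m
      eq = ℕ-solver.solve-∀

    open QuadraticCharacter N p-prime h h+h≡N

    opaque
      -- The curve y² = x³ + D has p + ψ(D) affine points modulo p; for D ≢ 0, -ψ(D) is its trace of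
      -- Frobenius.
      ψ : ℤ → ℤ
      ψ D = ∑ₚ (λ x → χ (x ^ 3 + D))

      ψ-def : ∀ D → ψ D ≡ ∑ₚ (λ x → χ (x ^ 3 + D))
      ψ-def D = refl

    ψ-periodic : Periodic ψ
    ψ-periodic {a} {b} a≈b = trans (ψ-def a) (trans (∑ₚ-cong λ x → χ-periodic (+-congˡ (x ^ 3) a≈b)) (sym (ψ-def b)))

    χ-^3 : ∀ x → χ (x ^ 3) ≡ χ x
    χ-^3 x = trans (χ-* x (x ^ 2)) (trans (cong (λ z → χ x * z) (trans (χ-* x (x * 1ℤ)) (cong (λ z → χ x * χ z) (ℤₚ.*-identityʳ x)))) (cube (x ≈? 0ℤ)))
      where
      cube : Dec (x ≈ 0ℤ) → χ x * (χ x * χ x) ≡ χ x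
      cube (yes x≈0) = trans (cong (λ z → z * (χ x * χ x)) (χ-≈0 x≈0)) (trans (ℤₚ.*-zeroˡ (χ x * χ x)) (sym (χ-≈0 x≈0)))
      cube (no  x≉0) = trans (cong (λ z → χ x * z) (χ² x≉0)) (ℤₚ.*-identityʳ (χ x))

    ψ-≈0 : ∀ {D} → D ≈ 0ℤ → ψ D ≡ 0ℤ
    ψ-≈0 {D} D≈0 = trans (ψ-def D) (trans (∑ₚ-cong {G = χ} λ x →
      trans (χ-periodic (≈-trans (+-congˡ (x ^ 3) D≈0) (≈-reflexive (ℤₚ.+-identityʳ (x ^ 3))))) (χ-^3 x)) ∑χ≡0)

    ψ-scale : ∀ c {t} → t ≉ 0ℤ → ψ (c * t ^ 3) ≡ χ (t ^ 3) * ψ c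
    ψ-scale c {t} t≉0 = begin
      ψ (c * t ^ 3)                                ≡⟨ ψ-def (c * t ^ 3) ⟩
      ∑ₚ (λ x → χ (x ^ 3 + c * t ^ 3))
        ≡⟨ scale {λ x → χ (x ^ 3 + c * t ^ 3)} (λ x≈y → χ-periodic (+-congʳ (c * t ^ 3) (^-cong 3 x≈y))) t≉0 ⟨
      ∑ₚ (λ x → χ ((t * x) ^ 3 + c * t ^ 3))       ≡⟨ ∑ₚ-cong (λ x → trans (cong χ (eq c t x)) (χ-* (t ^ 3) (x ^ 3 + c))) ⟩
      ∑ₚ (λ x → χ (t ^ 3) * χ (x ^ 3 + c))         ≡⟨ ∑ₚ-*ˡ (χ (t ^ 3)) (λ x → χ (x ^ 3 + c)) ⟩
      χ (t ^ 3) * ∑ₚ (λ x → χ (x ^ 3 + c))         ≡⟨ cong (λ z → χ (t ^ 3) * z) (ψ-def c) ⟨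
      χ (t ^ 3) * ψ c                              ∎
      where
      open ≡-Reasoning
      eq : ∀ c t x → t * x * (t * x * (t * x * 1ℤ)) + c * (t * (t * (t * 1ℤ))) ≡ t * (t * (t * 1ℤ)) * (x * (x * (x * 1ℤ)) + c)
      eq = solve-∀

    -- Replacing D by D t³ multiplies ψ by the sign χ(t³), as the substitution x ↦ t x shows. The
    -- factor χ(D) changes by the same sign and cancels it.
    f : ℤ → ℤ
    f D = χ D * ψ D

    f-periodic : Periodic f
    f-periodic a≈b = cong₂ _*_ (χ-periodic a≈b) (ψ-periodic a≈b)

    f-≈0 : ∀ {a} → a ≈ 0ℤ → f a ≡ 0ℤ
    f-≈0 {a} a≈0 = trans (cong (_* ψ a) (χ-≈0 a≈0)) (ℤₚ.*-zeroˡ (ψ a))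

    f-invariant : ∀ c {t} → t ≉ 0ℤ → f (c * t ^ 3) ≡ f c
    f-invariant c {t} t≉0 = begin
      χ (c * t ^ 3) * ψ (c * t ^ 3)            ≡⟨ cong₂ _*_ (χ-* c (t ^ 3)) (ψ-scale c t≉0) ⟩
      χ c * χ (t ^ 3) * (χ (t ^ 3) * ψ c)      ≡⟨ eq (χ c) (χ (t ^ 3)) (ψ c) ⟩
      χ (t ^ 3) * χ (t ^ 3) * (χ c * ψ c)      ≡⟨ cong (_* (χ c * ψ c)) (χ² (^≉0 3 t≉0)) ⟩
      1ℤ * (χ c * ψ c)                         ≡⟨ ℤₚ.*-identityˡ (χ c * ψ c) ⟩
      χ c * ψ c                                ∎
      where
      open ≡-Reasoning
      eq : ∀ c s w → c * s * (s * w) ≡ s * s * (c * w)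
      eq = solve-∀

    -- For fixed x the sum over D is p - 1 if x³ ≡ 0 and -1 otherwise. Only x ≡ 0 has cube 0, so the
    -- total is p - p.
    ∑f≡0 : ∑ₚ f ≡ 0ℤ
    ∑f≡0 = begin
      ∑ₚ f
        ≡⟨ ∑ₚ-cong {G = λ D → ∑ₚ (λ x → χ D * χ (x ^ 3 + D))} (λ D → trans (cong (λ z → χ D * z) (ψ-def D)) (sym (∑ₚ-*ˡ (χ D) (λ x → χ (x ^ 3 + D))))) ⟩
      ∑ₚ (λ D → ∑ₚ (λ x → χ D * χ (x ^ 3 + D)))
        ≡⟨ ∑ₚ-comm (λ D x → χ D * χ (x ^ 3 + D)) ⟩
      ∑ₚ (λ x → ∑ₚ (λ D → χ D * χ (x ^ 3 + D)))
        ≡⟨ ∑ₚ-cong {G = λ x → + p * δ (x ^ 3) 0ℤ + -1ℤ} (λ x → trans (∑ₚ-cong λ D → cong (λ z → χ z * χ (x ^ 3 + D)) (sym (ℤₚ.+-identityˡ D))) (∑χ[+a]χ[+b] 0ℤ (x ^ 3))) ⟩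
      ∑ₚ (λ x → + p * δ (x ^ 3) 0ℤ + -1ℤ)
        ≡⟨ ∑ₚ-+ (λ x → + p * δ (x ^ 3) 0ℤ) (λ _ → -1ℤ) ⟩
      ∑ₚ (λ x → + p * δ (x ^ 3) 0ℤ) + ∑ₚ (λ _ → -1ℤ)
        ≡⟨ cong₂ _+_ (trans (∑ₚ-*ˡ (+ p) (λ x → δ (x ^ 3) 0ℤ)) (cong (λ z → + p * z) (∑δ-cube-0 ≈-refl))) (∑ₚ-const -1ℤ) ⟩
      + p * 1ℤ + + p * -1ℤ
        ≡⟨ eq (+ p) ⟩
      0ℤ ∎
      where
      open ≡-Reasoning
      eq : ∀ p → p * 1ℤ + p * -1ℤ ≡ 0ℤ
      eq = solve-∀

    ∑δ-cubes : ∀ x → ∑ₚ (λ y → δ (y ^ 3) (x ^ 3)) ≡ + 3 + - + 2 * δ x 0ℤ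
    ∑δ-cubes x = split (x ≈? 0ℤ)
      where
      split : Dec (x ≈ 0ℤ) → ∑ₚ (λ y → δ (y ^ 3) (x ^ 3)) ≡ + 3 + - + 2 * δ x 0ℤ
      split (yes x≈0) = trans (∑δ-cube-0 (≈0⇒^3≈0 x≈0)) (cong (λ d → + 3 + - + 2 * d) (sym (δ-≈ x≈0)))
      split (no  x≉0) = trans (∑δ-cube x≉0) (cong (λ d → + 3 + - + 2 * d) (sym (δ-≉ x≉0)))

    -- Orthogonality in D leaves p times the number of pairs with x³ ≡ y³, minus p². There are 3(p -
    -- 1) + 1 such pairs.
    ∑ψ² : ∑ₚ (λ D → ψ D * ψ D) ≡ + 2 * (+ p * + N)
    ∑ψ² = begin
      ∑ₚ (λ D → ψ D * ψ D)
        ≡⟨ ∑ₚ-cong square ⟩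
      ∑ₚ (λ D → ∑ₚ (λ x → ∑ₚ (λ y → χ (x ^ 3 + D) * χ (y ^ 3 + D))))
        ≡⟨ ∑ₚ-comm (λ D x → ∑ₚ (λ y → χ (x ^ 3 + D) * χ (y ^ 3 + D))) ⟩
      ∑ₚ (λ x → ∑ₚ (λ D → ∑ₚ (λ y → χ (x ^ 3 + D) * χ (y ^ 3 + D))))
        ≡⟨ ∑ₚ-cong inner ⟩
      ∑ₚ (λ x → (+ p * + 2) + (- (+ p * + 2)) * δ x 0ℤ)
        ≡⟨ ∑ₚ-+ (λ _ → + p * + 2) (λ x → (- (+ p * + 2)) * δ x 0ℤ) ⟩
      ∑ₚ (λ _ → + p * + 2) + ∑ₚ (λ x → (- (+ p * + 2)) * δ x 0ℤ)
        ≡⟨ cong₂ _+_ (∑ₚ-const (+ p * + 2)) (trans (∑ₚ-*ˡ (- (+ p * + 2)) (λ x → δ x 0ℤ)) (cong (λ z → - (+ p * + 2) * z) (∑ₚ-δ-count 0ℤ))) ⟩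
      + p * (+ p * + 2) + - (+ p * + 2) * 1ℤ
        ≡⟨ eq (+ N) ⟩
      + 2 * (+ p * + N) ∎
      where
      open ≡-Reasoning
      eq : ∀ n → (1ℤ + n) * ((1ℤ + n) * + 2) + - ((1ℤ + n) * + 2) * 1ℤ ≡ + 2 * ((1ℤ + n) * n)
      eq = solve-∀
      square : ∀ D → ψ D * ψ D ≡ ∑ₚ (λ x → ∑ₚ (λ y → χ (x ^ 3 + D) * χ (y ^ 3 + D)))
      square D = begin
        ψ D * ψ D
          ≡⟨ cong (_* ψ D) (ψ-def D) ⟩
        ∑ₚ (λ x → χ (x ^ 3 + D)) * ψ D
          ≡⟨ ∑ₚ-*ʳ (ψ D) (λ x → χ (x ^ 3 + D)) ⟨
        ∑ₚ (λ x → χ (x ^ 3 + D) * ψ D)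
          ≡⟨ ∑ₚ-cong (λ x → trans (cong (λ z → χ (x ^ 3 + D) * z) (ψ-def D)) (sym (∑ₚ-*ˡ (χ (x ^ 3 + D)) (λ y → χ (y ^ 3 + D))))) ⟩
        ∑ₚ (λ x → ∑ₚ (λ y → χ (x ^ 3 + D) * χ (y ^ 3 + D))) ∎
      eq₂ : ∀ p d → p * (+ 3 + - + 2 * d) + p * -1ℤ ≡ p * + 2 + - (p * + 2) * d
      eq₂ = solve-∀
      inner : ∀ x → ∑ₚ (λ D → ∑ₚ (λ y → χ (x ^ 3 + D) * χ (y ^ 3 + D))) ≡ (+ p * + 2) + (- (+ p * + 2)) * δ x 0ℤ
      inner x = begin
        ∑ₚ (λ D → ∑ₚ (λ y → χ (x ^ 3 + D) * χ (y ^ 3 + D)))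
          ≡⟨ ∑ₚ-comm (λ D y → χ (x ^ 3 + D) * χ (y ^ 3 + D)) ⟩
        ∑ₚ (λ y → ∑ₚ (λ D → χ (x ^ 3 + D) * χ (y ^ 3 + D)))
          ≡⟨ ∑ₚ-cong (λ y → ∑χ[+a]χ[+b] (x ^ 3) (y ^ 3)) ⟩
        ∑ₚ (λ y → + p * δ (y ^ 3) (x ^ 3) + -1ℤ)
          ≡⟨ ∑ₚ-+ (λ y → + p * δ (y ^ 3) (x ^ 3)) (λ _ → -1ℤ) ⟩
        ∑ₚ (λ y → + p * δ (y ^ 3) (x ^ 3)) + ∑ₚ (λ _ → -1ℤ)
          ≡⟨ cong₂ _+_ (trans (∑ₚ-*ˡ (+ p) (λ y → δ (y ^ 3) (x ^ 3))) (cong (λ z → + p * z) (∑δ-cubes x))) (∑ₚ-const -1ℤ) ⟩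
        + p * (+ 3 + - + 2 * δ x 0ℤ) + + p * -1ℤ
          ≡⟨ eq₂ (+ p) (δ x 0ℤ) ⟩
        (+ p * + 2) + (- (+ p * + 2)) * δ x 0ℤ ∎

    -- The two squares agree everywhere: χ is ±1 away from 0, and at 0 both ψ and χ vanish.
    ∑f² : ∑ₚ (λ D → f D * f D) ≡ + 2 * (+ p * + N)
    ∑f² = trans (∑ₚ-cong λ D → f²≡ψ² D (D ≈? 0ℤ)) ∑ψ²
      where
      eq : ∀ c s → c * s * (c * s) ≡ c * c * (s * s)
      eq = solve-∀
      f²≡ψ² : ∀ D → Dec (D ≈ 0ℤ) → f D * f D ≡ ψ D * ψ D
      f²≡ψ² D (yes D≈0) = trans (cong₂ _*_ (f-≈0 D≈0) (f-≈0 D≈0)) (sym (cong₂ _*_ (ψ-≈0 D≈0) (ψ-≈0 D≈0)))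
      f²≡ψ² D (no  D≉0) = trans (eq (χ D) (ψ D)) (trans (cong (_* (ψ D * ψ D)) (χ² D≉0)) (ℤₚ.*-identityˡ (ψ D * ψ D)))

    private
      instance
        +N≢0 : ℤ.NonZero (+ N)
        +N≢0 = ℕ.>-nonZero 0<N

    opaque
      -- The orthogonality relations ∑f = 0 and ∑f² = 2p(p−1), read on the three classes of cubes.
      ψ1-norm : ∃ λ b → ψ 1ℤ * ψ 1ℤ + ψ 1ℤ * b + b * b ≡ + 3 * + p
      ψ1-norm = f g , trans (cong (λ z → z * z + z * f g + f g * f g) (sym f1≡ψ1))
        -- The third value is minus the sum of the other two, so the three squares add up to twice
        -- the norm form; 6p thus becomes 3p.
        (ℤₚ.*-cancelˡ-≡ (+ 2) _ _ (trans (eq₁ (f 1ℤ) (f g)) (trans (cong (λ u → f 1ℤ * f 1ℤ + (f g * f g + u * u)) (sym third)) (trans squares (eq₃ (+ p))))))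
        where
        f1≡ψ1 : f 1ℤ ≡ ψ 1ℤ
        f1≡ψ1 = trans (cong (_* ψ 1ℤ) χ1≡1) (ℤₚ.*-identityˡ (ψ 1ℤ))
        eq₁ : ∀ a b → + 2 * (a * a + a * b + b * b) ≡ a * a + (b * b + - (a + b) * - (a + b))
        eq₁ = solve-∀
        eq₂ : ∀ a b c → c ≡ a + (b + c) + - (a + b)
        eq₂ = solve-∀
        eq₃ : ∀ p → + 6 * p ≡ + 2 * (+ 3 * p)
        eq₃ = solve-∀
        eq₄ : ∀ p n → + 3 * (+ 2 * (p * n)) ≡ n * (+ 6 * p)
        eq₄ = solve-∀
        sum : f 1ℤ + (f g + f (g * g)) ≡ 0ℤ
        sum = ℤₚ.*-cancelˡ-≡ (+ N) _ _ (trans (sym (∑-by-classes f-periodic f-≈0 f-invariant))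
                (trans (cong (λ z → + 3 * z) ∑f≡0) (sym (ℤₚ.*-zeroʳ (+ N)))))
        third : f (g * g) ≡ - (f 1ℤ + f g)
        third = trans (eq₂ (f 1ℤ) (f g) (f (g * g))) (trans (cong (_+ - (f 1ℤ + f g)) sum) (ℤₚ.+-identityˡ (- (f 1ℤ + f g))))
        squares : f 1ℤ * f 1ℤ + (f g * f g + f (g * g) * f (g * g)) ≡ + 6 * + p
        squares = ℤₚ.*-cancelˡ-≡ (+ N) _ _ (trans
          (sym (∑-by-classes {λ D → f D * f D} (λ a≈b → cong₂ _*_ (f-periodic a≈b) (f-periodic a≈b))
            (λ a≈0 → cong₂ _*_ (f-≈0 a≈0) (f-≈0 a≈0)) (λ c t≉0 → cong₂ _*_ (f-invariant c t≉0) (f-invariant c t≉0))))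
          (trans (cong (λ z → + 3 * z) ∑f²) (eq₄ (+ p) (+ N))))

      -- Every value of χ is odd except at 0, and x³ ≡ -1 has exactly three solutions. So ψ(1) has
      -- the parity of p - 3.
      ψ1-even : ∃ λ k → ψ 1ℤ ≡ + 2 * k
      ψ1-even = - 1ℤ + + h + ∑ₚ (λ x → proj₁ (χ-parity (x ^ 3 + 1ℤ))) , (begin
        ψ 1ℤ                                                          ≡⟨ ψ-def 1ℤ ⟩
        ∑ₚ (λ x → χ (x ^ 3 + 1ℤ))                                     ≡⟨ ∑ₚ-cong (λ x → proj₂ (χ-parity (x ^ 3 + 1ℤ))) ⟩
        ∑ₚ (λ x → (1ℤ + -1ℤ * δ (x ^ 3 + 1ℤ) 0ℤ) + + 2 * e x)          ≡⟨ ∑ₚ-+ (λ x → 1ℤ + -1ℤ * δ (x ^ 3 + 1ℤ) 0ℤ) (λ x → + 2 * e x) ⟩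
        ∑ₚ (λ x → 1ℤ + -1ℤ * δ (x ^ 3 + 1ℤ) 0ℤ) + ∑ₚ (λ x → + 2 * e x)
          ≡⟨ cong₂ _+_ (∑ₚ-+ (λ _ → 1ℤ) (λ x → -1ℤ * δ (x ^ 3 + 1ℤ) 0ℤ)) (∑ₚ-*ˡ (+ 2) e) ⟩
        ∑ₚ (λ _ → 1ℤ) + ∑ₚ (λ x → -1ℤ * δ (x ^ 3 + 1ℤ) 0ℤ) + + 2 * ∑ₚ e
          ≡⟨ cong (_+ + 2 * ∑ₚ e) (cong₂ _+_ (∑ₚ-const 1ℤ) (trans (∑ₚ-*ˡ -1ℤ (λ x → δ (x ^ 3 + 1ℤ) 0ℤ)) (cong (λ z → -1ℤ * z) roots))) ⟩
        + p * 1ℤ + -1ℤ * + 3 + + 2 * ∑ₚ e                             ≡⟨ cong (λ n → (1ℤ + n) * 1ℤ + -1ℤ * + 3 + + 2 * ∑ₚ e) (cong +_ (sym h+h≡N)) ⟩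
        (1ℤ + (+ h + + h)) * 1ℤ + -1ℤ * + 3 + + 2 * ∑ₚ e              ≡⟨ eq (+ h) (∑ₚ e) ⟩
        + 2 * (- 1ℤ + + h + ∑ₚ e)                                     ∎)
        where
        open ≡-Reasoning
        eq : ∀ h s → (1ℤ + (h + h)) * 1ℤ + -1ℤ * + 3 + + 2 * s ≡ + 2 * (- 1ℤ + h + s)
        eq = solve-∀
        χ-parity : ∀ a → ∃ λ e → χ a ≡ (1ℤ + -1ℤ * δ a 0ℤ) + + 2 * e
        χ-parity a = parity (χ-value a)
          where
          parity : ∀ {v} → Value a v → ∃ λ e → v ≡ (1ℤ + -1ℤ * δ a 0ℤ) + + 2 * e
          parity (zero a≈0)         = 0ℤ  , cong (λ d → (1ℤ + -1ℤ * d) + + 2 * 0ℤ) (sym (δ-≈ a≈0))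
          parity (residue a≉0 _)    = 0ℤ  , cong (λ d → (1ℤ + -1ℤ * d) + + 2 * 0ℤ) (sym (δ-≉ a≉0))
          parity (nonresidue a≉0 _) = -1ℤ , cong (λ d → (1ℤ + -1ℤ * d) + + 2 * -1ℤ) (sym (δ-≉ a≉0))
        e : ℤ → ℤ
        e x = proj₁ (χ-parity (x ^ 3 + 1ℤ))
        roots : ∑ₚ (λ x → δ (x ^ 3 + 1ℤ) 0ℤ) ≡ + 3
        roots = trans (∑ₚ-cong {G = λ x → δ (x ^ 3) (-1ℤ ^ 3)} λ x → δ-⇔
          (λ e → -≈0⇒≈ e) (λ e → ≈⇒-≈0 e)) (∑δ-cube {t = -1ℤ} λ -1≈0 → 1≉0 (neg-cong -1≈0))

      -- The nonzero x fall into triples with the same cube, hence with equal summands; x = 0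
      -- contributes χ(1) = 1.
      ψ1-mod-3 : ∃ λ s → ψ 1ℤ ≡ 1ℤ + + 3 * s
      ψ1-mod-3 = ∑ₚ (λ D → proj₁ (count D) * χ (D + 1ℤ)) , (begin
        ψ 1ℤ
          ≡⟨ ψ-def 1ℤ ⟩
        ∑ₚ (λ x → χ (x ^ 3 + 1ℤ))
          ≡⟨ ∑ₚ-cong (λ x → cong (λ z → χ (z + 1ℤ)) (ℤₚ.*-identityˡ (x ^ 3))) ⟨
        ∑ₚ (λ x → χ (1ℤ * x ^ 3 + 1ℤ))
          ≡⟨ ∑representations 1ℤ {λ D → χ (D + 1ℤ)} periodic ⟨
        ∑ₚ (λ D → representations 1ℤ D * χ (D + 1ℤ))
          ≡⟨ ∑ₚ-cong (λ D → trans (cong (_* χ (D + 1ℤ)) (proj₂ (count D))) (eq (δ D 0ℤ) (proj₁ (count D)) (χ (D + 1ℤ)))) ⟩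
        ∑ₚ (λ D → δ D 0ℤ * χ (D + 1ℤ) + + 3 * (proj₁ (count D) * χ (D + 1ℤ)))
          ≡⟨ ∑ₚ-+ (λ D → δ D 0ℤ * χ (D + 1ℤ)) (λ D → + 3 * (proj₁ (count D) * χ (D + 1ℤ))) ⟩
        ∑ₚ (λ D → δ D 0ℤ * χ (D + 1ℤ)) + ∑ₚ (λ D → + 3 * (proj₁ (count D) * χ (D + 1ℤ)))
          ≡⟨ cong₂ _+_ (trans (∑ₚ-δ 0ℤ {λ D → χ (D + 1ℤ)} periodic) χ1≡1) (∑ₚ-*ˡ (+ 3) (λ D → proj₁ (count D) * χ (D + 1ℤ))) ⟩
        1ℤ + + 3 * ∑ₚ (λ D → proj₁ (count D) * χ (D + 1ℤ)) ∎)
        where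
        open ≡-Reasoning
        eq : ∀ d s c → (d + + 3 * s) * c ≡ d * c + + 3 * (s * c)
        eq = solve-∀
        periodic : Periodic (λ D → χ (D + 1ℤ))
        periodic a≈b = χ-periodic (+-congʳ 1ℤ a≈b)
        count : ∀ D → ∃ λ s → representations 1ℤ D ≡ δ D 0ℤ + + 3 * s
        count D = split (D ≈? 0ℤ)
          where
          split : Dec (D ≈ 0ℤ) → ∃ λ s → representations 1ℤ D ≡ δ D 0ℤ + + 3 * s
          split (yes D≈0) = 0ℤ , trans (representations-0 1≉0 D≈0) (cong (_+ + 3 * 0ℤ) (sym (δ-≈ D≈0)))
          split (no  D≉0) = [ (λ e → 0ℤ , trans e (cong (_+ + 3 * 0ℤ) (sym (δ-≉ D≉0))))
                            , (λ (e , _) → 1ℤ , trans e (cong (_+ + 3 * 1ℤ) (sym (δ-≉ D≉0)))) ]′ (representations-≉0 1≉0 D≉0)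

    -- By Euler's criterion this is the sum of (x³ + 1)^(3m), of degree 9m < 2N. The exponent N = 6m
    -- is reached by the 2m-th power of x³.
    ψ1-residue : ψ 1ℤ ≈ - + ((3 ℕ.* m) C (2 ℕ.* m))
    ψ1-residue = begin
      ψ 1ℤ                                           ≡⟨ ψ-def 1ℤ ⟩
      ∑ₚ (λ x → χ (x ^ 3 + 1ℤ))                      ≈⟨ ∑-cong-≈ p (λ {k} _ → pointwise (+ k)) ⟩
      ∑ₚ (λ x → x ^ 0 * (1ℤ * x ^ 3 + 1ℤ) ^ h)       ≈⟨ extract-coefficient 0 3 1ℤ 1ℤ h small (ℕₚ.*-monoˡ-≤ m {2} {3} (s≤s (s≤s z≤n))) 3*2m≡N ⟩
      - (+ (h C q) * (1ℤ ^ q * 1ℤ ^ (h ℕ.∸ q)))      ≡⟨ cong -_ (trans (cong (λ z → + (h C q) * z) (cong₂ _*_ (ℤₚ.^-zeroˡ q) (ℤₚ.^-zeroˡ (h ℕ.∸ q)))) (ℤₚ.*-identityʳ (+ (h C q)))) ⟩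
      - + (h C q)                                    ∎
      where
      open ≈-Reasoning
      pointwise : ∀ x → χ (x ^ 3 + 1ℤ) ≈ x ^ 0 * (1ℤ * x ^ 3 + 1ℤ) ^ h
      pointwise x = ≈-trans (χ≈^h (x ^ 3 + 1ℤ)) (≈-reflexive (sym (trans (ℤₚ.*-identityˡ ((1ℤ * x ^ 3 + 1ℤ) ^ h))
        (cong (λ z → (z + 1ℤ) ^ h) (ℤₚ.*-identityˡ (x ^ 3))))))
      3*2m≡N : 3 ℕ.* (2 ℕ.* m) ≡ N
      3*2m≡N = trans (eq m) (sym N≡6m)
        where
        eq : ∀ m → 3 ℕ.* (2 ℕ.* m) ≡ 6 ℕ.* m
        eq = ℕ-solver.solve-∀
      3h≡N+h : 3 ℕ.* h ≡ N ℕ.+ h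
      3h≡N+h = trans (eq h) (cong (ℕ._+ h) h+h≡N)
        where
        eq : ∀ h → 3 ℕ.* h ≡ h ℕ.+ h ℕ.+ h
        eq = ℕ-solver.solve-∀
      small : 3 ℕ.* h ℕ.< N ℕ.+ N
      small = subst (ℕ._< N ℕ.+ N) (sym 3h≡N+h) (ℕₚ.+-monoʳ-< N (subst (h ℕ.<_) h+h≡N (ℕₚ.m<m+n h 0<h)))

  -- Central binomial coefficients, and the form x² + 3y²

  central-binomial-step : ∀ j → + suc j * + ((2 ℕ.* suc j) C suc j) ≡ + 2 * ((+ 2 * + j + 1ℤ) * + ((2 ℕ.* j) C j))
  -- The extra factor j + 1 allows absorption to be applied twice, once before and once after the
  -- reflection in row 2j + 1.
  central-binomial-step j = ℤₚ.*-cancelˡ-≡ (+ suc j) _ _ (begin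
    + suc j * (+ suc j * + ((2 ℕ.* suc j) C suc j))
      ≡⟨ cong (λ k → + suc j * (+ suc j * + (k C suc j))) (2*suc j) ⟩
    + suc j * (+ suc j * + (suc (suc (2 ℕ.* j)) C suc j))
      ≡⟨ cong (λ z → + suc j * z) (absorption (suc (2 ℕ.* j)) j) ⟩
    + suc j * (+ suc (suc (2 ℕ.* j)) * + (suc (2 ℕ.* j) C j))
      ≡⟨ cong (λ z → + suc j * (+ suc (suc (2 ℕ.* j)) * + z)) symmetric ⟩
    + suc j * (+ suc (suc (2 ℕ.* j)) * + (suc (2 ℕ.* j) C suc j))
      ≡⟨ eq₁ (+ suc j) (+ suc (suc (2 ℕ.* j))) (+ (suc (2 ℕ.* j) C suc j)) ⟩
    + suc (suc (2 ℕ.* j)) * (+ suc j * + (suc (2 ℕ.* j) C suc j))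
      ≡⟨ cong₂ _*_ (cong (λ z → + 2 + z) (ℤₚ.pos-* 2 j)) (trans (absorption (2 ℕ.* j) j) (cong (λ z → (1ℤ + z) * + ((2 ℕ.* j) C j)) (ℤₚ.pos-* 2 j))) ⟩
    (+ 2 + + 2 * + j) * ((1ℤ + + 2 * + j) * + ((2 ℕ.* j) C j))
      ≡⟨ eq₂ (+ j) (+ ((2 ℕ.* j) C j)) ⟩
    + suc j * (+ 2 * ((+ 2 * + j + 1ℤ) * + ((2 ℕ.* j) C j))) ∎)
    where
    open ≡-Reasoning
    2*suc : ∀ j → 2 ℕ.* suc j ≡ suc (suc (2 ℕ.* j))
    2*suc = ℕ-solver.solve-∀
    eq : ∀ j → suc (2 ℕ.* j) ≡ j ℕ.+ suc j
    eq = ℕ-solver.solve-∀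
    symmetric : suc (2 ℕ.* j) C j ≡ suc (2 ℕ.* j) C suc j
    symmetric = trans (nCk≡nC[n∸k] (ℕₚ.≤-trans (ℕₚ.m≤m+n j (suc j)) (ℕₚ.≤-reflexive (sym (eq j)))))
      (cong (suc (2 ℕ.* j) C_) (trans (cong (ℕ._∸ j) (eq j)) (ℕₚ.m+n∸m≡n j (suc j))))
    eq₁ : ∀ a b c → a * (b * c) ≡ b * (a * c)
    eq₁ = solve-∀
    eq₂ : ∀ j c → (+ 2 + + 2 * j) * ((1ℤ + + 2 * j) * c) ≡ (1ℤ + j) * (+ 2 * ((+ 2 * j + 1ℤ) * c))
    eq₂ = solve-∀

  i*i≡∣i∣*∣i∣ : ∀ i → i * i ≡ + (ℤ.∣ i ∣ ℕ.* ℤ.∣ i ∣)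
  i*i≡∣i∣*∣i∣ i = trans (square i) (sym (ℤₚ.pos-* ℤ.∣ i ∣ ℤ.∣ i ∣))
    where
    square : ∀ i → i * i ≡ + ℤ.∣ i ∣ * + ℤ.∣ i ∣
    square (+ n)    = refl
    square -[1+ n ] = refl

  square-injective : ∀ i j → i * i ≡ j * j → i ≡ j ⊎ i ≡ - j
  square-injective i j i²≡j² = ⊎.map (ℤₚ.i-j≡0⇒i≡j i j)
    (λ e → ℤₚ.i-j≡0⇒i≡j i (- j) (trans (cong (λ z → i + z) (ℤₚ.neg-involutive j)) e))
    (ℤₚ.i*j≡0⇒i≡0∨j≡0 (i - j) (trans (eq i j) (trans (cong (_- j * j) i²≡j²) (ℤₚ.+-inverseʳ (j * j)))))
    where
    eq : ∀ i j → (i - j) * (i + j) ≡ i * i - j * j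
    eq = solve-∀

  module QuadraticForm (N : ℕ) (p-prime : Prime (suc N)) where
    open Residues N p-prime
    open ResidueSums N p-prime

    private
      -- A nonzero multiple of p has absolute value at least p, and then 3y² alone would exceed p².
      determinant≡0 : ∀ {x y z} → + p * + p ≡ x * x + + 3 * (y * y) → y ≈ 0ℤ → z ≡ y → z ≡ 0ℤ
      determinant≡0 {x} {y} p²≡ y≈0 refl = ≈⇒≡ (subst (ℕ._< p) (cong ℤ.∣_∣ (sym (ℤₚ.+-identityʳ y))) (ℕₚ.≰⇒> p≰∣y∣)) y≈0
        where
        Y X : ℕ
        Y = ℤ.∣ y ∣
        X = ℤ.∣ x ∣
        p²≡ℕ : p ℕ.* p ≡ X ℕ.* X ℕ.+ 3 ℕ.* (Y ℕ.* Y)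
        p²≡ℕ = ℤₚ.+-injective (trans (ℤₚ.pos-* p p) (trans p²≡
          (cong₂ _+_ (i*i≡∣i∣*∣i∣ x) (trans (cong (λ z → + 3 * z) (i*i≡∣i∣*∣i∣ y)) (sym (ℤₚ.pos-* 3 (Y ℕ.* Y)))))))
        p≰∣y∣ : ¬ p ℕ.≤ Y
        p≰∣y∣ p≤Y = ℕₚ.<-irrefl refl (begin-strict
          p ℕ.* p                                     <⟨ ℕₚ.m<m+n (p ℕ.* p) (s≤s z≤n) ⟩
          p ℕ.* p ℕ.+ p ℕ.* p                         ≤⟨ ℕₚ.+-mono-≤ (ℕₚ.*-mono-≤ p≤Y p≤Y) (ℕₚ.*-mono-≤ p≤Y p≤Y) ⟩
          Y ℕ.* Y ℕ.+ Y ℕ.* Y                         ≤⟨ ℕₚ.m≤m+n (Y ℕ.* Y ℕ.+ Y ℕ.* Y) (Y ℕ.* Y ℕ.+ X ℕ.* X) ⟩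
          Y ℕ.* Y ℕ.+ Y ℕ.* Y ℕ.+ (Y ℕ.* Y ℕ.+ X ℕ.* X) ≡⟨ eq (X ℕ.* X) (Y ℕ.* Y) ⟩
          X ℕ.* X ℕ.+ 3 ℕ.* (Y ℕ.* Y)                 ≡⟨ p²≡ℕ ⟨
          p ℕ.* p                                     ∎)
          where
          open ℕₚ.≤-Reasoning
          eq : ∀ x y → y ℕ.+ y ℕ.+ (y ℕ.+ x) ≡ x ℕ.+ 3 ℕ.* y
          eq = ℕ-solver.solve-∀

      -- Proportional vectors of the same norm agree up to sign: expanding p a² by the second
      -- representation and p c² by the first gives the same number.
      parallel⇒≡ : ∀ a b c d → + p ≡ a * a + + 3 * (b * b) → + p ≡ c * c + + 3 * (d * d) → a * d ≡ c * b → a * a ≡ c * c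
      parallel⇒≡ a b c d p≡₁ p≡₂ ad≡cb = ℤₚ.*-cancelˡ-≡ (+ p) _ _ (begin
        + p * (a * a)                                            ≡⟨ cong (_* (a * a)) p≡₂ ⟩
        (c * c + + 3 * (d * d)) * (a * a)                        ≡⟨ eq₁ a c d ⟩
        c * c * (a * a) + + 3 * (a * d * (a * d))                ≡⟨ cong (λ z → c * c * (a * a) + + 3 * (z * z)) ad≡cb ⟩
        c * c * (a * a) + + 3 * (c * b * (c * b))                ≡⟨ eq₂ a b c ⟩
        (a * a + + 3 * (b * b)) * (c * c)                        ≡⟨ cong (_* (c * c)) p≡₁ ⟨
        + p * (c * c)                                            ∎)
        where
        open ≡-Reasoning
        eq₁ : ∀ a c d → (c * c + + 3 * (d * d)) * (a * a) ≡ c * c * (a * a) + + 3 * (a * d * (a * d))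
        eq₁ = solve-∀
        eq₂ : ∀ a b c → c * c * (a * a) + + 3 * (c * b * (c * b)) ≡ (a * a + + 3 * (b * b)) * (c * c)
        eq₂ = solve-∀

      -- The norm of ℤ[√-3] on the product of a + b√-3 with the conjugate of c + d√-3.
      brahmagupta : ∀ a b c d → + p ≡ a * a + + 3 * (b * b) → + p ≡ c * c + + 3 * (d * d) →
                    + p * + p ≡ (a * c + + 3 * (b * d)) * (a * c + + 3 * (b * d)) + + 3 * ((a * d - c * b) * (a * d - c * b))
      brahmagupta a b c d p≡₁ p≡₂ = trans (cong₂ _*_ p≡₁ p≡₂) (eq a b c d)
        where
        eq : ∀ a b c d → (a * a + + 3 * (b * b)) * (c * c + + 3 * (d * d)) ≡
             (a * c + + 3 * (b * d)) * (a * c + + 3 * (b * d)) + + 3 * ((a * d - c * b) * (a * d - c * b))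
        eq = solve-∀

    -- The product (ad - cb)(ad + cb) equals p(d² - b²), so p divides one of the factors; the sign
    -- of d may be changed to make it the first. By size that factor is then 0, and the two vectors
    -- are parallel.
    representation-unique : ∀ a b c d → + p ≡ a * a + + 3 * (b * b) → + p ≡ c * c + + 3 * (d * d) → a ≡ c ⊎ a ≡ - c
    representation-unique a b c d p≡₁ p≡₂ = square-injective a c ([ case d p≡₂ , case (- d) p≡₂′ ∘ ≈-trans (≈-reflexive (eq₂ a b c d)) ∘ neg-cong ]′
      (*≈0 (a * d - c * b) (a * d + c * b) (≈-trans (≈-reflexive factorisation) (≈-trans (*-congʳ (d * d - b * b) p≈0) (≈-reflexive (ℤₚ.*-zeroˡ (d * d - b * b)))))))
      where
      eq₁ : ∀ a b c d → (a * d - c * b) * (a * d + c * b) ≡ (a * a + + 3 * (b * b)) * (d * d) - (c * c + + 3 * (d * d)) * (b * b)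
      eq₁ = solve-∀
      eq₂ : ∀ a b c d → a * - d - c * b ≡ - (a * d + c * b)
      eq₂ = solve-∀
      eq₃ : ∀ p x y → p * x - p * y ≡ p * (x - y)
      eq₃ = solve-∀
      eq₄ : ∀ d → d * d ≡ - d * - d
      eq₄ = solve-∀
      factorisation : (a * d - c * b) * (a * d + c * b) ≡ + p * (d * d - b * b)
      factorisation = trans (eq₁ a b c d) (trans (sym (cong₂ (λ u v → u * (d * d) - v * (b * b)) p≡₁ p≡₂)) (eq₃ (+ p) (d * d) (b * b)))
      p≡₂′ : + p ≡ c * c + + 3 * (- d * - d)
      p≡₂′ = trans p≡₂ (cong (λ z → c * c + + 3 * z) (eq₄ d))
      case : ∀ d → + p ≡ c * c + + 3 * (d * d) → a * d - c * b ≈ 0ℤ → a * a ≡ c * c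
      case d p≡₂ small = parallel⇒≡ a b c d p≡₁ p≡₂ (ℤₚ.i-j≡0⇒i≡j (a * d) (c * b)
        (determinant≡0 {x = a * c + + 3 * (b * d)} (brahmagupta a b c d p≡₁ p≡₂) small refl))

    -- Since a is even, a² + ab + b² = 3p becomes (a/2 + b)² + 3(a/2)² = 3p, so 3 divides a/2 + b.
    half-trace : ∀ {a b k} → a * a + a * b + b * b ≡ + 3 * + p → a ≡ + 2 * k → ∃ λ d → + p ≡ k * k + + 3 * (d * d)
    half-trace {_} {b} {k} norm refl = d , ℤₚ.*-cancelˡ-≡ (+ 3) _ _ (trans (sym norm) (trans (eq₁ b k) (trans (cong (λ z → z * z + + 3 * (k * k)) k+b≡3d) (eq₂ k d))))
      where
      eq₁ : ∀ b k → + 2 * k * (+ 2 * k) + + 2 * k * b + b * b ≡ (k + b) * (k + b) + + 3 * (k * k)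
      eq₁ = solve-∀
      eq₂ : ∀ k d → d * + 3 * (d * + 3) + + 3 * (k * k) ≡ + 3 * (k * k + + 3 * (d * d))
      eq₂ = solve-∀
      eq₃ : ∀ x y → x ≡ x + + 3 * y - + 3 * y
      eq₃ = solve-∀
      eq₄ : ∀ p y → + 3 * p - + 3 * y ≡ (p - y) * + 3
      eq₄ = solve-∀
      3∣[k+b]² : + 3 Unsigned.∣ (k + b) * (k + b)
      3∣[k+b]² = Signed.∣⇒∣ᵤ (divides (+ p - k * k) (trans (eq₃ ((k + b) * (k + b)) (k * k))
        (trans (cong (_- + 3 * (k * k)) (trans (sym (eq₁ b k)) norm)) (eq₄ (+ p) (k * k)))))
      3∣k+b : + 3 Unsigned.∣ k + b
      3∣k+b = [ id , id ]′ (euclidsLemma ℤ.∣ k + b ∣ ℤ.∣ k + b ∣ (from-yes (prime? 3)) (subst (3 ℕ∣.∣_) (ℤₚ.abs-* (k + b) (k + b)) 3∣[k+b]²))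
      3∣ₛk+b : + 3 Signed.∣ k + b
      3∣ₛk+b = Signed.∣ᵤ⇒∣ 3∣k+b
      d : ℤ
      d = Signed._∣_.quotient 3∣ₛk+b
      k+b≡3d : k + b ≡ d * + 3
      k+b≡3d = Signed._∣_.equality 3∣ₛk+b

  -- 2A as a binomial coefficient modulo p

  module _ (N : ℕ) (p-prime : Prime (suc N)) (m : ℕ) (N≡6m : N ≡ 6 ℕ.* m) where
    open Residues N p-prime
    open QuadraticForm N p-prime
    open CubicCharacterSums N p-prime m N≡6m

    2A≈3mCm : ∀ A B → + p ≡ A * A + + 3 * (B * B) → + 3 Unsigned.∣ A - 1ℤ → + 2 * A ≈ + ((3 ℕ.* m) C m)
    2A≈3mCm A B p≡ 3∣A-1 = begin
      + 2 * A                          ≡⟨ ψ1≡-2A ⟨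
      - ψ 1ℤ                           ≈⟨ neg-cong ψ1-residue ⟩
      - - + ((3 ℕ.* m) C (2 ℕ.* m))    ≡⟨ ℤₚ.neg-involutive (+ ((3 ℕ.* m) C (2 ℕ.* m))) ⟩
      + ((3 ℕ.* m) C (2 ℕ.* m))        ≡⟨ cong +_ symmetric ⟩
      + ((3 ℕ.* m) C m)                ∎
      where
      open ≈-Reasoning
      3∣ₛA-1 : + 3 Signed.∣ A - 1ℤ
      3∣ₛA-1 = Signed.∣ᵤ⇒∣ 3∣A-1
      k s j : ℤ
      k = proj₁ ψ1-even
      s = proj₁ ψ1-mod-3
      j = Signed._∣_.quotient 3∣ₛA-1
      k²+3d² : ∃ λ d → + p ≡ k * k + + 3 * (d * d)
      k²+3d² = half-trace (proj₂ ψ1-norm) (proj₂ ψ1-even)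
      A-1≡3j : A - 1ℤ ≡ j * + 3
      A-1≡3j = Signed._∣_.equality 3∣ₛA-1
      2k≡1+3s : + 2 * k ≡ 1ℤ + + 3 * s
      2k≡1+3s = trans (sym (proj₂ ψ1-even)) (proj₂ ψ1-mod-3)
      eq₁ : ∀ A → 1ℤ ≡ + 2 * A - + 2 * (A - 1ℤ) - 1ℤ
      eq₁ = solve-∀
      eq₂ : ∀ s j → 1ℤ + + 3 * s - + 2 * (j * + 3) - 1ℤ ≡ (s - + 2 * j) * + 3
      eq₂ = solve-∀
      eq₃ : ∀ k → + 2 * - k ≡ - (+ 2 * k)
      eq₃ = solve-∀
      -- With k = ψ(1)/2 one has 2k ≡ 1 (mod 3), whereas A ≡ 1 gives 2A ≡ 2; equality would make 3
      -- divide 1.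
      A≢k : A ≢ k
      A≢k refl = contradiction
        (Signed.∣⇒∣ᵤ {+ 3} {1ℤ} (divides (s - + 2 * j) (trans (eq₁ k) (trans (cong₂ (λ u v → u - + 2 * v - 1ℤ) 2k≡1+3s A-1≡3j) (eq₂ s j)))))
        λ 3∣1 → contradiction (ℕ∣.∣1⇒≡1 3∣1) λ ()
      A≡-k : A ≡ - k
      A≡-k = [ (λ A≡k → contradiction A≡k A≢k) , id ]′
        (representation-unique A B k (proj₁ k²+3d²) p≡ (proj₂ k²+3d²))
      ψ1≡-2A : - ψ 1ℤ ≡ + 2 * A
      ψ1≡-2A = trans (cong -_ (proj₂ ψ1-even)) (trans (sym (eq₃ k)) (cong (λ z → + 2 * z) (sym A≡-k)))
      symmetric : (3 ℕ.* m) C (2 ℕ.* m) ≡ (3 ℕ.* m) C m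
      symmetric = trans (nCk≡nC[n∸k] (ℕₚ.m≤n+m (2 ℕ.* m) m)) (cong ((3 ℕ.* m) C_) (ℕₚ.m+n∸n≡m m (2 ℕ.* m)))

    -- Both sides represent C(−1/2, j) up to the factor 4ʲ, because 3m ≡ −1/2.
    4^j*3mCj : ∀ j → j ℕ.≤ m → (+ 4) ^ j * + ((3 ℕ.* m) C j) ≈ -1ℤ ^ j * + ((2 ℕ.* j) C j)
    4^j*3mCj zero    _     = ≈-refl
    4^j*3mCj (suc j) 1+j≤m = *-cancelˡ (0<k<p⇒k≉0 (s≤s z≤n) 1+j<p) (begin
      + suc j * (+ 4 * (+ 4) ^ j * + ((3 ℕ.* m) C suc j))
        ≡⟨ eq₁ (+ suc j) ((+ 4) ^ j) (+ ((3 ℕ.* m) C suc j)) ⟩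
      + 4 * (+ 4) ^ j * (+ suc j * + ((3 ℕ.* m) C suc j))
        ≡⟨ cong (λ z → + 4 * (+ 4) ^ j * z) (trans ([1+k]*nC[1+k]≡[n-k]*nCk (3 ℕ.* m) j) (cong (λ z → (z - + j) * + ((3 ℕ.* m) C j)) (ℤₚ.pos-* 3 m))) ⟩
      + 4 * (+ 4) ^ j * ((+ 3 * + m - + j) * + ((3 ℕ.* m) C j))
        ≡⟨ eq₂ (+ m) (+ j) ((+ 4) ^ j) (+ ((3 ℕ.* m) C j)) ⟩
      -- Here 4(3m - j) is written as 2(p - (2j + 1)), which isolates the multiple of p and leaves
      -- the factor of the central binomial recursion.
      + 2 * (+ 6 * + m + 1ℤ - (+ 2 * + j + 1ℤ)) * ((+ 4) ^ j * + ((3 ℕ.* m) C j))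
        ≈⟨ *-cong (*-congˡ (+ 2) (+-congʳ (- (+ 2 * + j + 1ℤ)) 6m+1≈0)) (4^j*3mCj j (ℕₚ.<⇒≤ 1+j≤m)) ⟩
      + 2 * (0ℤ - (+ 2 * + j + 1ℤ)) * (-1ℤ ^ j * + ((2 ℕ.* j) C j))
        ≡⟨ eq₃ (+ j) (-1ℤ ^ j) (+ ((2 ℕ.* j) C j)) ⟩
      -1ℤ * -1ℤ ^ j * (+ 2 * ((+ 2 * + j + 1ℤ) * + ((2 ℕ.* j) C j)))
        ≡⟨ cong (λ z → -1ℤ * -1ℤ ^ j * z) (central-binomial-step j) ⟨
      -1ℤ * -1ℤ ^ j * (+ suc j * + ((2 ℕ.* suc j) C suc j))
        ≡⟨ eq₄ (+ suc j) (-1ℤ * -1ℤ ^ j) (+ ((2 ℕ.* suc j) C suc j)) ⟩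
      + suc j * (-1ℤ * -1ℤ ^ j * + ((2 ℕ.* suc j) C suc j)) ∎)
      where
      open ≈-Reasoning
      1+j<p : suc j ℕ.< p
      1+j<p = s≤s (ℕₚ.≤-trans 1+j≤m (ℕₚ.≤-trans (ℕₚ.m≤m+n m (5 ℕ.* m)) (ℕₚ.≤-reflexive (sym N≡6m))))
      6m+1≈0 : + 6 * + m + 1ℤ ≈ 0ℤ
      6m+1≈0 = ≈-trans (≈-reflexive (trans (ℤₚ.+-comm (+ 6 * + m) 1ℤ) (cong (λ z → 1ℤ + z) (sym (trans (cong +_ N≡6m) (ℤₚ.pos-* 6 m)))))) p≈0
      eq₁ : ∀ a x c → a * (+ 4 * x * c) ≡ + 4 * x * (a * c)
      eq₁ = solve-∀
      eq₂ : ∀ m j x c → + 4 * x * ((+ 3 * m - j) * c) ≡ + 2 * (+ 6 * m + 1ℤ - (+ 2 * j + 1ℤ)) * (x * c)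
      eq₂ = solve-∀
      eq₃ : ∀ j x c → + 2 * (0ℤ - (+ 2 * j + 1ℤ)) * (x * c) ≡ -1ℤ * x * (+ 2 * ((+ 2 * j + 1ℤ) * c))
      eq₃ = solve-∀
      eq₄ : ∀ a x c → x * (a * c) ≡ a * (x * c)
      eq₄ = solve-∀

  -- From integer residues to the rational sums

  pos-^ : ∀ a k → + (a ℕ.^ k) ≡ (+ a) ^ k
  pos-^ a zero    = refl
  pos-^ a (suc k) = trans (ℤₚ.pos-* a (a ℕ.^ k)) (cong (λ z → + a * z) (pos-^ a k))

  [r+k*d]/d : ∀ r k d .{{_ : ℕ.NonZero d}} → r ℕ./ d ≡ 0 → (r ℕ.+ k ℕ.* d) ℕ./ d ≡ k
  [r+k*d]/d r k d r/d≡0 = trans (+-distrib-/-∣ʳ r (ℕ∣.divides k refl)) (cong₂ ℕ._+_ r/d≡0 (m*n/n≡m k d))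

  summand weighted-summand : ℕ → ℚ
  summand k = (+ ((3 ℕ.* k) !) ℚ./ (54 ℕ.^ k ℕ.* (k !) ℕ.^ 3)) {{54^k*k!³≢0 k}}
  weighted-summand k = (+ (k ℕ.* (3 ℕ.* k) !) ℚ./ (54 ℕ.^ k ℕ.* (k !) ℕ.^ 3)) {{54^k*k!³≢0 k}}

  module TruncatedSums (N : ℕ) (p-prime : Prime (suc N)) (3<p : 3 ℕ.< suc N)
    (half : ℤ) (2half≈1 : Residues._≈_ N p-prime (+ 2 * half) 1ℤ) (n e : ℕ) (e+n≡N : e ℕ.+ n ≡ N) (n<N : n ℕ.< N)
    (9n[n+1]≈-2 : Residues._≈_ N p-prime (+ 9 * (+ n * (+ n + 1ℤ))) (- + 2)) where
    open Residues N p-prime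
    open RationalResidues N p-prime
    open LegendreSums N p-prime half 2half≈1 n e e+n≡N n<N

    k!≉0 : ∀ k → k ℕ.< p → + (k !) ≉ 0ℤ
    k!≉0 zero    _     = 1≉0
    k!≉0 (suc k) 1+k<p = *≉0 (0<k<p⇒k≉0 (s≤s z≤n) 1+k<p) (k!≉0 k (ℕₚ.<-trans (ℕₚ.n<1+n k) 1+k<p)) ∘
      ≈-trans (≈-reflexive (sym (ℤₚ.pos-* (suc k) (k !))))

    3≉0 : + 3 ≉ 0ℤ
    3≉0 = 0<k<p⇒k≉0 (s≤s z≤n) 3<p

    2≉0 : + 2 ≉ 0ℤ
    2≉0 = 0<k<p⇒k≉0 (s≤s z≤n) (ℕₚ.<-trans (ℕₚ.n<1+n 2) 3<p)

    -- 54 = 2 · 3³ and k ≤ n < p, so every factor is a unit modulo p.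
    54^k*k!³≉0 : ∀ {k} → k ℕ.≤ n → + (54 ℕ.^ k ℕ.* (k !) ℕ.^ 3) ≉ 0ℤ
    54^k*k!³≉0 {k} k≤n = *≉0 (^≉0 k (*≉0 2≉0 (^≉0 3 3≉0))) (^≉0 3 (k!≉0 k (ℕₚ.≤-<-trans k≤n (ℕₚ.m<n⇒m<1+n n<N)))) ∘
      ≈-trans (≈-reflexive (sym (trans (ℤₚ.pos-* (54 ℕ.^ k) ((k !) ℕ.^ 3)) (cong₂ _*_ (pos-^ 54 k) (pos-^ (k !) 3)))))

    sum-residue : ∑≤ n summand ↦ ∑ (suc n) term
    sum-residue = ∑-residue n λ k k≤n → /-residue (+ ((3 ℕ.* k) !)) _ {{54^k*k!³≢0 k}} (54^k*k!³≉0 k≤n) (term-residue 9n[n+1]≈-2 k)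

    weighted-sum-residue : ∑≤ n weighted-summand ↦ ∑ (suc n) (λ k → + k * term k)
    weighted-sum-residue = ∑-residue n λ k k≤n → /-residue (+ (k ℕ.* (3 ℕ.* k) !)) _ {{54^k*k!³≢0 k}} (54^k*k!³≉0 k≤n) (begin
      + (k ℕ.* (3 ℕ.* k) !)                                ≡⟨ ℤₚ.pos-* k ((3 ℕ.* k) !) ⟩
      + k * + ((3 ℕ.* k) !)                                ≈⟨ *-congˡ (+ k) (term-residue 9n[n+1]≈-2 k) ⟩
      + k * (term k * + (54 ℕ.^ k ℕ.* (k !) ℕ.^ 3))        ≡⟨ ℤₚ.*-assoc (+ k) (term k) _ ⟨
      + k * term k * + (54 ℕ.^ k ℕ.* (k !) ℕ.^ 3)          ∎)
      where open ≈-Reasoning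

    +/1-residue : ∀ a → a ℚ./ 1 ↦ a
    +/1-residue a = /-residue a 1 1≉0 (≈-reflexive (sym (ℤₚ.*-identityʳ a)))

    ½-residue : ½ ↦ half
    ½-residue = /-residue (+ 1) 2 2≉0 (≈-sym (≈-trans (≈-reflexive (ℤₚ.*-comm half (+ 2))) 2half≈1))

  -- The case p = 6m + 1

  module Residue≡1 (m′ N : ℕ) (p-prime : Prime (suc N)) (N≡6m : N ≡ 6 ℕ.* suc m′) where
    open Residues N p-prime
    open RationalResidues N p-prime

    m n e : ℕ
    m = suc m′
    n = 2 ℕ.* m
    e = 4 ℕ.* m

    -- (p + 1)/2.
    half : ℤ
    half = + 3 * + m + 1ℤ

    p≡6m+1 : + p ≡ + 6 * + m + 1ℤ
    p≡6m+1 = trans (ℤₚ.+-comm 1ℤ (+ N)) (cong (_+ 1ℤ) (trans (cong +_ N≡6m) (ℤₚ.pos-* 6 m)))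

    6m+1≈0 : + 6 * + m + 1ℤ ≈ 0ℤ
    6m+1≈0 = ≈-trans (≈-reflexive (sym p≡6m+1)) p≈0

    2half≈1 : + 2 * half ≈ 1ℤ
    2half≈1 = ≈-trans (≈-reflexive (eq (+ m))) (+-congʳ 1ℤ 6m+1≈0)
      where
      eq : ∀ m → + 2 * (+ 3 * m + 1ℤ) ≡ + 6 * m + 1ℤ + 1ℤ
      eq = solve-∀

    e+n≡N : e ℕ.+ n ≡ N
    e+n≡N = trans (eq m) (sym N≡6m)
      where
      eq : ∀ m → 4 ℕ.* m ℕ.+ 2 ℕ.* m ≡ 6 ℕ.* m
      eq = ℕ-solver.solve-∀

    n<N : n ℕ.< N
    n<N = subst (n ℕ.<_) e+n≡N (ℕₚ.m<n+m n (s≤s z≤n))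

    -- Here 3n + 1 = p, so n is -1/3 modulo p.
    9n[n+1]≈-2 : + 9 * (+ n * (+ n + 1ℤ)) ≈ - + 2
    9n[n+1]≈-2 = begin
      + 9 * (+ n * (+ n + 1ℤ))                           ≡⟨ cong (λ z → + 9 * (z * (z + 1ℤ))) (ℤₚ.pos-* 2 m) ⟩
      + 9 * (+ 2 * + m * (+ 2 * + m + 1ℤ))               ≡⟨ eq (+ m) ⟩
      (+ 6 * + m + 1ℤ) * (+ 6 * + m + + 2) + - + 2       ≈⟨ +-congʳ (- + 2) (*-congʳ (+ 6 * + m + + 2) 6m+1≈0) ⟩
      0ℤ * (+ 6 * + m + + 2) + - + 2                     ≡⟨ cong (_+ - + 2) (ℤₚ.*-zeroˡ (+ 6 * + m + + 2)) ⟩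
      - + 2                                              ∎
      where
      open ≈-Reasoning
      eq : ∀ m → + 9 * (+ 2 * m * (+ 2 * m + 1ℤ)) ≡ (+ 6 * m + 1ℤ) * (+ 6 * m + + 2) + - + 2
      eq = solve-∀

    3<p : 3 ℕ.< p
    3<p = s≤s (subst (3 ℕ.≤_) (sym N≡6m) (ℕₚ.≤-trans (s≤s (s≤s (s≤s z≤n))) (ℕₚ.m≤m*n 6 m)))

    open LegendreSums N p-prime half 2half≈1 n e e+n≡N n<N
    open TruncatedSums N p-prime 3<p half 2half≈1 n e e+n≡N n<N 9n[n+1]≈-2 public

    half^2m*4^m : half ^ n * (+ 4) ^ m ≈ 1ℤ
    half^2m*4^m = begin
      half ^ (2 ℕ.* m) * (+ 4) ^ m      ≡⟨ cong (_* (+ 4) ^ m) (ℤₚ.^-*-assoc half 2 m) ⟨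
      (half ^ 2) ^ m * (+ 4) ^ m        ≡⟨ ^-distrib-* (half ^ 2) (+ 4) m ⟨
      (half ^ 2 * + 4) ^ m              ≡⟨ cong (_^ m) (eq half) ⟩
      (+ 2 * half * (+ 2 * half)) ^ m   ≈⟨ ^-cong m (*-cong 2half≈1 2half≈1) ⟩
      1ℤ ^ m                            ≡⟨ ℤₚ.^-zeroˡ m ⟩
      1ℤ                                ∎
      where
      open ≈-Reasoning
      eq : ∀ h → h * (h * 1ℤ) * + 4 ≡ + 2 * h * (+ 2 * h)
      eq = solve-∀

    -- As e + 2m = N, the coefficient extracted is the middle one, (-1)ᵐ C(2m, m). It equals 4ᵐ
    -- C(3m, m) modulo p, and 2⁻ⁿ with n = 2m cancels the power of 4.
    ∑term≈3mCm : ∑ (suc n) term ≈ + ((3 ℕ.* m) C m)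
    ∑term≈3mCm = begin
      ∑ (suc n) term
        ≈⟨ ∑term ⟩
      - (half ^ n * ∑ₚ (λ y → y ^ e * (-1ℤ * y ^ 2 + 1ℤ) ^ n))
        ≈⟨ neg-cong (*-congˡ (half ^ n) (extract-coefficient e 2 -1ℤ 1ℤ n small (ℕₚ.m≤m+n m (m ℕ.+ 0)) e+n≡N)) ⟩
      - (half ^ n * - (+ (n C m) * (-1ℤ ^ m * 1ℤ ^ (n ℕ.∸ m))))
        ≡⟨ cong (λ z → - (half ^ n * - (+ (n C m) * (-1ℤ ^ m * z)))) (ℤₚ.^-zeroˡ (n ℕ.∸ m)) ⟩
      - (half ^ n * - (+ (n C m) * (-1ℤ ^ m * 1ℤ)))
        ≡⟨ eq (half ^ n) (+ (n C m)) (-1ℤ ^ m) ⟩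
      half ^ n * (-1ℤ ^ m * + (n C m))
        ≈⟨ *-congˡ (half ^ n) (4^j*3mCj N p-prime m N≡6m m ℕₚ.≤-refl) ⟨
      half ^ n * ((+ 4) ^ m * + ((3 ℕ.* m) C m))
        ≡⟨ ℤₚ.*-assoc (half ^ n) ((+ 4) ^ m) _ ⟨
      half ^ n * (+ 4) ^ m * + ((3 ℕ.* m) C m)
        ≈⟨ *-congʳ (+ ((3 ℕ.* m) C m)) half^2m*4^m ⟩
      1ℤ * + ((3 ℕ.* m) C m)
        ≡⟨ ℤₚ.*-identityˡ (+ ((3 ℕ.* m) C m)) ⟩
      + ((3 ℕ.* m) C m) ∎
      where
      open ≈-Reasoning
      eq : ∀ h c s → - (h * - (c * (s * 1ℤ))) ≡ h * (s * c)
      eq = solve-∀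
      small : e ℕ.+ 2 ℕ.* n ℕ.< N ℕ.+ N
      small = subst (λ k → k ℕ.+ 2 ℕ.* n ℕ.< N ℕ.+ N) (ℕₚ.+-identityʳ e) (exponent-bound 0 n refl)

    n′ : ℕ
    n′ = suc (2 ℕ.* m′)

    n≡1+n′ : n ≡ suc n′
    n≡1+n′ = eq m′
      where
      eq : ∀ k → 2 ℕ.* suc k ≡ suc (suc (2 ℕ.* k))
      eq = ℕ-solver.solve-∀

    -- N is even and e + 1 odd, so the middle sum `T` vanishes. The outer two extract the
    -- coefficients of index m and m - 1 in (1 - y²)^(2m - 1): equal binomials by symmetry, with
    -- opposite signs.
    ∑k*term≈0 : ∑ (suc n) (λ k → + k * term k) ≈ 0ℤ
    ∑k*term≈0 = begin
      ∑ (suc n) (λ k → + k * term k)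
        ≈⟨ ∑k*term n′ n≡1+n′ ⟩
      + n * half ^ n * (T n′ n≡1+n′ 0 + + 2 * T n′ n≡1+n′ 1 + T n′ n≡1+n′ 2)
        ≈⟨ *-congˡ (+ n * half ^ n) (+-cong (+-cong T0≈ (*-congˡ (+ 2) T1≈)) T2≈) ⟩
      + n * half ^ n * (- (+ (n′ C m) * (-1ℤ * -1ℤ ^ m′ * 1ℤ ^ (n′ ℕ.∸ m))) + + 2 * 0ℤ + - (+ (n′ C m′) * (-1ℤ ^ m′ * 1ℤ ^ (n′ ℕ.∸ m′))))
        ≡⟨ cong (λ z → + n * half ^ n * (- (+ (n′ C m) * (-1ℤ * -1ℤ ^ m′ * z)) + + 2 * 0ℤ + - (+ (n′ C m′) * (-1ℤ ^ m′ * 1ℤ ^ (n′ ℕ.∸ m′))))) (ℤₚ.^-zeroˡ (n′ ℕ.∸ m)) ⟩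
      + n * half ^ n * (- (+ (n′ C m) * (-1ℤ * -1ℤ ^ m′ * 1ℤ)) + + 2 * 0ℤ + - (+ (n′ C m′) * (-1ℤ ^ m′ * 1ℤ ^ (n′ ℕ.∸ m′))))
        ≡⟨ cong₂ (λ c z → + n * half ^ n * (- (+ c * (-1ℤ * -1ℤ ^ m′ * 1ℤ)) + + 2 * 0ℤ + - (+ (n′ C m′) * (-1ℤ ^ m′ * z)))) symmetric (ℤₚ.^-zeroˡ (n′ ℕ.∸ m′)) ⟩
      + n * half ^ n * (- (+ (n′ C m′) * (-1ℤ * -1ℤ ^ m′ * 1ℤ)) + + 2 * 0ℤ + - (+ (n′ C m′) * (-1ℤ ^ m′ * 1ℤ)))
        ≡⟨ eq (+ n * half ^ n) (+ (n′ C m′)) (-1ℤ ^ m′) ⟩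
      0ℤ ∎
      where
      open ≈-Reasoning
      eq : ∀ h c s → h * (- (c * (-1ℤ * s * 1ℤ)) + + 2 * 0ℤ + - (c * (s * 1ℤ))) ≡ 0ℤ
      eq = solve-∀
      n′≡m+m′ : n′ ≡ m ℕ.+ m′
      n′≡m+m′ = cong suc (cong (m′ ℕ.+_) (ℕₚ.+-identityʳ m′))
      m≤n′ : m ℕ.≤ n′
      m≤n′ = subst (m ℕ.≤_) (sym n′≡m+m′) (ℕₚ.m≤m+n m m′)
      symmetric : n′ C m ≡ n′ C m′
      symmetric = trans (nCk≡nC[n∸k] m≤n′) (cong (n′ C_) (trans (cong (ℕ._∸ m) n′≡m+m′) (ℕₚ.m+n∸m≡n m m′)))
      2+2n′≡2n : 2 ℕ.+ 2 ℕ.* n′ ≡ 2 ℕ.* n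
      2+2n′≡2n = trans (eq₁ n′) (cong (2 ℕ.*_) (sym n≡1+n′))
        where
        eq₁ : ∀ k → 2 ℕ.+ 2 ℕ.* k ≡ 2 ℕ.* suc k
        eq₁ = ℕ-solver.solve-∀
      small : ∀ {i} → i ℕ.≤ 2 → e ℕ.+ i ℕ.+ 2 ℕ.* n′ ℕ.< N ℕ.+ N
      small {i} i≤2 = ℕₚ.≤-<-trans (ℕₚ.+-monoˡ-≤ (2 ℕ.* n′) (ℕₚ.+-monoʳ-≤ e i≤2)) (exponent-bound 2 n′ 2+2n′≡2n)
      T0≈ : T n′ n≡1+n′ 0 ≈ - (+ (n′ C m) * (-1ℤ * -1ℤ ^ m′ * 1ℤ ^ (n′ ℕ.∸ m)))
      T0≈ = extract-coefficient (e ℕ.+ 0) 2 -1ℤ 1ℤ n′ (small z≤n) m≤n′ (trans (cong (ℕ._+ n) (ℕₚ.+-identityʳ e)) e+n≡N)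
      T1≈ : T n′ n≡1+n′ 1 ≈ 0ℤ
      T1≈ = no-coefficient (e ℕ.+ 1) 2 -1ℤ 1ℤ n′ (small (s≤s z≤n)) λ i odd≡N →
        ℕₚ.even≢odd (3 ℕ.* m) (2 ℕ.* m ℕ.+ i) (trans (eq₁ m) (trans (sym N≡6m) (trans (sym odd≡N) (eq₂ m i))))
        where
        eq₁ : ∀ m → 2 ℕ.* (3 ℕ.* m) ≡ 6 ℕ.* m
        eq₁ = ℕ-solver.solve-∀
        eq₂ : ∀ m i → 4 ℕ.* m ℕ.+ 1 ℕ.+ 2 ℕ.* i ≡ suc (2 ℕ.* (2 ℕ.* m ℕ.+ i))
        eq₂ = ℕ-solver.solve-∀
      T2≈ : T n′ n≡1+n′ 2 ≈ - (+ (n′ C m′) * (-1ℤ ^ m′ * 1ℤ ^ (n′ ℕ.∸ m′)))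
      T2≈ = extract-coefficient (e ℕ.+ 2) 2 -1ℤ 1ℤ n′ (small ℕₚ.≤-refl) (ℕₚ.≤-trans (ℕₚ.n≤1+n m′) m≤n′) (trans (eq₁ m′) (sym N≡6m))
        where
        eq₁ : ∀ m → 4 ℕ.* suc m ℕ.+ 2 ℕ.+ 2 ℕ.* m ≡ 6 ℕ.* suc m
        eq₁ = ℕ-solver.solve-∀

    p/3≡n : p ℕ./ 3 ≡ n
    p/3≡n = trans (cong (ℕ._/ 3) (cong suc (trans N≡6m (eq m)))) ([r+k*d]/d 1 n 3 refl)
      where
      eq : ∀ m → 6 ℕ.* m ≡ 2 ℕ.* m ℕ.* 3
      eq = ℕ-solver.solve-∀

    weighted-sum≡0 : ∑≤ (p ℕ./ 3) weighted-summand ≡ 0ℚ [mod p ]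
    weighted-sum≡0 = subst (λ k → ∑≤ k weighted-summand ≡ 0ℚ [mod p ]) (sym p/3≡n)
      (residue⇒≡ weighted-sum-residue 0-residue ∑k*term≈0)

    sum≡2A : ∀ A B → + p ≡ A ^ 2 + + 3 * B ^ 2 → + 3 Unsigned.∣ A - 1ℤ → ∑≤ (p ℕ./ 3) summand ≡ (+ 2 * A) ℚ./ 1 [mod p ]
    sum≡2A A B p≡ 3∣A-1 = subst (λ k → ∑≤ k summand ≡ (+ 2 * A) ℚ./ 1 [mod p ]) (sym p/3≡n)
      (residue⇒≡ sum-residue (+/1-residue (+ 2 * A))
        (≈-trans ∑term≈3mCm (≈-sym (2A≈3mCm N p-prime m N≡6m A B (trans p≡ (eq A B)) 3∣A-1))))
      where
      eq : ∀ A B → A * (A * 1ℤ) + + 3 * (B * (B * 1ℤ)) ≡ A * A + + 3 * (B * B)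
      eq = solve-∀

  -- The case p = 6m + 5

  module Residue≡5 (m N : ℕ) (p-prime : Prime (suc N)) (N≡6m+4 : N ≡ 4 ℕ.+ 6 ℕ.* m) where
    open Residues N p-prime
    open RationalResidues N p-prime

    n e : ℕ
    n = suc (2 ℕ.* m)
    e = 4 ℕ.* m ℕ.+ 3

    -- p + 1 = 6(m + 1) is divisible by 2 and by 3, so `half` and `third` are the integers (p + 1)/2
    -- and (p + 1)/3.
    half : ℤ
    half = + 3 * + m + + 3

    third : ℤ
    third = + 2 * + suc m

    p≡6m+5 : + p ≡ + 6 * + m + + 5
    p≡6m+5 = trans (cong (λ k → + suc k) N≡6m+4) (trans (ℤₚ.+-comm (+ 5) (+ (6 ℕ.* m))) (cong (_+ + 5) (ℤₚ.pos-* 6 m)))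

    6m+5≈0 : + 6 * + m + + 5 ≈ 0ℤ
    6m+5≈0 = ≈-trans (≈-reflexive (sym p≡6m+5)) p≈0

    2half≈1 : + 2 * half ≈ 1ℤ
    2half≈1 = ≈-trans (≈-reflexive (eq (+ m))) (+-congʳ 1ℤ 6m+5≈0)
      where
      eq : ∀ m → + 2 * (+ 3 * m + + 3) ≡ + 6 * m + + 5 + 1ℤ
      eq = solve-∀

    third*3≈1 : third * + 3 ≈ 1ℤ
    third*3≈1 = ≈-trans (≈-reflexive (eq (+ m))) (+-congʳ 1ℤ 6m+5≈0)
      where
      eq : ∀ m → + 2 * (1ℤ + m) * + 3 ≡ + 6 * m + + 5 + 1ℤ
      eq = solve-∀

    e+n≡N : e ℕ.+ n ≡ N
    e+n≡N = trans (eq m) (sym N≡6m+4)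
      where
      eq : ∀ m → 4 ℕ.* m ℕ.+ 3 ℕ.+ suc (2 ℕ.* m) ≡ 4 ℕ.+ 6 ℕ.* m
      eq = ℕ-solver.solve-∀

    n<N : n ℕ.< N
    n<N = subst (n ℕ.<_) e+n≡N (ℕₚ.m<n+m n (subst (0 ℕ.<_) (ℕₚ.+-comm 3 (4 ℕ.* m)) (s≤s z≤n)))

    -- Here 3n + 2 = p, so n is -2/3 modulo p.
    9n[n+1]≈-2 : + 9 * (+ n * (+ n + 1ℤ)) ≈ - + 2
    9n[n+1]≈-2 = begin
      + 9 * (+ n * (+ n + 1ℤ))                           ≡⟨ cong (λ z → + 9 * ((1ℤ + z) * ((1ℤ + z) + 1ℤ))) (ℤₚ.pos-* 2 m) ⟩
      + 9 * ((1ℤ + + 2 * + m) * ((1ℤ + + 2 * + m) + 1ℤ)) ≡⟨ eq (+ m) ⟩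
      (+ 6 * + m + + 5) * (+ 6 * + m + + 4) + - + 2      ≈⟨ +-congʳ (- + 2) (*-congʳ (+ 6 * + m + + 4) 6m+5≈0) ⟩
      0ℤ * (+ 6 * + m + + 4) + - + 2                     ≡⟨ cong (_+ - + 2) (ℤₚ.*-zeroˡ (+ 6 * + m + + 4)) ⟩
      - + 2                                              ∎
      where
      open ≈-Reasoning
      eq : ∀ m → + 9 * ((1ℤ + + 2 * m) * ((1ℤ + + 2 * m) + 1ℤ)) ≡ (+ 6 * m + + 5) * (+ 6 * m + + 4) + - + 2
      eq = solve-∀

    3<p : 3 ℕ.< p
    3<p = s≤s (subst (3 ℕ.≤_) (sym N≡6m+4) (s≤s (s≤s (s≤s z≤n))))

    open LegendreSums N p-prime half 2half≈1 n e e+n≡N n<N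
    open TruncatedSums N p-prime 3<p half 2half≈1 n e e+n≡N n<N 9n[n+1]≈-2 public

    -- e = 4m + 3 is odd while N is even: an even polynomial times y^e has no term in y^N.
    even-exponent≢N : ∀ i → e ℕ.+ 2 ℕ.* i ≢ N
    even-exponent≢N i e+2i≡N = ℕₚ.even≢odd (2 ℕ.+ 3 ℕ.* m) (suc (2 ℕ.* m) ℕ.+ i) (trans (eq₁ m) (trans (sym N≡6m+4) (trans (sym e+2i≡N) (eq₂ m i))))
      where
      eq₁ : ∀ m → 2 ℕ.* (2 ℕ.+ 3 ℕ.* m) ≡ 4 ℕ.+ 6 ℕ.* m
      eq₁ = ℕ-solver.solve-∀
      eq₂ : ∀ m i → 4 ℕ.* m ℕ.+ 3 ℕ.+ 2 ℕ.* i ≡ suc (2 ℕ.* (suc (2 ℕ.* m) ℕ.+ i))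
      eq₂ = ℕ-solver.solve-∀

    ∑term≈0 : ∑ (suc n) term ≈ 0ℤ
    ∑term≈0 = begin
      ∑ (suc n) term
        ≈⟨ ∑term ⟩
      - (half ^ n * ∑ₚ (λ y → y ^ e * (-1ℤ * y ^ 2 + 1ℤ) ^ n))
        ≈⟨ neg-cong (*-congˡ (half ^ n) (no-coefficient e 2 -1ℤ 1ℤ n small even-exponent≢N)) ⟩
      - (half ^ n * 0ℤ)
        ≡⟨ cong -_ (ℤₚ.*-zeroʳ (half ^ n)) ⟩
      0ℤ ∎
      where
      open ≈-Reasoning
      small : e ℕ.+ 2 ℕ.* n ℕ.< N ℕ.+ N
      small = subst (λ k → k ℕ.+ 2 ℕ.* n ℕ.< N ℕ.+ N) (ℕₚ.+-identityʳ e) (exponent-bound 0 n refl)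

    -- By parity only the summand 2y of (1 + y)² reaches the exponent N, which gives (-1)ᵐ C(2m, m).
    -- The prefactor n = 2m + 1 is what the central binomial recursion needs to pass to C(2m + 2, m
    -- + 1).
    ∑k*term≈ : ∑ (suc n) (λ k → + k * term k) ≈
               third * -1ℤ ^ suc m * half ^ (2 ℕ.* suc m) * + ((2 ℕ.* suc m) C suc m)
    ∑k*term≈ = begin
      ∑ (suc n) (λ k → + k * term k)
        ≈⟨ ∑k*term n′ refl ⟩
      + n * half ^ n * (T n′ refl 0 + + 2 * T n′ refl 1 + T n′ refl 2)
        ≈⟨ *-congˡ (+ n * half ^ n) (+-cong (+-cong T0≈ (*-congˡ (+ 2) T1≈)) T2≈) ⟩
      + n * half ^ n * (0ℤ + + 2 * - (+ (n′ C m) * (-1ℤ ^ m * 1ℤ ^ (n′ ℕ.∸ m))) + 0ℤ)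
        ≡⟨ cong₂ (λ k z → (1ℤ + k) * (half * half ^ n′) * (0ℤ + + 2 * - (+ (n′ C m) * (-1ℤ ^ m * z)) + 0ℤ)) (ℤₚ.pos-* 2 m) (ℤₚ.^-zeroˡ (n′ ℕ.∸ m)) ⟩
      (1ℤ + + 2 * + m) * (half * half ^ n′) * (0ℤ + + 2 * - (+ (n′ C m) * (-1ℤ ^ m * 1ℤ)) + 0ℤ)
        ≡⟨ eq₁ (+ m) half (half ^ n′) (+ (n′ C m)) (-1ℤ ^ m) ⟩
      -- The 1 is replaced by 2 · `half`: this raises the power of `half` from n = 2m + 1 to 2(m +
      -- 1) = (p + 1)/3 and supplies the factor 2 of the recursion.
      1ℤ * (+ 2 * half * ((+ 2 * + m + 1ℤ) * + (n′ C m) * (-1ℤ * -1ℤ ^ m * half ^ n′)))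
        ≈⟨ *-congʳ (+ 2 * half * ((+ 2 * + m + 1ℤ) * + (n′ C m) * (-1ℤ * -1ℤ ^ m * half ^ n′))) 2half≈1 ⟨
      + 2 * half * (+ 2 * half * ((+ 2 * + m + 1ℤ) * + (n′ C m) * (-1ℤ * -1ℤ ^ m * half ^ n′)))
        ≡⟨ eq₂ (+ m) half (half ^ n′) (+ (n′ C m)) (-1ℤ ^ m) ⟩
      + 2 * (-1ℤ * -1ℤ ^ m) * (half * (half * half ^ n′)) * (+ 2 * ((+ 2 * + m + 1ℤ) * + (n′ C m)))
        ≡⟨ cong (λ z → + 2 * (-1ℤ * -1ℤ ^ m) * (half * (half * half ^ n′)) * z) (central-binomial-step m) ⟨
      + 2 * (-1ℤ * -1ℤ ^ m) * (half * (half * half ^ n′)) * (+ suc m * + ((2 ℕ.* suc m) C suc m))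
        ≡⟨ eq₃ (+ suc m) (-1ℤ * -1ℤ ^ m) (half * (half * half ^ n′)) (+ ((2 ℕ.* suc m) C suc m)) ⟩
      third * -1ℤ ^ suc m * half ^ suc (suc n′) * + ((2 ℕ.* suc m) C suc m)
        ≡⟨ cong (λ k → third * -1ℤ ^ suc m * half ^ k * + ((2 ℕ.* suc m) C suc m)) (eq₄ m) ⟩
      third * -1ℤ ^ suc m * half ^ (2 ℕ.* suc m) * + ((2 ℕ.* suc m) C suc m) ∎
      where
      open ≈-Reasoning
      n′ : ℕ
      n′ = 2 ℕ.* m
      eq₁ : ∀ m h x c s → (1ℤ + + 2 * m) * (h * x) * (0ℤ + + 2 * - (c * (s * 1ℤ)) + 0ℤ) ≡
                          1ℤ * (+ 2 * h * ((+ 2 * m + 1ℤ) * c * (-1ℤ * s * x)))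
      eq₁ = solve-∀
      eq₂ : ∀ m h x c s → + 2 * h * (+ 2 * h * ((+ 2 * m + 1ℤ) * c * (-1ℤ * s * x))) ≡
                          + 2 * (-1ℤ * s) * (h * (h * x)) * (+ 2 * ((+ 2 * m + 1ℤ) * c))
      eq₂ = solve-∀
      eq₃ : ∀ a s x c → + 2 * s * x * (a * c) ≡ + 2 * a * s * x * c
      eq₃ = solve-∀
      eq₄ : ∀ m → suc (suc (2 ℕ.* m)) ≡ 2 ℕ.* suc m
      eq₄ = ℕ-solver.solve-∀
      small : ∀ {i} → i ℕ.≤ 2 → e ℕ.+ i ℕ.+ 2 ℕ.* n′ ℕ.< N ℕ.+ N
      small {i} i≤2 = ℕₚ.≤-<-trans (ℕₚ.+-monoˡ-≤ (2 ℕ.* n′) (ℕₚ.+-monoʳ-≤ e i≤2)) (exponent-bound 2 n′ (eq₅ n′))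
        where
        eq₅ : ∀ k → 2 ℕ.+ 2 ℕ.* k ≡ 2 ℕ.* suc k
        eq₅ = ℕ-solver.solve-∀
      T0≈ : T n′ refl 0 ≈ 0ℤ
      T0≈ = no-coefficient (e ℕ.+ 0) 2 -1ℤ 1ℤ n′ (small z≤n) λ i ≡N →
        even-exponent≢N i (trans (cong (ℕ._+ 2 ℕ.* i) (sym (ℕₚ.+-identityʳ e))) ≡N)
      T1≈ : T n′ refl 1 ≈ - (+ (n′ C m) * (-1ℤ ^ m * 1ℤ ^ (n′ ℕ.∸ m)))
      T1≈ = extract-coefficient (e ℕ.+ 1) 2 -1ℤ 1ℤ n′ (small (s≤s z≤n)) (ℕₚ.m≤m+n m (m ℕ.+ 0)) (trans (eq₅ m) (sym N≡6m+4))
        where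
        eq₅ : ∀ m → 4 ℕ.* m ℕ.+ 3 ℕ.+ 1 ℕ.+ 2 ℕ.* m ≡ 4 ℕ.+ 6 ℕ.* m
        eq₅ = ℕ-solver.solve-∀
      T2≈ : T n′ refl 2 ≈ 0ℤ
      T2≈ = no-coefficient (e ℕ.+ 2) 2 -1ℤ 1ℤ n′ (small ℕₚ.≤-refl) λ i ≡N →
        even-exponent≢N (suc i) (trans (eq₅ e i) ≡N)
        where
        eq₅ : ∀ e i → e ℕ.+ 2 ℕ.* suc i ≡ e ℕ.+ 2 ℕ.+ 2 ℕ.* i
        eq₅ = ℕ-solver.solve-∀

    p/3≡n : p ℕ./ 3 ≡ n
    p/3≡n = trans (cong (ℕ._/ 3) (cong suc (trans N≡6m+4 (eq m)))) ([r+k*d]/d 2 n 3 refl)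
      where
      eq : ∀ m → 4 ℕ.+ 6 ℕ.* m ≡ suc (suc (2 ℕ.* m) ℕ.* 3)
      eq = ℕ-solver.solve-∀

    [p+1]/6≡ : (p ℕ.+ 1) ℕ./ 6 ≡ suc m
    [p+1]/6≡ = trans (cong (λ k → (suc k ℕ.+ 1) ℕ./ 6) N≡6m+4) (trans (cong (ℕ._/ 6) (eq m)) ([r+k*d]/d 0 (suc m) 6 refl))
      where
      eq : ∀ m → 5 ℕ.+ 6 ℕ.* m ℕ.+ 1 ≡ suc m ℕ.* 6
      eq = ℕ-solver.solve-∀

    [p+1]/3≡ : (p ℕ.+ 1) ℕ./ 3 ≡ 2 ℕ.* suc m
    [p+1]/3≡ = trans (cong (λ k → (suc k ℕ.+ 1) ℕ./ 3) N≡6m+4) (trans (cong (ℕ._/ 3) (eq m)) ([r+k*d]/d 0 (2 ℕ.* suc m) 3 refl))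
      where
      eq : ∀ m → 5 ℕ.+ 6 ℕ.* m ℕ.+ 1 ≡ 2 ℕ.* suc m ℕ.* 3
      eq = ℕ-solver.solve-∀

    ⅓-residue : + 1 ℚ./ 3 ↦ third
    ⅓-residue = /-residue (+ 1) 3 3≉0 (≈-sym third*3≈1)

    -1-residue : ℚ.- 1ℚ ↦ -1ℤ
    -1-residue = neg-residue 1-residue

    sum≡0 : ∑≤ (p ℕ./ 3) summand ≡ 0ℚ [mod p ]
    sum≡0 = subst (λ k → ∑≤ k summand ≡ 0ℚ [mod p ]) (sym p/3≡n) (residue⇒≡ sum-residue 0-residue ∑term≈0)

    -- The quotients (p + 1)/6 and (p + 1)/3 are made arguments, so that their values m + 1 and 2(m
    -- + 1) can be substituted for them.
    right-hand-side : ℕ → ℕ → ℚ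
    right-hand-side a b = (+ 1 ℚ./ 3) ℚ.* ((ℚ.- 1ℚ) ^ℚ a) ℚ.* (½ ^ℚ b) ℚ.* (+ (b C a) ℚ./ 1)

    right-hand-side-residue : ∀ a b → right-hand-side a b ↦ third * -1ℤ ^ a * half ^ b * + (b C a)
    right-hand-side-residue a b = *-residue (*-residue (*-residue
      ⅓-residue (^-residue a -1-residue)) (^-residue b ½-residue)) (+/1-residue (+ (b C a)))

    weighted-sum≡ : ∑≤ (p ℕ./ 3) weighted-summand ≡ right-hand-side ((p ℕ.+ 1) ℕ./ 6) ((p ℕ.+ 1) ℕ./ 3) [mod p ]
    weighted-sum≡ = subst (λ k → ∑≤ k weighted-summand ≡ right-hand-side ((p ℕ.+ 1) ℕ./ 6) ((p ℕ.+ 1) ℕ./ 3) [mod p ]) (sym p/3≡n)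
      (subst₂ (λ a b → ∑≤ n weighted-summand ≡ right-hand-side a b [mod p ]) (sym [p+1]/6≡) (sym [p+1]/3≡)
        (residue⇒≡ weighted-sum-residue (right-hand-side-residue (suc m) (2 ℕ.* suc m)) ∑k*term≈))

  6∣⇒6*suc : ∀ {k} → 0 ℕ.< k → 6 ℕ∣.∣ k → ∃ λ m → k ≡ 6 ℕ.* suc m
  6∣⇒6*suc 0<k (ℕ∣.divides zero refl)     = contradiction 0<k λ ()
  6∣⇒6*suc _   (ℕ∣.divides (suc m) k≡m*6) = m , trans k≡m*6 (ℕₚ.*-comm (suc m) 6)

  -- For p = `suc N`, p ∸ 5 reduces to N ∸ 4; the bound ensures that this subtraction is not
  -- truncated.
  6∣∸4⇒4+6* : ∀ {k} → 4 ℕ.≤ k → 6 ℕ∣.∣ k ℕ.∸ 4 → ∃ λ m → k ≡ 4 ℕ.+ 6 ℕ.* m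
  6∣∸4⇒4+6* {k} 4≤k (ℕ∣.divides m k∸4≡m*6) =
    m , trans (sym (ℕₚ.m+[n∸m]≡n 4≤k)) (cong (4 ℕ.+_) (trans k∸4≡m*6 (ℕₚ.*-comm m 6)))

open import Defs
open import Data.Integer.Base as ℤ using (ℤ; +_)
open import Data.Integer.Divisibility as ℤ using ()
open import Data.Nat.Base using (ℕ; suc; s≤s; z≤n; _+_; _*_; _∸_; _/_; _^_; _>_; _!)
open import Data.Nat.Combinatorics using (_C_)
open import Data.Nat.Divisibility using (_∣_)
open import Data.Nat.Primality using (Prime)
open import Data.Nat.Properties using (≤-trans; m≤n+m)
open import Data.Product.Base using (_×_; _,_; proj₁; proj₂)
open import Data.Rational.Base as ℚ using (ℚ; 0ℚ; 1ℚ; ½)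
open import Relation.Binary.PropositionalEquality.Core using (_≡_)

open Lemmas using (module Residue≡1; module Residue≡5; 6∣⇒6*suc; 6∣∸4⇒4+6*)

theorem2p5 : (p : ℕ) → Prime p → p > 5 →
    ( (6 ∣ p ∸ 5 →
    ∑[ k ≤ p / 3 ] (+ ((3 * k) !) ℚ./ (54 ^ k * (k !) ^ 3)) {{54^k*k!³≢0 k}} ≡ 0ℚ [mod p ])
    × (6 ∣ p ∸ 1 → (A B : ℤ) →
    + p ≡ A ℤ.^ 2 ℤ.+ + 3 ℤ.* B ℤ.^ 2 → + 3 ℤ.∣ A ℤ.- + 1 →
    ∑[ k ≤ p / 3 ] (+ ((3 * k) !) ℚ./ (54 ^ k * (k !) ^ 3)) {{54^k*k!³≢0 k}} ≡ (+ 2 ℤ.* A) ℚ./ 1 [mod p ]) )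
    × ( (6 ∣ p ∸ 1 →
    ∑[ k ≤ p / 3 ] (+ (k * (3 * k) !) ℚ./ (54 ^ k * (k !) ^ 3)) {{54^k*k!³≢0 k}} ≡ 0ℚ [mod p ])
    × (6 ∣ p ∸ 5 →
    ∑[ k ≤ p / 3 ] (+ (k * (3 * k) !) ℚ./ (54 ^ k * (k !) ^ 3)) {{54^k*k!³≢0 k}}
    ≡ (+ 1 ℚ./ 3) ℚ.* ((ℚ.- 1ℚ) ^ℚ ((p + 1) / 6)) ℚ.* (½ ^ℚ ((p + 1) / 3))
    ℚ.* (+ (((p + 1) / 3) C ((p + 1) / 6)) ℚ./ 1) [mod p ]) )
theorem2p5 (suc N) p-prime (s≤s 5≤N) =
  ( (λ 6∣p-5 → let m , N≡6m+4 = 6∣∸4⇒4+6* 4≤N 6∣p-5 in Residue≡5.sum≡0 m N p-prime N≡6m+4)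
  , (λ 6∣p-1 → let m , N≡6+6m = 6∣⇒6*suc 0<N 6∣p-1 in Residue≡1.sum≡2A m N p-prime N≡6+6m) )
  , ( (λ 6∣p-1 → let m , N≡6+6m = 6∣⇒6*suc 0<N 6∣p-1 in Residue≡1.weighted-sum≡0 m N p-prime N≡6+6m)
  , (λ 6∣p-5 → let m , N≡6m+4 = 6∣∸4⇒4+6* 4≤N 6∣p-5 in Residue≡5.weighted-sum≡ m N p-prime N≡6m+4) )
  where
  4≤N = ≤-trans (m≤n+m 4 1) 5≤N
  0<N = ≤-trans (m≤n+m 1 4) 5≤N
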